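{- Assume that $\xi_p\in F$; that if $p=2$ and $n=1$ then $-1\in N_{K/F}(K^\times)$; and that we are not in the case ($p=2$ and $\omega=1<\nu$). Let $m\ge 1$ and let $(\mathbf a,d)$ be a minimal norm pair of length $m$. Then: (1) If $\omega<\nu$, then for every integer $\tilde d$ with $\tilde d\equiv d \pmod{p^\nu}$ (when $\nu=\infty$ this means $\tilde d=d$), the pair $(\mathbf a,\tilde d)$ is a minimal norm pair of length $m$. (2) If $\omega=\nu$, then $d\equiv 1\pmod{p^m}$. (3) $d\equiv \chi(\sigma)\pmod{p^{\min\{m,\nu\}}}$, where $\chi$ is the cyclotomic character of $K/F$.
   Context: Let $p$ be a prime, $n\ge1$, and $K/F$ a cyclic Galois extension of degree $p^n$ with $\mathrm{char}(K)\neq p$; $G=\mathrm{Gal}(K/F)=\langle\sigma\rangle$. For $0\le i\le n$ let $K_i$ be the intermediate field with $[K_i:F]=p^i$. For $k\ge1$, $\xi_{p^k}$ denotes a primitive $p^k$-th root of unity (in an algebraic closure) and $\mu_{p^k}$ the group of $p^k$-th roots of unity. Put $\omega=\infty$ if $\mu_{p^k}\subseteq F$ for all $k$, otherwise $\omega$ is the integer with $\mu_{p^\omega}\subseteq F$, $\mu_{p^{\omega+1}}\not\subseteq F$; define $\nu$ the same way with $K$ in place of $F$. $U_i=1+p^i\mathbb Z$, and $v_p$ is the $p$-adic valuation. Conventions: $-\infty$ is smaller than every integer, $-\infty+c=-\infty$, $p^{ -\infty}=0$. Norm pair: for $m\ge1$, a pair $(\mathbf a,d)$ with $\mathbf a=(a_0,\dots,a_{m-1})\in\{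 -\infty,0,1,\dots,n\}^m$, $a_0<n$, and $d\in U_1$ is a norm pair of length $m$ if there exist $\alpha,\delta_m\in K^\times$ and $\delta_i\in K_{a_i}^\times$ for $0\le i<m$ (with $\delta_i=1$ when $a_i=-\infty$) such that $\sigma(\alpha)=\alpha^d\delta_0\delta_1^p\cdots\delta_m^{p^m}$ and $\xi_p=N_{K/F}(\alpha)^{(d-1)/p}\,N_{K_{n-1}/F}(\delta_0)\prod_{i=1}^m N_{K/F}(\delta_i)^{p^{i-1}}$ for a fixed primitive $p$-th root of unity $\xi_p$; one says $(\alpha,\{\delta_i\}_{i=0}^m)$ represents $(\mathbf a,d)$. Order: $(\mathbf a,d)\le(\mathbf a',d')$ if $\mathbf a<\mathbf a'$ lexicographically, or $\mathbf a=\mathbf a'$ and $\min\{v_p(d'-1),m\}\le\min\{v_p(d-1),m\}$. A norm pair of length $m$ is minimal if it is $\le$ every norm pair of length $m$. Cyclotomic character: $\chi(\sigma)$ is the element of $(\mathbb Z/p^\nu\mathbb Z)^\times$ (of $\mathbb Z_p^\times$ if $\nu=\infty$) with $\sigma(\zeta)=\zeta^{\chi(\sigma)}$ for all $\zeta\in\mu_{p^\nu}$ (all $p$-power roots of unity if $\nu=\infty$). -}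

module Defs where

open import Algebra.Apartness.Bundles using (HeytingCommutativeRing; HeytingField)
open import Algebra.Bundles using (AbelianGroup; CommutativeRing)
open import Algebra.Morphism.Structures
  using (IsRingMonomorphism; IsRingIsomorphism)
import Algebra.Definitions
import Algebra.Definitions.RawMonoid
import Algebra.Properties.Semiring.Exp
open import Data.Bool.Base using (if_then_else_)
open import Data.Fin.Base using (Fin; zero; suc; toℕ; fromℕ; inject₁) renaming (_<_ to _<ᶠ_)
open import Data.Integer.Base using (ℤ; +_; -[1+_]; 1ℤ; ∣_∣) renaming (_-_ to _-ᶻ_)
open import Data.Integer.Divisibility.Signed using (quotient) renaming (_∣_ to _∣ᶻ_)
open import Data.Nat.Base as ℕ using (ℕ; zero; suc; _≤_; _∸_; _⊓_)
open import Data.Nat.Coprimality using (Coprime)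
open import Data.Nat.Divisibility using (_∣_; _∣?_)
open import Data.Nat.GeneralisedArithmetic using (iterate)
open import Data.Product.Base using (Σ-syntax; ∃; ∃-syntax; _×_; _,_; proj₁; proj₂)
open import Data.Sum.Base using (_⊎_)
open import Data.Vec.Base using (Vec; lookup)
open import Data.Vec.Functional using (Vector)
open import Data.Vec.Relation.Binary.Lex.Strict using (Lex-<)
open import Function.Bundles using (_⇔_)
open import Level using (Level; _⊔_) renaming (suc to lsuc)
open import Relation.Binary.PropositionalEquality.Core using (_≡_)
open import Relation.Nullary.Construct.Add.Infimum using (_₋; ⊥₋; [_])
open import Relation.Nullary.Construct.Add.Supremum using (_⁺; ⊤⁺)
open import Relation.Nullary.Decidable.Core using (does)
open import Relation.Nullary.Negation.Core using (¬_)
open import Relation.Unary using (Pred; _∈_; _⊆_; U)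
import Relation.Binary.Construct.Add.Infimum.Strict as AddInfimum
import Relation.Binary.Construct.Add.Supremum.Strict as AddSupremum

open AddSupremum ℕ._<_ public using (_<⁺_)

------------------------------------------------------------------------
-- Arithmetic in ℕ ∪ {∞} and p-adic valuations

_⊓⁺_ : ℕ → ℕ ⁺ → ℕ
m ⊓⁺ [ e ] = m ⊓ e
m ⊓⁺ ⊤⁺    = m

greatestExponent : (p x bound : ℕ) → ℕ
greatestExponent p x zero    = 0
greatestExponent p x (suc k) =
  if does (p ℕ.^ suc k ∣? x) then suc k else greatestExponent p x k

-- For p ≥ 2 and x ≢ 0, p ^ k ∣ x forces k ≤ ∣ x ∣, so the search bound is
-- harmless.
valuation : ℕ → ℤ → ℕ ⁺
valuation p (+ 0) = ⊤⁺
valuation p x     = [ greatestExponent p ∣ x ∣ ∣ x ∣ ]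

-- Congruence modulo p ^ ν; it is equality when ν is infinite (p ^ ∞ = 0).
CongruentMod : (p : ℕ) → ℕ ⁺ → ℤ → ℤ → Set
CongruentMod p [ e ] x y = + (p ℕ.^ e) ∣ᶻ (x -ᶻ y)
CongruentMod p ⊤⁺    x y = x ≡ y

-- A p-adic integer as a coherent sequence of representatives of its residues
-- modulo the powers of p.
record ℤₚ (p : ℕ) : Set where
  field
    residue  : ℕ → ℤ
    coherent : ∀ k → + (p ℕ.^ k) ∣ᶻ (residue (suc k) -ᶻ residue k)

-- Elements of ℤ / p ^ ν (given by integer representatives), or of ℤₚ when ν is
-- infinite.
ℤ/_^_ : ℕ → ℕ ⁺ → Set
ℤ/ p ^ [ e ] = ℤ
ℤ/ p ^ ⊤⁺    = ℤₚ p

-- A representative modulo p ^ k; only meaningful for k ≤ ν.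
residueMod : (p : ℕ) (ν : ℕ ⁺) → ℤ/ p ^ ν → ℕ → ℤ
residueMod p [ e ] x k = x
residueMod p ⊤⁺    x k = ℤₚ.residue x k

IsUnitMod : (p : ℕ) (ν : ℕ ⁺) → ℤ/ p ^ ν → Set
IsUnitMod p [ e ] x = Coprime ∣ x ∣ (p ℕ.^ e)
IsUnitMod p ⊤⁺    x = ∀ k → Coprime ∣ ℤₚ.residue x k ∣ (p ℕ.^ k)

------------------------------------------------------------------------
-- Fields

module FieldOps {c ℓ₁ ℓ₂} (K : HeytingField c ℓ₁ ℓ₂) where

  open HeytingField K public
    using (Carrier; _≈_; _#_; _+_; _*_; -_; 0#; 1#; heytingCommutativeRing)

  commutativeRing : CommutativeRing c ℓ₁
  commutativeRing = HeytingCommutativeRing.commutativeRing heytingCommutativeRing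

  open CommutativeRing commutativeRing public
    using (rawRing; semiring; commutativeSemiring; +-rawMonoid)
  open Algebra.Definitions.RawMonoid +-rawMonoid public
    using (sum) renaming (_×_ to _·ℕ_)
  open Algebra.Properties.Semiring.Exp semiring public using (_^_)

  HasCharacteristic : ℕ → Set ℓ₁
  HasCharacteristic q = ∀ k → (k ·ℕ 1# ≈ 0#) ⇔ (q ∣ k)

  IsPrimitiveRoot : ℕ → Carrier → Set ℓ₁
  IsPrimitiveRoot r ζ = (ζ ^ r ≈ 1#) × (∀ k → ζ ^ k ≈ 1# → r ∣ k)

  -- X ^ d + c₍d₋₁₎ X ^ (d - 1) + ⋯ + c₀ evaluated at x.
  evalMonic : ∀ {d} → Vector Carrier d → Carrier → Carrier
  evalMonic {d} coeff x = x ^ d + sum (λ i → coeff i * x ^ toℕ i)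

  IsAlgebraicallyClosed : Set (c ⊔ ℓ₁)
  IsAlgebraicallyClosed =
    ∀ d (coeff : Vector Carrier (suc d)) → ∃[ x ] evalMonic coeff x ≈ 0#

  Invertible : Carrier → Set (c ⊔ ℓ₁)
  Invertible = Algebra.Definitions.Invertible _≈_ 1# _*_

  private
    open CommutativeRing commutativeRing
      using (*-assoc; *-comm; *-cong; *-identityˡ; *-identityʳ; refl; sym; trans)

    invertible : ∀ {x y} → x * y ≈ 1# → Invertible x
    invertible xy≈1 = _ , trans (*-comm _ _) xy≈1 , xy≈1

    exchange : ∀ w x y z → (w * x) * (y * z) ≈ (w * y) * (x * z)
    exchange w x y z =
      trans (*-assoc w x (y * z))
     (trans (*-cong refl (trans (sym (*-assoc x y z))
                         (trans (*-cong (*-comm x y) refl) (*-assoc y x z))))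
            (sym (*-assoc w y (x * z))))

    ∙-invertible : ∀ {x y} → Invertible x → Invertible y → Invertible (x * y)
    ∙-invertible {x} {y} (x⁻¹ , _ , p) (y⁻¹ , _ , q) = invertible
      (trans (exchange x y x⁻¹ y⁻¹) (trans (*-cong p q) (*-identityˡ 1#)))

  unitGroup : AbelianGroup (c ⊔ ℓ₁) ℓ₁
  unitGroup = record
    { Carrier = ∃ Invertible
    ; _≈_     = λ u v → proj₁ u ≈ proj₁ v
    ; _∙_     = λ { (x , ix) (y , iy) → x * y , ∙-invertible ix iy }
    ; ε       = 1# , invertible (*-identityˡ 1#)
    ; _⁻¹     = λ { (x , y , yx≈1 , xy≈1) → y , invertible yx≈1 }
    ; isAbelianGroup = record
      { isGroup = record
        { isMonoid = record
          { isSemigroup = record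
            { isMagma = record
              { isEquivalence = record { refl = refl ; sym = sym ; trans = trans }
              ; ∙-cong        = *-cong
              }
            ; assoc = λ u v w → *-assoc (proj₁ u) (proj₁ v) (proj₁ w)
            }
          ; identity = (λ u → *-identityˡ (proj₁ u)) , (λ u → *-identityʳ (proj₁ u))
          }
        ; inverse = (λ u → proj₁ (proj₂ (proj₂ u))) , (λ u → proj₂ (proj₂ (proj₂ u)))
        ; ⁻¹-cong = λ { {x , y , yx , xy} {x′ , y′ , y′x′ , x′y′} x≈x′ →
            trans (sym (*-identityʳ y))
           (trans (*-cong refl (sym x′y′))
           (trans (*-cong refl (*-cong (sym x≈x′) refl))
           (trans (sym (*-assoc y x y′))
           (trans (*-cong yx refl) (*-identityˡ y′))))) }
        }
      ; comm = λ u v → *-comm (proj₁ u) (proj₁ v)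
      }
    }

  open AbelianGroup unitGroup public
    using ()
    renaming (Carrier to Unit; _≈_ to _≈ˣ_; _∙_ to _∙ˣ_; ε to 1ˣ; _⁻¹ to _⁻¹ˣ)

  open Algebra.Definitions.RawMonoid (AbelianGroup.rawMonoid unitGroup) public
    using () renaming (sum to ∏ˣ)

  infixr 8 _^ˣ_ _^ᶻ_

  _^ˣ_ : Unit → ℕ → Unit
  u ^ˣ k = Algebra.Definitions.RawMonoid._×_ (AbelianGroup.rawMonoid unitGroup) k u

  _^ᶻ_ : Unit → ℤ → Unit
  u ^ᶻ (+ k)    = u ^ˣ k
  u ^ᶻ -[1+ k ] = (u ^ˣ suc k) ⁻¹ˣ

module _ {c ℓ₁ ℓ₂} (K : HeytingField c ℓ₁ ℓ₂) where

  open FieldOps K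

  record Subfield s : Set (c ⊔ ℓ₁ ⊔ lsuc s) where
    field
      member    : Pred Carrier s
      resp      : ∀ {x y} → x ≈ y → x ∈ member → y ∈ member
      +-closed  : ∀ {x y} → x ∈ member → y ∈ member → x + y ∈ member
      *-closed  : ∀ {x y} → x ∈ member → y ∈ member → x * y ∈ member
      neg-closed : ∀ {x} → x ∈ member → - x ∈ member
      0∈        : 0# ∈ member
      1∈        : 1# ∈ member
      inv-closed : ∀ {x y} → x ∈ member → x * y ≈ 1# → y ∈ member

  open Subfield using (member)

  -- [ E : F ] = d
  record HasDegree {s t} (F : Subfield s) (E : Pred Carrier t) (d : ℕ)
         : Set (c ⊔ ℓ₁ ⊔ s ⊔ t) where
    field
      basis       : Vector Carrier d
      basis∈E     : ∀ i → basis i ∈ E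
      independent : ∀ (coeff : Vector Carrier d) → (∀ i → coeff i ∈ member F) →
                    sum (λ i → coeff i * basis i) ≈ 0# → ∀ i → coeff i ≈ 0#
      spanning    : ∀ {x} → x ∈ E →
                    Σ[ coeff ∈ Vector Carrier d ]
                               ((∀ i → coeff i ∈ member F) ×
                                x ≈ sum (λ i → coeff i * basis i))

  record Automorphism {s} (F : Subfield s) : Set (c ⊔ ℓ₁ ⊔ s) where
    field
      ⟦_⟧               : Carrier → Carrier
      isRingIsomorphism : IsRingIsomorphism rawRing rawRing ⟦_⟧
      fixesBase         : ∀ {x} → x ∈ member F → ⟦ x ⟧ ≈ x

    open IsRingIsomorphism isRingIsomorphism public
      using (⟦⟧-cong; *-homo; 1#-homo)

    onUnits : Unit → Unit
    onUnits (x , y , yx≈1 , xy≈1) = ⟦ x ⟧ , ⟦ y ⟧ , lift yx≈1 , lift xy≈1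
      where
      open CommutativeRing commutativeRing using (sym; trans)
      lift : ∀ {u v} → u * v ≈ 1# → ⟦ u ⟧ * ⟦ v ⟧ ≈ 1#
      lift {u} {v} uv≈1 = trans (sym (*-homo u v)) (trans (⟦⟧-cong uv≈1) 1#-homo)

  open Automorphism using (⟦_⟧)

  -- For a finite extension this is the usual notion: F is the fixed field of
  -- Gal (K / F).
  IsGalois : ∀ {s} → Subfield s → Set (c ⊔ ℓ₁ ⊔ s)
  IsGalois F = ∀ x → (∀ (τ : Automorphism F) → ⟦ τ ⟧ x ≈ x) → x ∈ member F

  -- A cyclic Galois extension K / F of degree p ^ n with chosen generator σ of
  -- its Galois group, together with its intermediate fields K₀ , … , Kₙ.
  record CyclicExtension s (p n : ℕ) : Set (c ⊔ ℓ₁ ⊔ lsuc s) where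
    field
      F          : Subfield s
      degree     : HasDegree F U (p ℕ.^ n)
      galois     : IsGalois F
      σ          : Automorphism F
      generates  : ∀ (τ : Automorphism F) → ∃[ k ] ∀ x → ⟦ τ ⟧ x ≈ iterate ⟦ σ ⟧ x k
      Kᵢ         : Fin (suc n) → Subfield s
      F⊆Kᵢ       : ∀ i → member F ⊆ member (Kᵢ i)
      degreeKᵢ   : ∀ i → HasDegree F (member (Kᵢ i)) (p ℕ.^ toℕ i)

    σˣ : Unit → Unit
    σˣ = Automorphism.onUnits σ

    -- The norm from Kᵢ to F: the product of the conjugates under
    -- Gal (Kᵢ / F) = { σ ^ j restricted to Kᵢ ∣ 0 ≤ j < p ^ i }.
    norm : ℕ → Unit → Unit
    norm i u = ∏ˣ {p ℕ.^ i} (λ j → iterate σˣ u (toℕ j))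

    Index : Set
    Index = Fin (suc n) ₋

    open AddInfimum (_<ᶠ_ {suc n}) public using (_<₋_)

    data InKᵢ (u : Unit) : Index → Set (ℓ₁ ⊔ s) where
      one : u ≈ˣ 1ˣ → InKᵢ u ⊥₋
      mem : ∀ {i} → proj₁ u ∈ member (Kᵢ i) → InKᵢ u [ i ]

    module _ (ξ : Carrier) {m : ℕ} where

      record Represents (a : Vec Index m) (d : ℤ) (p∣d-1 : + p ∣ᶻ (d -ᶻ 1ℤ))
                        (α : Unit) (δ : Fin (suc m) → Unit)
                        : Set (ℓ₁ ⊔ s) where
        field
          δ∈Kᵢ    : ∀ (i : Fin m) → InKᵢ (δ (inject₁ i)) (lookup a i)
          σα      : σˣ α ≈ˣ α ^ᶻ d ∙ˣ ∏ˣ (λ i → δ i ^ˣ (p ℕ.^ toℕ i))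
          ξ≈norms : ξ ≈ proj₁ ((norm n α ^ᶻ quotient p∣d-1 ∙ˣ norm (n ∸ 1) (δ zero))
                              ∙ˣ ∏ˣ (λ (i : Fin m) → norm n (δ (suc i)) ^ˣ (p ℕ.^ toℕ i)))

      record IsNormPair (a : Vec Index m) (d : ℤ) : Set (c ⊔ ℓ₁ ⊔ s) where
        field
          a₀<n  : ∀ (i : Fin m) → toℕ i ≡ 0 → lookup a i <₋ [ fromℕ n ]
          d∈U₁  : + p ∣ᶻ (d -ᶻ 1ℤ)
          α     : Unit
          δ     : Fin (suc m) → Unit
          represents : Represents a d d∈U₁ α δ

      _≼_ : Vec Index m × ℤ → Vec Index m × ℤ → Set
      (a , d) ≼ (a′ , d′) =
        Lex-< _≡_ _<₋_ a a′ ⊎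
        (a ≡ a′ × m ⊓⁺ valuation p (d′ -ᶻ 1ℤ) ≤ m ⊓⁺ valuation p (d -ᶻ 1ℤ))

      IsMinimalNormPair : Vec Index m → ℤ → Set (c ⊔ ℓ₁ ⊔ s)
      IsMinimalNormPair a d =
        IsNormPair a d × (∀ a′ d′ → IsNormPair a′ d′ → (a , d) ≼ (a′ , d′))

    -- χ is the value at σ of the cyclotomic character, where p ^ ν is the
    -- number of p-power roots of unity in K.
    IsCyclotomicCharacter : (ν : ℕ ⁺) → ℤ/ p ^ ν → Set (c ⊔ ℓ₁)
    IsCyclotomicCharacter [ e ] χ = IsUnitMod p [ e ] χ ×
      (∀ ζ → ζ ^ˣ (p ℕ.^ e) ≈ˣ 1ˣ → σˣ ζ ≈ˣ ζ ^ᶻ χ)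
    IsCyclotomicCharacter ⊤⁺    χ = IsUnitMod p ⊤⁺ χ ×
      (∀ k ζ → ζ ^ˣ (p ℕ.^ k) ≈ˣ 1ˣ → σˣ ζ ≈ˣ ζ ^ᶻ ℤₚ.residue χ k)

------------------------------------------------------------------------
-- Algebraic closures and roots of unity

record AlgebraicClosure {c ℓ₁ ℓ₂} (K : HeytingField c ℓ₁ ℓ₂) : Set (lsuc (c ⊔ ℓ₁ ⊔ ℓ₂)) where
  private module K = FieldOps K
  field
    Ω : HeytingField c ℓ₁ ℓ₂

  open FieldOps Ω

  field
    embed     : K.Carrier → Carrier
    isRingMonomorphism : IsRingMonomorphism K.rawRing rawRing embed
    algebraic : ∀ x → ∃[ d ] Σ[ coeff ∈ Vector K.Carrier d ]
                  evalMonic (λ i → embed (coeff i)) x ≈ 0#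
    closed    : IsAlgebraicallyClosed

  -- All r-th roots of unity of the algebraic closure lie in L.
  μ_⊆_ : ∀ {t} → ℕ → Pred K.Carrier t → Set (c ⊔ ℓ₁ ⊔ t)
  μ r ⊆ L = ∀ z → z ^ r ≈ 1# → ∃[ x ] (x ∈ L × embed x ≈ z)

  -- e = sup { k ∣ μ (p ^ k) ⊆ L }
  IsRootExponent : ∀ {t} → ℕ → Pred K.Carrier t → ℕ ⁺ → Set (c ⊔ ℓ₁ ⊔ t)
  IsRootExponent p L [ e ] = (μ (p ℕ.^ e) ⊆ L) × ¬ (μ (p ℕ.^ suc e) ⊆ L)
  IsRootExponent p L ⊤⁺    = ∀ k → μ (p ℕ.^ k) ⊆ L

-- Write K ˣ additively, as a module over the polynomials in σ.  Let (a, d) be a norm pair represented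
-- by α and δ, and put d = 1 + p s and P = p ^ n.  Let p ^ e be the largest power of p dividing d ^ P - 1
-- and all p ^ i q i, where q i = Σ_{j < p ^ (n - a i)} d ^ (p ^ (a i) j).  From α and the partial twisted
-- norms of the δ i one builds a root of unity w with σ w = w ^ d, and the norm condition says precisely
-- that w ^ (p ^ (e - 1)) = ξ, so w has order p ^ e.  By maximality of e some d ^ P - 1 or p ^ i q i is
-- divisible by no higher power, and solving for α ^ (p ^ e) in terms of that slot absorbs it into the δ i:
-- thus d may be changed modulo p ^ e without changing a.
-- If e < m and w = η ^ p for some η ∈ K, then after such a change of d also σ η = η ^ d.  By Hilbert 90 and
-- the injectivity of inflation on Ĥ⁰, some δ b can then be replaced by an element of a smaller field (at
-- the cost of later components), contradicting the minimality of a.  Hence e = min (m, ν), and all three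
-- claims follow from σ w = w ^ d.
{-# OPTIONS --safe #-}
module Submission where

open import Defs
import Algebra.Definitions.RawMonoid
import Algebra.Properties.AbelianGroup
import Algebra.Properties.Ring
import Algebra.Properties.Semiring.Exp
import Algebra.Properties.Semiring.Mult.TCOptimised
import Algebra.Properties.Semiring.Sum
import Algebra.Solver.CommutativeMonoid
import Algebra.Solver.Ring
open import Algebra.Apartness.Bundles using (HeytingField)
open import Algebra.Bundles using (AbelianGroup; CommutativeRing; RawRing)
open import Algebra.Morphism.Structures using (module RingMorphisms)
open import Algebra.Solver.Ring.AlmostCommutativeRing using (fromCommutativeRing; _-Raw-AlmostCommutative⟶_)
open import Axiom.ExcludedMiddle using (ExcludedMiddle)
open import Data.Fin.Base as Fin using (Fin; zero; suc; toℕ; fromℕ; fromℕ<; inject₁; lower₁; punchIn; punchOut)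
import Data.Fin.Properties as Fin
open import Data.Integer.Base as ℤ using (ℤ; +_; -[1+_]; 1ℤ; 0ℤ) renaming (_-_ to _-ᶻ_; _*_ to _*ᶻ_; _+_ to _+ᶻ_)
import Data.Integer.DivMod as ℤ
open import Data.Integer.Divisibility.Signed as ℤ using (quotient; divides) renaming (_∣_ to _∣ᶻ_)
import Data.Integer.Properties as ℤ
import Data.Integer.Solver
open import Data.Maybe.Base using (Maybe; just; nothing)
open import Data.Nat.Base as ℕ using (ℕ; zero; suc; _≤_; _<_; _∸_; NonZero; s≤s; z≤n; z<s) renaming (_^_ to _^ℕ_; _*_ to _*ℕ_; _+_ to _+ℕ_; _⊓_ to _⊓ℕ_)
open import Data.Nat.Coprimality as Coprime using (Coprime; coprime-Bézout)
open import Data.Nat.Divisibility as ∣ using (_∣_; divides; _∣?_)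
import Data.Nat.DivMod as ℕ
open import Data.Nat.GCD using (module Bézout)
open import Data.Nat.GeneralisedArithmetic using (iterate)
open import Data.Nat.Primality using (Prime; prime⇒nonZero; prime⇒nonTrivial; prime⇒irreducible; euclidsLemma)
import Data.Nat.Properties as ℕ
open import Data.Nat.Solver using (module +-*-Solver)
open import Data.Product.Base using (Σ; ∃; ∃-syntax; _×_; _,_; proj₁; proj₂)
open import Data.Sign.Base as Sign using (Sign)
open import Data.Sum.Base using (_⊎_; inj₁; inj₂)
open import Data.Unit.Base using (⊤; tt)
open import Data.Vec.Base using (Vec; []; _∷_; lookup; replicate)
open import Data.Vec.Relation.Binary.Lex.Strict using (Lex-<; this; next; <-asym)
open import Function.Base using (_∘_)
open import Level as Level using (_⊔_; Lift; lift) renaming (suc to lsuc)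
import Relation.Binary.Construct.Add.Infimum.Strict as AddInfimum
import Relation.Binary.Construct.Add.Supremum.Strict as AddSupremum
open import Relation.Binary.Definitions using (tri<; tri≈; tri>)
open import Relation.Binary.PropositionalEquality as ≡ using (_≡_)
import Relation.Binary.Reasoning.Setoid
open import Relation.Nullary.Construct.Add.Infimum using (_₋; ⊥₋; [_])
open import Relation.Nullary.Construct.Add.Supremum using (_⁺; ⊤⁺; [_])
open import Relation.Nullary.Decidable.Core using (yes; no; Dec; map′; decidable-stable; ¬?; _×-dec_)
open import Relation.Nullary.Negation.Core using (¬_; contradiction)
open import Relation.Unary using (Pred; _∈_; U)

-- Multiplication by p is not injective on K ˣ, since it kills `ξ`. The norm of the equation for σ α
-- yields only p times the norm condition, so this condition cannot be recovered from the equation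
-- and has to be carried along separately. Hence quotients by p such as `E`, `Y` and `gsumQuotient`
-- are defined by integral recursions, and slot zero, whose component lies in a proper subfield,
-- uses N (p ^ (n - 1)) as the p-th part of N P. The root w has this origin: T P (σ - d) = σ ^ P - d
-- ^ P, applied to α, gives a vanishing combination of α and twisted norms of the δ i with
-- coefficients d ^ P - 1 and p ^ i q i, and w is this combination formally divided by p ^ e. The
-- ends of the family bound e: a 0 < n makes it at least 1, and the unconstrained last component,
-- where q is 1, makes it at most m. The case p = 2, n = 1 is special because 0 + 1 + ... + (p ^ n -
-- 1) has to be divisible by p when slot zero has level 0. There the hypothesis on -1 forces a 0 =
-- -∞ in a minimal pair.

-- Integer scalars and geometric sums in a commutative ring.

module IntegerMultiples {a ℓ} (R : CommutativeRing a ℓ) where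

  open CommutativeRing R
  open Algebra.Properties.Ring ring
  open Algebra.Properties.AbelianGroup +-abelianGroup using (⁻¹-∙-comm; ⁻¹-involutive; ε⁻¹≈ε)
  open Algebra.Properties.Semiring.Mult.TCOptimised semiring renaming (_×_ to _·_)
  open Relation.Binary.Reasoning.Setoid setoid

  ι : ℕ → Carrier
  ι k = k · 1#

  ιᶻ : ℤ → Carrier
  ιᶻ (+ k)    = ι k
  ιᶻ -[1+ k ] = - ι (suc k)

  ι-suc : ∀ k → ι (suc k) ≈ 1# + ι k
  ι-suc k = ×-homo-+ 1# 1 k

  ι-+ : ∀ j k → ι (j ℕ.+ k) ≈ ι j + ι k
  ι-+ = ×-homo-+ 1#

  ι-* : ∀ j k → ι (j ℕ.* k) ≈ ι j * ι k
  ι-* = ×1-homo-*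

  ι-cong : ∀ {j k} → j ≡ k → ι j ≈ ι k
  ι-cong ≡.refl = refl

  private
    cancel : ∀ x y → (1# + x) - (1# + y) ≈ x - y
    cancel x y = begin
      (1# + x) - (1# + y)       ≈⟨ +-cong (+-comm 1# x) (sym (⁻¹-∙-comm 1# y)) ⟩
      (x + 1#) + (- 1# - y)     ≈⟨ +-assoc x 1# _ ⟩
      x + (1# + (- 1# - y))     ≈⟨ +-congˡ (+-assoc 1# (- 1#) _) ⟨
      x + ((1# - 1#) - y)       ≈⟨ +-congˡ (+-congʳ (-‿inverseʳ 1#)) ⟩
      x + (0# - y)              ≈⟨ +-congˡ (+-identityˡ _) ⟩
      x - y                     ∎

    ⊖-homo : ∀ j k → ιᶻ (j ℤ.⊖ k) ≈ ι j - ι k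
    ⊖-homo j       zero    = sym (trans (+-congˡ ε⁻¹≈ε) (+-identityʳ _))
    ⊖-homo zero    (suc k) = sym (+-identityˡ _)
    ⊖-homo (suc j) (suc k) = begin
      ιᶻ (suc j ℤ.⊖ suc k)        ≡⟨ ≡.cong ιᶻ (ℤ.[1+m]⊖[1+n]≡m⊖n j k) ⟩
      ιᶻ (j ℤ.⊖ k)                ≈⟨ ⊖-homo j k ⟩
      ι j - ι k                   ≈⟨ cancel (ι j) (ι k) ⟨
      (1# + ι j) - (1# + ι k)     ≈⟨ +-cong (ι-suc j) (-‿cong (ι-suc k)) ⟨
      ι (suc j) - ι (suc k)       ∎

    signed : Sign → Carrier → Carrier
    signed Sign.+ x = x
    signed Sign.- x = - x

    ◃-homo : ∀ s k → ιᶻ (s ℤ.◃ k) ≈ signed s (ι k)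
    ◃-homo Sign.+ zero    = refl
    ◃-homo Sign.- zero    = sym ε⁻¹≈ε
    ◃-homo Sign.+ (suc k) = refl
    ◃-homo Sign.- (suc k) = refl

  ιᶻ-+ : ∀ i j → ιᶻ (i ℤ.+ j) ≈ ιᶻ i + ιᶻ j
  ιᶻ-+ (+ j)    (+ k)    = ι-+ j k
  ιᶻ-+ (+ j)    -[1+ k ] = ⊖-homo j (suc k)
  ιᶻ-+ -[1+ j ] (+ k)    = trans (⊖-homo k (suc j)) (+-comm _ _)
  ιᶻ-+ -[1+ j ] -[1+ k ] = begin
    - ι (suc (suc (j ℕ.+ k)))     ≡⟨ ≡.cong (λ l → - ι (suc l)) (ℕ.+-suc j k) ⟨
    - ι (suc j ℕ.+ suc k)         ≈⟨ -‿cong (ι-+ (suc j) (suc k)) ⟩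
    - (ι (suc j) + ι (suc k))     ≈⟨ ⁻¹-∙-comm _ _ ⟨
    - ι (suc j) - ι (suc k)       ∎

  ιᶻ-* : ∀ i j → ιᶻ (i ℤ.* j) ≈ ιᶻ i * ιᶻ j
  ιᶻ-* (+ j)    (+ k)    = trans (◃-homo Sign.+ (j ℕ.* k)) (ι-* j k)
  ιᶻ-* (+ j)    -[1+ k ] = trans (◃-homo Sign.- (j ℕ.* suc k))
    (trans (-‿cong (ι-* j (suc k))) (-‿distribʳ-* _ _))
  ιᶻ-* -[1+ j ] (+ k)    = trans (◃-homo Sign.- (suc j ℕ.* k))
    (trans (-‿cong (ι-* (suc j) k)) (-‿distribˡ-* _ _))
  ιᶻ-* -[1+ j ] -[1+ k ] = begin
    ι (suc j ℕ.* suc k)           ≈⟨ ι-* (suc j) (suc k) ⟩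
    ι (suc j) * ι (suc k)         ≈⟨ ⁻¹-involutive _ ⟨
    - - (ι (suc j) * ι (suc k))   ≈⟨ -‿cong (-‿distribʳ-* _ _) ⟩
    - (ι (suc j) * - ι (suc k))   ≈⟨ -‿distribˡ-* _ _ ⟩
    - ι (suc j) * - ι (suc k)     ∎

  ιᶻ-neg : ∀ i → ιᶻ (ℤ.- i) ≈ - ιᶻ i
  ιᶻ-neg (+ zero)  = sym ε⁻¹≈ε
  ιᶻ-neg (+ suc k) = refl
  ιᶻ-neg -[1+ k ]  = sym (⁻¹-involutive _)

  private
    ℤ-rawRing : RawRing _ _
    ℤ-rawRing = record
      { _≈_ = _≡_ ; _+_ = ℤ._+_ ; _*_ = ℤ._*_ ; -_ = ℤ.-_ ; 0# = ℤ.0ℤ ; 1# = ℤ.1ℤ }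

    homomorphism : ℤ-rawRing -Raw-AlmostCommutative⟶ fromCommutativeRing R
    homomorphism = record
      { ⟦_⟧ = ιᶻ ; +-homo = ιᶻ-+ ; *-homo = ιᶻ-* ; -‿homo = ιᶻ-neg
      ; 0-homo = refl ; 1-homo = refl }

    coefficient≟ : ∀ i j → Maybe (ιᶻ i ≈ ιᶻ j)
    coefficient≟ i j with i ℤ.≟ j
    ... | yes ≡.refl = just refl
    ... | no  _      = nothing

  -- Coefficients are compared in ℤ, where equality is decidable, so identities with signs and
  -- integer constants normalise although equality in the ring itself need not be decidable.
  module Solver = Algebra.Solver.Ring ℤ-rawRing (fromCommutativeRing R) homomorphism coefficient≟

module Geometric {a ℓ} (R : CommutativeRing a ℓ) where

  open CommutativeRing R public hiding (zero)
  private module I = IntegerMultiples R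
  open I public using (module Solver; ιᶻ; ιᶻ-+; ιᶻ-*)
  open Solver public using (solve; _:=_; _:+_; _:*_; :-_; _:-_; con)
  open Algebra.Properties.Semiring.Exp semiring public
    using (_^_; ^-homo-*; ^-assocʳ; ^-congˡ)
  private module Sum = Algebra.Properties.Semiring.Sum semiring
  open Sum using (sum; sum-cong-≋; ∑-distrib-+; *-distribˡ-sum)

  -- Abstract copies, so that unification treats ι and ∑ as injective.
  abstract
    ι : ℕ → Carrier
    ι = I.ι

    ι≡ι : ∀ k → ι k ≡ I.ι k
    ι≡ι k = ≡.refl

    ι-0 : ι 0 ≈ 0#
    ι-0 = refl

    ι-1 : ι 1 ≈ 1#
    ι-1 = refl

    ι-suc : ∀ k → ι (suc k) ≈ 1# + ι k
    ι-suc = I.ι-suc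

    ι-+ : ∀ j k → ι (j ℕ.+ k) ≈ ι j + ι k
    ι-+ = I.ι-+

    ι-* : ∀ j k → ι (j ℕ.* k) ≈ ι j * ι k
    ι-* = I.ι-*

    ∑ : ∀ {k} → (Fin k → Carrier) → Carrier
    ∑ = sum

    ∑≡sum : ∀ {k} (x : Fin k → Carrier) → ∑ x ≡ sum x
    ∑≡sum x = ≡.refl

    ∑-suc : ∀ {k} (x : Fin (suc k) → Carrier) → ∑ x ≈ x zero + ∑ (λ i → x (suc i))
    ∑-suc x = refl

    ∑-cong : ∀ {k} {x y : Fin k → Carrier} → (∀ i → x i ≈ y i) → ∑ x ≈ ∑ y
    ∑-cong = sum-cong-≋

    ∑-zero : ∀ {k} {x : Fin k → Carrier} → (∀ i → x i ≈ 0#) → ∑ x ≈ 0#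
    ∑-zero {zero}  h = refl
    ∑-zero {suc k} h = trans (+-cong (h zero) (∑-zero (λ i → h (suc i)))) (+-identityˡ 0#)

    ∑-+ : ∀ {k} (x y : Fin k → Carrier) → ∑ (λ i → x i + y i) ≈ ∑ x + ∑ y
    ∑-+ = ∑-distrib-+

    ∑-* : ∀ {k} c (x : Fin k → Carrier) → ∑ (λ i → c * x i) ≈ c * ∑ x
    ∑-* c x = sym (*-distribˡ-sum c x)

    ∑-comm : ∀ {j k} (x : Fin j → Fin k → Carrier) → ∑ (λ i → ∑ (x i)) ≈ ∑ (λ i′ → ∑ (λ i → x i i′))
    ∑-comm = Sum.∑-comm

    ∑-last : ∀ {k} (f : ℕ → Carrier) → ∑ {suc k} (λ i → f (toℕ i)) ≈ ∑ {k} (λ i → f (toℕ i)) + f k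
    ∑-last {zero}  f = trans (+-identityʳ _) (sym (+-identityˡ _))
    ∑-last {suc k} f = trans (+-congˡ (∑-last (λ i → f (suc i)))) (sym (+-assoc _ _ _))

    ∑-closed : ∀ {r} (P : Carrier → Set r) → P 0# → (∀ {x y} → P x → P y → P (x + y)) →
               ∀ {k} {x : Fin k → Carrier} → (∀ i → P (x i)) → P (∑ x)
    ∑-closed P P-0 P-+ {zero}  h = P-0
    ∑-closed P P-0 P-+ {suc k} h = P-+ (h zero) (∑-closed P P-0 P-+ (λ i → h (suc i)))

  ι-cong : ∀ {j k} → j ≡ k → ι j ≈ ι k
  ι-cong ≡.refl = refl

  :1 : ∀ {k} → Solver.Polynomial k
  :1 = con ℤ.1ℤ

  -- With hypotheses l ≈ r and coefficients c, these reduce a goal to an identity for the ring solver.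
  linear₁ : ∀ {x y} c {l r} → l ≈ r → x + c * r ≈ y + c * l → x ≈ y
  linear₁ {x} {y} c {l} {r} h e = trans
    (solve 3 (λ x c r → x := (x :+ c :* r) :- c :* r) refl x c r)
    (trans (+-cong e (-‿cong (*-congˡ (sym h))))
    (solve 3 (λ y c l → (y :+ c :* l) :- c :* l := y) refl y c l))

  linear₂ : ∀ {x y} c₁ {l₁ r₁} → l₁ ≈ r₁ → ∀ c₂ {l₂ r₂} → l₂ ≈ r₂ →
            x + c₁ * r₁ + c₂ * r₂ ≈ y + c₁ * l₁ + c₂ * l₂ → x ≈ y
  linear₂ c₁ h₁ c₂ h₂ e = linear₁ c₁ h₁ (linear₁ c₂ h₂ e)

  linear₃ : ∀ {x y} c₁ {l₁ r₁} → l₁ ≈ r₁ → ∀ c₂ {l₂ r₂} → l₂ ≈ r₂ → ∀ c₃ {l₃ r₃} → l₃ ≈ r₃ →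
            x + c₁ * r₁ + c₂ * r₂ + c₃ * r₃ ≈ y + c₁ * l₁ + c₂ * l₂ + c₃ * l₃ → x ≈ y
  linear₃ c₁ h₁ c₂ h₂ c₃ h₃ e = linear₂ c₁ h₁ c₂ h₂ (linear₁ c₃ h₃ e)

  linear₄ : ∀ {x y} c₁ {l₁ r₁} → l₁ ≈ r₁ → ∀ c₂ {l₂ r₂} → l₂ ≈ r₂ → ∀ c₃ {l₃ r₃} → l₃ ≈ r₃ →
            ∀ c₄ {l₄ r₄} → l₄ ≈ r₄ →
            x + c₁ * r₁ + c₂ * r₂ + c₃ * r₃ + c₄ * r₄ ≈
            y + c₁ * l₁ + c₂ * l₂ + c₃ * l₃ + c₄ * l₄ → x ≈ y
  linear₄ c₁ h₁ c₂ h₂ c₃ h₃ c₄ h₄ e = linear₃ c₁ h₁ c₂ h₂ c₃ h₃ (linear₁ c₄ h₄ e)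

  -- The sum of x ^ j y ^ (k - 1 - j) over j < k, that is, (y ^ k - x ^ k) / (y - x) without a
  -- division. For y = σ it is a norm when x = 1 and a norm twisted by d when x = d.
  geom : Carrier → Carrier → ℕ → Carrier
  geom x y zero    = 0#
  geom x y (suc k) = y * geom x y k + x ^ k

  geom-difference : ∀ x y k → (y - x) * geom x y k ≈ y ^ k - x ^ k
  geom-difference x y zero    = solve 2 (λ x y → (y :- x) :* con ℤ.0ℤ := :1 :- :1) refl x y
  geom-difference x y (suc k) = linear₁ y (geom-difference x y k)
    (solve 5 (λ x y g u v → (y :- x) :* (y :* g :+ u) :+ y :* (v :- u)
                          := y :* v :- x :* u :+ y :* ((y :- x) :* g))
       refl x y (geom x y k) (x ^ k) (y ^ k))

  geom-+ : ∀ x y j k → geom x y (j ℕ.+ k) ≈ y ^ j * geom x y k + x ^ k * geom x y j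
  geom-+ x y zero    k = solve 2 (λ g u → g := :1 :* g :+ u :* con ℤ.0ℤ) refl (geom x y k) (x ^ k)
  geom-+ x y (suc j) k = linear₂ y (geom-+ x y j k) 1# (^-homo-* x j k)
    (solve 8 (λ y g h u v w q r →
        y :* q :+ r :+ y :* (u :* g :+ v :* h) :+ :1 :* (w :* v)
        := y :* u :* g :+ v :* (y :* h :+ w) :+ y :* q :+ :1 :* r)
      refl y (geom x y k) (geom x y j) (y ^ j) (x ^ k) (x ^ j) (geom x y (j ℕ.+ k)) (x ^ (j ℕ.+ k)))

  ^-swap : ∀ x j k → x ^ (j ℕ.* k) ≈ (x ^ k) ^ j
  ^-swap x j k = trans (reflexive (≡.cong (x ^_) (ℕ.*-comm j k))) (sym (^-assocʳ x k j))

  -- For x = 1 and y = σ this is the transitivity of norms: the second factor is the norm down to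
  -- the field fixed by σ ^ k, the first one the norm from there to F.
  geom-* : ∀ x y l k → geom x y (l ℕ.* k) ≈ geom x y k * geom (x ^ k) (y ^ k) l
  geom-* x y zero    k = sym (zeroʳ _)
  geom-* x y (suc l) k = linear₃ 1# (geom-+ x y k (l ℕ.* k)) (y ^ k) (geom-* x y l k)
      (geom x y k) (^-swap x l k)
    (solve 7 (λ q u h v g b w →
        q :+ :1 :* (u :* h :+ v :* g) :+ u :* (g :* b) :+ g :* w
        := g :* (u :* b :+ w) :+ :1 :* q :+ u :* h :+ g :* v)
      refl (geom x y (k ℕ.+ l ℕ.* k)) (y ^ k) (geom x y (l ℕ.* k)) (x ^ (l ℕ.* k))
           (geom x y k) (geom (x ^ k) (y ^ k) l) ((x ^ k) ^ l))

  -- The quotient of `geom x y k - geom x 1# k` by y - 1. It is defined by recursion because y - 1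
  -- may be a zero divisor, as σ - 1 is.
  slope : Carrier → Carrier → ℕ → Carrier
  slope x y zero    = 0#
  slope x y (suc k) = y * slope x y k + geom x 1# k

  geom-slope : ∀ x y k → geom x y k ≈ geom x 1# k + (y - 1#) * slope x y k
  geom-slope x y zero    = solve 1 (λ y → con ℤ.0ℤ := con ℤ.0ℤ :+ (y :- :1) :* con ℤ.0ℤ) refl y
  geom-slope x y (suc k) = linear₁ y (geom-slope x y k)
    (solve 5 (λ y g h z u → y :* g :+ u :+ y :* (h :+ (y :- :1) :* z)
        := :1 :* h :+ u :+ (y :- :1) :* (y :* z :+ h) :+ y :* g)
      refl y (geom x y k) (geom x 1# k) (slope x y k) (x ^ k))

-- Twisted norms and the arithmetic of the multiplier d.

gsum : ℕ → ℕ → ℕ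
gsum x zero    = 0
gsum x (suc k) = gsum x k ℕ.+ x ℕ.^ k

module _ where
  open import Data.Nat.Base using (_+_; _*_; _^_)
  open +-*-Solver
  open ≡.≡-Reasoning

  ^-gsum : ∀ t k → suc t ^ k ≡ 1 + t * gsum (suc t) k
  ^-gsum t zero    = ≡.cong suc (≡.sym (ℕ.*-zeroʳ t))
  ^-gsum t (suc k) = begin
    suc t ^ k + t * suc t ^ k               ≡⟨ ≡.cong (_+ t * suc t ^ k) (^-gsum t k) ⟩
    1 + t * gsum (suc t) k + t * suc t ^ k  ≡⟨ ≡.cong suc (ℕ.*-distribˡ-+ t (gsum (suc t) k) _) ⟨
    1 + t * gsum (suc t) (suc k)            ∎

  gsum-+ : ∀ x j k → gsum x (j + k) ≡ gsum x j + x ^ j * gsum x k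
  gsum-+ x j zero    = ≡.trans (≡.cong (gsum x) (ℕ.+-identityʳ j))
    (≡.sym (≡.trans (≡.cong (λ z → gsum x j + z) (ℕ.*-zeroʳ (x ^ j))) (ℕ.+-identityʳ _)))
  gsum-+ x j (suc k) = begin
    gsum x (j + suc k)                            ≡⟨ ≡.cong (gsum x) (ℕ.+-suc j k) ⟩
    gsum x (j + k) + x ^ (j + k)                  ≡⟨ ≡.cong₂ _+_ (gsum-+ x j k) (ℕ.^-distribˡ-+-* x j k) ⟩
    gsum x j + x ^ j * gsum x k + x ^ j * x ^ k
      ≡⟨ solve 4 (λ a u b v → a :+ u :* b :+ u :* v := a :+ u :* (b :+ v)) ≡.refl
           (gsum x j) (x ^ j) (gsum x k) (x ^ k) ⟩
    gsum x j + x ^ j * gsum x (suc k)             ∎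

  gsum-* : ∀ x l k → gsum x (l * k) ≡ gsum x k * gsum (x ^ k) l
  gsum-* x zero    k = ≡.sym (ℕ.*-zeroʳ (gsum x k))
  gsum-* x (suc l) k = begin
    gsum x (k + l * k)                                  ≡⟨ ≡.cong (gsum x) (ℕ.+-comm k (l * k)) ⟩
    gsum x (l * k + k)                                  ≡⟨ gsum-+ x (l * k) k ⟩
    gsum x (l * k) + x ^ (l * k) * gsum x k             ≡⟨ ≡.cong₂ (λ a b → a + b * gsum x k) (gsum-* x l k) power ⟩
    gsum x k * gsum (x ^ k) l + (x ^ k) ^ l * gsum x k
      ≡⟨ solve 3 (λ a b c → a :* b :+ c :* a := a :* (b :+ c)) ≡.refl (gsum x k) (gsum (x ^ k) l) ((x ^ k) ^ l) ⟩
    gsum x k * gsum (x ^ k) (suc l)                     ∎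
    where
    power : x ^ (l * k) ≡ (x ^ k) ^ l
    power = ≡.trans (≡.cong (x ^_) (ℕ.*-comm l k)) (≡.sym (ℕ.^-*-assoc x k l))

module Multiplier (p s : ℕ) where
  open import Data.Nat.Base using (_+_; _*_; _^_)
  open +-*-Solver
  open ≡.≡-Reasoning

  d : ℕ
  d = suc (p * s)

  -- The integer (d ^ k - 1) / p, obtained from d - 1 = p s.
  E : ℕ → ℕ
  E k = s * gsum d k

  d^≡1+pE : ∀ k → d ^ k ≡ 1 + p * E k
  d^≡1+pE k = ≡.trans (^-gsum (p * s) k) (≡.cong suc (ℕ.*-assoc p s (gsum d k)))

  E-+ : ∀ j k → E (j + k) ≡ E k + d ^ k * E j
  E-+ j k = begin
    s * gsum d (j + k)                   ≡⟨ ≡.cong (λ i → s * gsum d i) (ℕ.+-comm j k) ⟩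
    s * gsum d (k + j)                   ≡⟨ ≡.cong (s *_) (gsum-+ d k j) ⟩
    s * (gsum d k + d ^ k * gsum d j)
      ≡⟨ solve 4 (λ s g u h → s :* (g :+ u :* h) := s :* g :+ u :* (s :* h)) ≡.refl s (gsum d k) (d ^ k) (gsum d j) ⟩
    E k + d ^ k * E j                    ∎

  d^-swap : ∀ l h → (d ^ h) ^ l ≡ d ^ (l * h)
  d^-swap l h = ≡.trans (ℕ.^-*-assoc d h l) (≡.cong (d ^_) (ℕ.*-comm h l))

  -- The integer (gsum (d ^ h) l - l) / p: each of the l powers of d ^ h is 1 modulo p.
  gsumQuotient : ℕ → ℕ → ℕ
  gsumQuotient h zero    = 0
  gsumQuotient h (suc l) = gsumQuotient h l + E (l * h)

  gsum-quotient : ∀ h l → gsum (d ^ h) l ≡ l + p * gsumQuotient h l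
  gsum-quotient h zero    = ≡.sym (ℕ.*-zeroʳ p)
  gsum-quotient h (suc l) = begin
    gsum (d ^ h) l + (d ^ h) ^ l
      ≡⟨ ≡.cong₂ _+_ (gsum-quotient h l) (≡.trans (d^-swap l h) (d^≡1+pE (l * h))) ⟩
    l + p * gsumQuotient h l + (1 + p * E (l * h))
      ≡⟨ solve 4 (λ l p f e → l :+ p :* f :+ (con 1 :+ p :* e) := con 1 :+ l :+ p :* (f :+ e)) ≡.refl
           l p (gsumQuotient h l) (E (l * h)) ⟩
    suc l + p * gsumQuotient h (suc l)   ∎

-- T k is the norm N k twisted by d, and Y k is the integral quotient (T k - N k) / p; multiplication
-- by p need not be injective on R.
module Twisted {a ℓ} (R : CommutativeRing a ℓ) (σ : CommutativeRing.Carrier R) (p s : ℕ) where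

  open Geometric R
  open Multiplier p s public
  open import Relation.Binary.Reasoning.Setoid setoid

  ι-^ : ∀ x k → ι (x ℕ.^ k) ≈ ι x ^ k
  ι-^ x zero    = ι-1
  ι-^ x (suc k) = trans (ι-* x (x ℕ.^ k)) (*-congˡ (ι-^ x k))

  ι-gsum : ∀ x k → ι (gsum x k) ≈ geom (ι x) 1# k
  ι-gsum x zero    = ι-0
  ι-gsum x (suc k) = trans (ι-+ (gsum x k) (x ℕ.^ k))
    (+-cong (trans (ι-gsum x k) (sym (*-identityˡ _))) (ι-^ x k))

  ι-d : ι d ≈ 1# + ι p * ι s
  ι-d = trans (ι-suc (p ℕ.* s)) (+-congˡ (ι-* p s))

  N T : ℕ → Carrier
  N = geom 1# σ
  T = geom (ι d) σ

  ι-d^ : ∀ k → ι d ^ k ≈ 1# + ι p * ι (E k)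
  ι-d^ k = begin
    ι d ^ k                 ≈⟨ ι-^ d k ⟨
    ι (d ℕ.^ k)             ≡⟨ ≡.cong ι (d^≡1+pE k) ⟩
    ι (1 ℕ.+ p ℕ.* E k)     ≈⟨ ι-suc (p ℕ.* E k) ⟩
    1# + ι (p ℕ.* E k)      ≈⟨ +-congˡ (ι-* p (E k)) ⟩
    1# + ι p * ι (E k)      ∎

  Y : ℕ → Carrier
  Y zero    = 0#
  Y (suc k) = σ * Y k + ι (E k)

  1^ : ∀ k → 1# ^ k ≈ 1#
  1^ zero    = refl
  1^ (suc k) = trans (*-identityˡ _) (1^ k)

  T≈N+pY : ∀ k → T k ≈ N k + ι p * Y k
  T≈N+pY zero    = solve 1 (λ p → con ℤ.0ℤ := con ℤ.0ℤ :+ p :* con ℤ.0ℤ) refl (ι p)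
  T≈N+pY (suc k) = linear₃ σ (T≈N+pY k) 1# (ι-d^ k) (- 1#) (1^ k)
    (solve 8 (λ σ t n y p e u v → σ :* t :+ u :+ σ :* (n :+ p :* y) :+ :1 :* (:1 :+ p :* e) :+ (:- :1) :* :1
        := (σ :* n :+ v) :+ p :* (σ :* y :+ e) :+ σ :* t :+ :1 :* u :+ (:- :1) :* v)
      refl σ (T k) (N k) (Y k) (ι p) (ι (E k)) (ι d ^ k) (1# ^ k))

  ι-E-suc : ∀ k → ι (E (suc k)) ≈ ι s + ι d * ι (E k)
  ι-E-suc k = begin
    ι (s ℕ.* (gsum d k ℕ.+ d ℕ.^ k))                     ≈⟨ ι-* s _ ⟩
    ι s * ι (gsum d k ℕ.+ d ℕ.^ k)                       ≈⟨ *-congˡ (ι-+ (gsum d k) _) ⟩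
    ι s * (ι (gsum d k) + ι (d ℕ.^ k))                   ≈⟨ *-congˡ (+-congˡ (trans (ι-^ d k) (ι-d^ k))) ⟩
    ι s * (ι (gsum d k) + (1# + ι p * ι (E k)))
      ≈⟨ linear₂ (- 1#) (ι-* s (gsum d k)) (- ι (E k)) ι-d
           (solve 5 (λ s g p e d → s :* (g :+ (:1 :+ p :* e)) :+ (:- :1) :* (s :* g) :+ (:- e) :* (:1 :+ p :* s)
             := s :+ d :* e :+ (:- :1) :* e :+ (:- e) :* d) refl (ι s) (ι (gsum d k)) (ι p) (ι (E k)) (ι d)) ⟩
    ι s + ι d * ι (E k)                                  ∎

  -- Formally, T k (σ - d) = σ ^ k - d ^ k and N k (σ - d) = σ ^ k - 1 - p s N k differ by p (s N k
  -- - E k), and both sides are divided by p. The induction replaces this division.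
  Y-twist : ∀ k → Y k * (σ - ι d) ≈ ι s * N k - ι (E k)
  Y-twist zero    = linear₁ 1# (trans (reflexive (≡.cong ι (ℕ.*-zeroʳ s))) ι-0)
    (solve 4 (λ σ d s e → con ℤ.0ℤ :* (σ :- d) :+ :1 :* con ℤ.0ℤ
      := s :* con ℤ.0ℤ :- e :+ :1 :* e) refl σ (ι d) (ι s) (ι (E 0)))
  Y-twist (suc k) = linear₃ σ (Y-twist k) 1# (ι-E-suc k) (- ι s) (1^ k)
    (solve 8 (λ σ d s y n e f v →
      (σ :* y :+ e) :* (σ :- d) :+ σ :* (s :* n :- e) :+ :1 :* (s :+ d :* e) :+ (:- s) :* :1
      := s :* (σ :* n :+ v) :- f :+ σ :* (y :* (σ :- d)) :+ :1 :* f :+ (:- s) :* v)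
      refl σ (ι d) (ι s) (Y k) (N k) (ι (E k)) (ι (E (suc k))) (1# ^ k))

  Y-difference : ∀ k → (σ - 1#) * Y k ≈ ι s * T k - ι (E k)
  Y-difference k = linear₃ 1# (Y-twist k) (Y k) ι-d (- ι s) (T≈N+pY k)
    (solve 8 (λ σ d s y n e p t →
      (σ :- :1) :* y :+ :1 :* (s :* n :- e) :+ y :* (:1 :+ p :* s) :+ (:- s) :* (n :+ p :* y)
      := s :* t :- e :+ :1 :* (y :* (σ :- d)) :+ y :* d :+ (:- s) :* t)
      refl σ (ι d) (ι s) (Y k) (N k) (ι (E k)) (ι p) (T k))

  Y-+ : ∀ j k → Y (j ℕ.+ k) ≈ σ ^ j * Y k + ι d ^ k * Y j + ι (E k) * N j
  Y-+ zero    k = solve 3 (λ y u e → y := :1 :* y :+ u :* con ℤ.0ℤ :+ e :* con ℤ.0ℤ) refl (Y k) (ι d ^ k) (ι (E k))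
  Y-+ (suc j) k = begin
    σ * Y (j ℕ.+ k) + ι (E (j ℕ.+ k))
      ≈⟨ +-cong (*-congˡ (Y-+ j k)) ι-E-+ ⟩
    σ * (σ ^ j * Y k + ι d ^ k * Y j + ι (E k) * N j) + (ι (E k) + ι d ^ k * ι (E j))
      ≈⟨ solve 8 (λ σ u y w z e n v →
            σ :* (u :* y :+ w :* z :+ e :* n) :+ (e :+ w :* v)
            := σ :* u :* y :+ w :* (σ :* z :+ v) :+ e :* (σ :* n :+ :1))
            refl σ (σ ^ j) (Y k) (ι d ^ k) (Y j) (ι (E k)) (N j) (ι (E j)) ⟩
    σ * σ ^ j * Y k + ι d ^ k * (σ * Y j + ι (E j)) + ι (E k) * (σ * N j + 1#)
      ≈⟨ +-congˡ (*-congˡ (+-congˡ (1^ j))) ⟨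
    σ ^ suc j * Y k + ι d ^ k * Y (suc j) + ι (E k) * N (suc j) ∎
    where
    ι-E-+ : ι (E (j ℕ.+ k)) ≈ ι (E k) + ι d ^ k * ι (E j)
    ι-E-+ = trans (reflexive (≡.cong ι (E-+ j k))) (trans (ι-+ (E k) _)
      (+-congˡ (trans (ι-* (d ℕ.^ k) (E j)) (*-congʳ (ι-^ d k)))))

  fixed-^ : ∀ {x y} l → y * x ≈ x → y ^ l * x ≈ x
  fixed-^ zero    h = *-identityˡ _
  fixed-^ {x} {y} (suc l) h = trans (*-assoc y (y ^ l) x) (trans (*-congˡ (fixed-^ l h)) h)

  -- The p-th part of the difference of `T-*` and `N-*`: on x the operators T and N of length l h
  -- are g T h and l N h with g = gsum (d ^ h) l, and (g (N h + p Y h) - l N h) / p is the right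
  -- side.
  Y-fixed : ∀ h l {x} → σ ^ h * x ≈ x →
            Y (l ℕ.* h) * x ≈ ι (gsumQuotient h l) * (N h * x) + ι (gsum (d ℕ.^ h) l) * (Y h * x)
  Y-fixed h zero    {x} hx = linear₁ (- (N h * x + Y h * x)) ι-0
    (solve 4 (λ x n y o → con ℤ.0ℤ :* x :+ (:- (n :+ y)) :* con ℤ.0ℤ := o :* n :+ o :* y :+ (:- (n :+ y)) :* o)
      refl x (N h * x) (Y h * x) (ι 0))
  Y-fixed h (suc l) {x} hx = begin
    Y (h ℕ.+ l ℕ.* h) * x
      ≈⟨ *-congʳ (Y-+ h (l ℕ.* h)) ⟩
    (σ ^ h * Y (l ℕ.* h) + ι d ^ (l ℕ.* h) * Y h + ι (E (l ℕ.* h)) * N h) * x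
      ≈⟨ linear₂ (Y (l ℕ.* h)) hx 1# (Y-fixed h l hx)
          (solve 10 (λ a b w y e n x f g z →
            (a :* b :+ w :* y :+ e :* n) :* x :+ b :* x :+ :1 :* (f :* (n :* x) :+ g :* (y :* x))
            := (f :+ e) :* (n :* x) :+ (g :+ w) :* (y :* x) :+ b :* (a :* x) :+ :1 :* (b :* x))
           refl (σ ^ h) (Y (l ℕ.* h)) (ι d ^ (l ℕ.* h)) (Y h) (ι (E (l ℕ.* h))) (N h) x
             (ι (gsumQuotient h l)) (ι (gsum (d ℕ.^ h) l)) 0#) ⟩
    (ι (gsumQuotient h l) + ι (E (l ℕ.* h))) * (N h * x) + (ι (gsum (d ℕ.^ h) l) + ι d ^ (l ℕ.* h)) * (Y h * x)
      ≈⟨ +-cong (*-congʳ (ι-+ (gsumQuotient h l) _)) (*-congʳ (trans (ι-+ (gsum (d ℕ.^ h) l) _)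
           (+-congˡ (trans (reflexive (≡.cong ι (d^-swap l h))) (ι-^ d (l ℕ.* h)))))) ⟨
    ι (gsumQuotient h (suc l)) * (N h * x) + ι (gsum (d ℕ.^ h) (suc l)) * (Y h * x) ∎

  geom-fixed : ∀ c {y x} l → y * x ≈ x → geom (ι c) y l * x ≈ ι (gsum c l) * x
  geom-fixed c {y} {x} l hx = begin
    geom (ι c) y l * x
      ≈⟨ *-congʳ (geom-slope (ι c) y l) ⟩
    (geom (ι c) 1# l + (y - 1#) * slope (ι c) y l) * x
      ≈⟨ linear₁ (slope (ι c) y l) hx (solve 4 (λ g y z x →
           (g :+ (y :- :1) :* z) :* x :+ z :* x := g :* x :+ z :* (y :* x)) refl
           (geom (ι c) 1# l) y (slope (ι c) y l) x) ⟩
    geom (ι c) 1# l * x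
      ≈⟨ *-congʳ (ι-gsum c l) ⟨
    ι (gsum c l) * x ∎

  gsum-1 : ∀ l → gsum 1 l ≡ l
  gsum-1 zero    = ≡.refl
  gsum-1 (suc l) = ≡.trans (≡.cong₂ ℕ._+_ (gsum-1 l) (ℕ.^-zeroˡ l)) (ℕ.+-comm l 1)

  geom-congˡ : ∀ {a b y} l → a ≈ b → geom a y l ≈ geom b y l
  geom-congˡ zero    e = refl
  geom-congˡ (suc l) e = +-cong (*-congˡ (geom-congˡ l e)) (^-congˡ l e)

  T-* : ∀ h l {x} → σ ^ h * x ≈ x → T (l ℕ.* h) * x ≈ ι (gsum (d ℕ.^ h) l) * (T h * x)
  T-* h l {x} hx = begin
    T (l ℕ.* h) * x
      ≈⟨ *-congʳ (geom-* (ι d) σ l h) ⟩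
    T h * geom (ι d ^ h) (σ ^ h) l * x
      ≈⟨ *-assoc _ _ _ ⟩
    T h * (geom (ι d ^ h) (σ ^ h) l * x)
      ≈⟨ *-congˡ (trans (*-congʳ (geom-congˡ l (sym (ι-^ d h)))) (geom-fixed (d ℕ.^ h) l hx)) ⟩
    T h * (ι (gsum (d ℕ.^ h) l) * x)
      ≈⟨ solve 3 (λ t g x → t :* (g :* x) := g :* (t :* x)) refl (T h) (ι (gsum (d ℕ.^ h) l)) x ⟩
    ι (gsum (d ℕ.^ h) l) * (T h * x) ∎

  N-* : ∀ h l {x} → σ ^ h * x ≈ x → N (l ℕ.* h) * x ≈ ι l * (N h * x)
  N-* h l {x} hx = begin
    N (l ℕ.* h) * x                        ≈⟨ *-congʳ (geom-* 1# σ l h) ⟩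
    N h * geom (1# ^ h) (σ ^ h) l * x      ≈⟨ *-assoc _ _ _ ⟩
    N h * (geom (1# ^ h) (σ ^ h) l * x)    ≈⟨ *-congˡ (trans (*-congʳ (geom-congˡ l (trans (1^ h) (sym ι-1)))) (geom-fixed 1 l hx)) ⟩
    N h * (ι (gsum 1 l) * x)               ≡⟨ ≡.cong (λ i → N h * (ι i * x)) (gsum-1 l) ⟩
    N h * (ι l * x)                        ≈⟨ solve 3 (λ t g x → t :* (g :* x) := g :* (t :* x)) refl (N h) (ι l) x ⟩
    ι l * (N h * x)                        ∎

-- Families of components and norm pairs in an abstract cyclic module.

module Families {a ℓ} (R : CommutativeRing a ℓ) where
  open Geometric R
  open import Relation.Binary.Reasoning.Setoid setoid

  single : ∀ {k} → Fin k → Carrier → Fin k → Carrier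
  single zero    v zero    = v
  single zero    v (suc i) = 0#
  single (suc j) v zero    = 0#
  single (suc j) v (suc i) = single j v i

  ∑-single : ∀ {k} (c : Fin k → Carrier) j v → ∑ (λ i → c i * single j v i) ≈ c j * v
  ∑-single c zero    v = trans (∑-suc _) (trans (+-congˡ (∑-zero (λ i → zeroʳ _))) (+-identityʳ _))
  ∑-single c (suc j) v = trans (∑-suc _) (trans (+-cong (zeroʳ _) (∑-single (λ i → c (suc i)) j v)) (+-identityˡ _))

  single-closed : ∀ {r} (P : Carrier → Set r) → P 0# → ∀ {k} (j : Fin k) {v} → P v → ∀ i → P (single j v i)
  single-closed P P-0 zero    Pv zero    = Pv
  single-closed P P-0 zero    Pv (suc i) = P-0
  single-closed P P-0 (suc j) Pv zero    = P-0
  single-closed P P-0 (suc j) Pv (suc i) = single-closed P P-0 j Pv i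

p^-split : ∀ p {c n} → c ≤ n → p ℕ.^ n ≡ p ℕ.^ (n ∸ c) ℕ.* p ℕ.^ c
p^-split p {c} {n} c≤n = ≡.trans (≡.cong (p ℕ.^_) (≡.sym (ℕ.m∸n+n≡m c≤n))) (ℕ.^-distribˡ-+-* p (n ∸ c) c)

∸-suc : ∀ {c n} → c < n → n ∸ c ≡ suc (n ∸ 1 ∸ c)
∸-suc (s≤s c≤n) = ℕ.+-∸-assoc 1 c≤n

module Levels (n : ℕ) where
  Index : Set
  Index = Fin (suc n) ₋

  -- The last slot of a family carries no constraint, so its level is n.
  level : ∀ {m} → Vec Index m → Fin (suc m) → Index
  level []      zero    = [ fromℕ n ]
  level (ℓ ∷ a) zero    = ℓ
  level (ℓ ∷ a) (suc i) = level a i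

  height : Index → ℕ
  height ⊥₋    = 0
  height [ c ] = toℕ c

  -- The factor by which T P exceeds T (p ^ c) on elements fixed by σ ^ (p ^ c), see `T-q`. The
  -- value 0 at `⊥₋` is compatible with this, since such elements vanish, and it keeps an absent
  -- slot from restricting the exponent e.
  q : ℕ → ℕ → Index → ℕ
  q p d ⊥₋    = 0
  q p d [ c ] = gsum (d ℕ.^ (p ℕ.^ toℕ c)) (p ℕ.^ (n ∸ toℕ c))

record IsIdeal {a ℓ ρ} (R : CommutativeRing a ℓ) (M : CommutativeRing.Carrier R → Set ρ) : Set (a ⊔ ℓ ⊔ ρ) where
  open CommutativeRing R
  field
    0∈       : M 0#
    +-closed : ∀ {x y} → M x → M y → M (x + y)
    *-closed : ∀ z {x} → M x → M (z * x)
    resp     : ∀ {x y} → x ≈ y → M x → M y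

-- What is used of the multiplicative group M = K ˣ of a cyclic extension of degree p ^ n, written
-- additively as an ideal of a commutative ring in which the generator σ acts by multiplication.
record CyclicModule a₀ ℓ ρ : Set (lsuc (a₀ ⊔ ℓ ⊔ ρ)) where
  field
    R : CommutativeRing a₀ ℓ

  open Geometric R

  field
    σ ξ       : Carrier
    {p}       : ℕ
    p-prime   : Prime p
    n         : ℕ
    1≤n       : 1 ≤ n
    M         : Carrier → Set ρ
    M-ideal   : IsIdeal R M
    σ-order   : ∀ {x} → M x → σ ^ (p ^ℕ n) * x ≈ x
    hilbert90 : ∀ c → c ≤ n → ∀ {x} → M x → geom 1# (σ ^ (p ^ℕ c)) (p ^ℕ (n ∸ c)) * x ≈ 0# →
                ∃[ γ ] M γ × x ≈ (σ ^ (p ^ℕ c) - 1#) * γ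
    ξ∈M       : M ξ
    ξ≉0       : ¬ ξ ≈ 0#
    σξ        : σ * ξ ≈ ξ
    pξ        : ι p * ξ ≈ 0#
    p-torsion : ∀ {x} → M x → ι p * x ≈ 0# → ∃[ j ] x ≈ ι j * ξ

module Pairs {a₀ ℓ ρ} (C : CyclicModule a₀ ℓ ρ) where
  open CyclicModule C
  open Geometric R
  open Families R
  open Levels n
  open import Relation.Binary.Reasoning.Setoid setoid

  P : ℕ
  P = p ℕ.^ n

  N : ℕ → Carrier
  N = geom 1# σ

  -- Membership in the intermediate field of the given level, expressed by the Galois action alone.
  -- Level `⊥₋` is the convention that δ = 1, written additively.
  At : Carrier → Index → Set ℓ
  At x ⊥₋    = x ≈ 0#
  At x [ c ] = σ ^ (p ℕ.^ toℕ c) * x ≈ x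

  At-0 : ∀ l → At 0# l
  At-0 ⊥₋    = refl
  At-0 [ c ] = zeroʳ _

  At-+ : ∀ l {x y} → At x l → At y l → At (x + y) l
  At-+ ⊥₋    hx hy = trans (+-cong hx hy) (+-identityˡ 0#)
  At-+ [ c ] hx hy = trans (distribˡ _ _ _) (+-cong hx hy)

  At-* : ∀ l z {x} → At x l → At (z * x) l
  At-* ⊥₋    z hx = trans (*-congˡ hx) (zeroʳ z)
  At-* [ c ] z {x} hx = trans (solve 3 (λ u z x → u :* (z :* x) := z :* (u :* x)) refl (σ ^ (p ℕ.^ toℕ c)) z x) (*-congˡ hx)

  At-single : ∀ {k} (f : Fin k → Index) j {v} → At v (f j) → ∀ i → At (single j v i) (f i)
  At-single f zero    hv zero    = hv
  At-single f zero    hv (suc i) = At-0 (f (suc i))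
  At-single f (suc j) hv zero    = At-0 (f zero)
  At-single f (suc j) hv (suc i) = At-single (λ i → f (suc i)) j hv i

  -- The contributions of the family δ to the two defining equations of a norm pair.
  S : ∀ {m} → (Fin (suc m) → Carrier) → Carrier
  S x = ∑ (λ i → ι (p ℕ.^ toℕ i) * x i)

  L : ∀ {m} → (Fin (suc m) → Carrier) → Carrier
  L x = N (p ℕ.^ (n ∸ 1)) * x zero + ∑ (λ i → ι (p ℕ.^ toℕ i) * (N P * x (suc i)))

  S-+ : ∀ {m} (x y : Fin (suc m) → Carrier) → S (λ i → x i + y i) ≈ S x + S y
  S-+ x y = trans (∑-cong (λ i → distribˡ _ _ _)) (∑-+ _ (λ i → ι (p ℕ.^ toℕ i) * y i))

  S-* : ∀ {m} z (x : Fin (suc m) → Carrier) → S (λ i → z * x i) ≈ z * S x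
  S-* z x = trans (∑-cong (λ i → solve 3 (λ u z x → u :* (z :* x) := z :* (u :* x)) refl (ι (p ℕ.^ toℕ i)) z (x i)))
    (∑-* z (λ i → ι (p ℕ.^ toℕ i) * x i))

  S-single : ∀ {m} (j : Fin (suc m)) v → S (single j v) ≈ ι (p ℕ.^ toℕ j) * v
  S-single j v = ∑-single (λ i → ι (p ℕ.^ toℕ i)) j v

  L-+ : ∀ {m} (x y : Fin (suc m) → Carrier) → L (λ i → x i + y i) ≈ L x + L y
  L-+ x y = begin
    N (p ℕ.^ (n ∸ 1)) * (x zero + y zero) + ∑ (λ i → ι (p ℕ.^ toℕ i) * (N P * (x (suc i) + y (suc i))))
      ≈⟨ +-congˡ (trans (∑-cong (λ i → solve 4 (λ u n x y → u :* (n :* (x :+ y)) := u :* (n :* x) :+ u :* (n :* y))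
           refl (ι (p ℕ.^ toℕ i)) (N P) (x (suc i)) (y (suc i))))
           (∑-+ (λ i → ι (p ℕ.^ toℕ i) * (N P * x (suc i))) (λ i → ι (p ℕ.^ toℕ i) * (N P * y (suc i))))) ⟩
    N (p ℕ.^ (n ∸ 1)) * (x zero + y zero) + (∑ (λ i → ι (p ℕ.^ toℕ i) * (N P * x (suc i))) + ∑ (λ i → ι (p ℕ.^ toℕ i) * (N P * y (suc i))))
      ≈⟨ solve 5 (λ n x y u v → n :* (x :+ y) :+ (u :+ v) := (n :* x :+ u) :+ (n :* y :+ v)) refl
           (N (p ℕ.^ (n ∸ 1))) (x zero) (y zero) _ _ ⟩
    L x + L y ∎

  L-* : ∀ {m} z (x : Fin (suc m) → Carrier) → L (λ i → z * x i) ≈ z * L x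
  L-* z x = begin
    N (p ℕ.^ (n ∸ 1)) * (z * x zero) + ∑ (λ i → ι (p ℕ.^ toℕ i) * (N P * (z * x (suc i))))
      ≈⟨ +-congˡ (trans (∑-cong (λ i → solve 4 (λ u n z x → u :* (n :* (z :* x)) := z :* (u :* (n :* x)))
           refl (ι (p ℕ.^ toℕ i)) (N P) z (x (suc i)))) (∑-* z (λ i → ι (p ℕ.^ toℕ i) * (N P * x (suc i))))) ⟩
    N (p ℕ.^ (n ∸ 1)) * (z * x zero) + z * ∑ (λ i → ι (p ℕ.^ toℕ i) * (N P * x (suc i)))
      ≈⟨ solve 4 (λ n x z u → n :* (z :* x) :+ z :* u := z :* (n :* x :+ u)) refl (N (p ℕ.^ (n ∸ 1))) (x zero) z _ ⟩
    z * L x ∎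

  L-single-zero : ∀ {m} v → L {m} (single zero v) ≈ N (p ℕ.^ (n ∸ 1)) * v
  L-single-zero v = trans (+-congˡ (∑-zero (λ i → trans (*-congˡ (zeroʳ _)) (zeroʳ _)))) (+-identityʳ _)

  L-single-suc : ∀ {m} (j : Fin m) v → L (single (suc j) v) ≈ ι (p ℕ.^ toℕ j) * (N P * v)
  L-single-suc j v = begin
    N (p ℕ.^ (n ∸ 1)) * 0# + ∑ (λ i → ι (p ℕ.^ toℕ i) * (N P * single j v i))
      ≈⟨ +-cong (zeroʳ _) (∑-cong (λ i → sym (*-assoc _ _ _))) ⟩
    0# + ∑ (λ i → ι (p ℕ.^ toℕ i) * N P * single j v i)
      ≈⟨ trans (+-identityˡ _) (∑-single (λ i → ι (p ℕ.^ toℕ i) * N P) j v) ⟩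
    ι (p ℕ.^ toℕ j) * N P * v
      ≈⟨ *-assoc _ _ _ ⟩
    ι (p ℕ.^ toℕ j) * (N P * v) ∎

  -- In the notation of norm pairs, y is α, x i is δ_i and S′ is (d - 1) / p.
  record IsPair {m} (a : Vec Index m) (S′ y : Carrier) (x : Fin (suc m) → Carrier) : Set (ℓ ⊔ ρ) where
    field
      y∈M     : M y
      x∈M     : ∀ i → M (x i)
      at      : ∀ i → At (x i) (level a i)
      twisted : σ * y ≈ (1# + ι p * S′) * y + S x
      normed  : ξ ≈ S′ * (N P * y) + L x

  Below : Index → Set
  Below l = ∀ c → l ≡ [ c ] → toℕ c < n

  -- Allows a multiple of p ^ (e′ + 1) to be moved from the multiplier d into the components of the pair.
  record Absorbed {m} (a : Vec Index m) (e′ : ℕ) (y : Carrier) (v : Fin (suc m) → Carrier) : Set (ℓ ⊔ ρ) where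
    field
      v∈M     : ∀ i → M (v i)
      u       : ℕ
      p∤u     : ¬ p ∣ u
      at      : ∀ i → At (v i) (level a i)
      twisted : ι (p ℕ.^ suc e′) * (ι u * y) ≈ S v
      normed  : ι (p ℕ.^ e′) * (ι u * (N P * y)) ≈ L v

-- The torsion element attached to a norm pair.

module Divided (p n : ℕ) .{{_ : NonZero p}} (s e′ r : ℕ)
  (power : suc (p *ℕ s) ^ℕ (p ^ℕ n) ≡ 1 +ℕ p ^ℕ suc e′ *ℕ r) where
  open import Data.Nat.Base using (_+_; _*_; _^_)
  open +-*-Solver
  open ≡.≡-Reasoning
  open Multiplier p s

  e : ℕ
  e = suc e′

  instance
    p^≢0 : ∀ {k} → NonZero (p ^ k)
    p^≢0 {k} = ℕ.m^n≢0 p k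

  pE≡ : p * E (p ^ n) ≡ p ^ e * r
  pE≡ = ℕ.suc-injective (≡.trans (≡.sym (d^≡1+pE (p ^ n))) power)

  E≡ : E (p ^ n) ≡ p ^ e′ * r
  E≡ = ℕ.*-cancelˡ-≡ (E (p ^ n)) _ p (≡.trans pE≡ (ℕ.*-assoc p (p ^ e′) r))

  module _ {c} (c≤n : c ≤ n) where
    private
      h = p ^ c
      l = p ^ (n ∸ c)
      g = gsum (d ^ h) l

    -- (d ^ h - 1) g = d ^ P - 1, as P = l h.
    E-gsum : p * E h * g ≡ p ^ e * r
    E-gsum = ℕ.suc-injective (begin
      1 + p * E h * g                       ≡⟨ ≡.cong (λ z → 1 + p * E h * gsum z l) (d^≡1+pE h) ⟩
      1 + p * E h * gsum (1 + p * E h) l    ≡⟨ ^-gsum (p * E h) l ⟨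
      (1 + p * E h) ^ l                     ≡⟨ ≡.cong (_^ l) (d^≡1+pE h) ⟨
      (d ^ h) ^ l                           ≡⟨ d^-swap l h ⟩
      d ^ (l * h)                           ≡⟨ ≡.cong (d ^_) (p^-split p c≤n) ⟨
      d ^ (p ^ n)                           ≡⟨ power ⟩
      1 + p ^ e * r                         ∎)

    -- Both r and r′ stem from d ^ P - 1: multiply the hypothesis by d ^ h - 1, use (d ^ h - 1) g =
    -- d ^ P - 1, and cancel p ^ e. The relation makes the terms of the root fit together under σ -
    -- d.
    E-quotient : ∀ i r′ → p ^ i * g ≡ p ^ e * r′ → r′ * (p * E h) ≡ p ^ i * r
    E-quotient i r′ hr = ℕ.*-cancelˡ-≡ _ _ (p ^ e) ⦃ ℕ.m^n≢0 p e ⦄ (begin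
      p ^ e * (r′ * (p * E h))      ≡⟨ ℕ.*-assoc (p ^ e) r′ _ ⟨
      p ^ e * r′ * (p * E h)        ≡⟨ ≡.cong (_* (p * E h)) hr ⟨
      p ^ i * g * (p * E h)         ≡⟨ solve 3 (λ a b c → a :* b :* c := a :* (c :* b)) ≡.refl (p ^ i) g (p * E h) ⟩
      p ^ i * (p * E h * g)         ≡⟨ ≡.cong (p ^ i *_) E-gsum ⟩
      p ^ i * (p ^ e * r)           ≡⟨ solve 3 (λ a b c → a :* (b :* c) := b :* (a :* c)) ≡.refl (p ^ i) (p ^ e) r ⟩
      p ^ e * (p ^ i * r)           ∎)

-- The power p ^ (e′ + 1) is the order of the torsion element produced by the pair.
record Data {a₀ ℓ ρ} (C : CyclicModule a₀ ℓ ρ) : Set (a₀ ⊔ ℓ ⊔ ρ) where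
  open CyclicModule C
  open Geometric R
  open Levels n
  open Pairs C
  field
    {m}    : ℕ
    a      : Vec Index m
    s      : ℕ
    y      : Carrier
    x      : Fin (suc m) → Carrier
    pair   : IsPair a (ι s) y x
    bottom : Below (level a zero)
    e′ r   : ℕ
    r′     : Fin (suc m) → ℕ
    power  : suc (p *ℕ s) ^ℕ (p ^ℕ n) ≡ 1 +ℕ p ^ℕ suc e′ *ℕ r
    levels : ∀ i → p ^ℕ toℕ i *ℕ q p (suc (p *ℕ s)) (level a i) ≡ p ^ℕ suc e′ *ℕ r′ i

module Torsion {a₀ ℓ ρ} (C : CyclicModule a₀ ℓ ρ) (D : Data C) where
  open CyclicModule C
  open Data D
  private instance
    p≢0 : NonZero p
    p≢0 = prime⇒nonZero p-prime
  open Geometric R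
  open Families R
  open Levels n
  open Pairs C hiding (N)
  open Twisted R σ p s
  open Divided p n s e′ r power
  open import Relation.Binary.Reasoning.Setoid setoid

  h : Index → ℕ
  h l = p ^ℕ height l

  T-q : ∀ l {x} → At x l → T P * x ≈ ι (q p d l) * (T (h l) * x)
  T-q ⊥₋    {x} hx = linear₁ (T P - ι 0 * T 1) hx (solve 4 (λ t u x o →
      t :* x :+ (t :- o :* u) :* con ℤ.0ℤ := o :* (u :* x) :+ (t :- o :* u) :* x) refl (T P) (T 1) x (ι 0))
  T-q [ c ] {x} hx = trans (*-congʳ (reflexive (≡.cong T (p^-split p (ℕ.s≤s⁻¹ (Fin.toℕ<n c))))))
    (T-* (p ^ℕ toℕ c) (p ^ℕ (n ∸ toℕ c)) hx)

  T-eigen : ∀ c {x} → σ ^ (p ^ℕ c) * x ≈ x →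
            σ * (T (p ^ℕ c) * x) + ι (p *ℕ E (p ^ℕ c)) * x ≈ ι d * (T (p ^ℕ c) * x)
  T-eigen c {x} hc = linear₄ x (geom-difference (ι d) σ (p ^ℕ c)) (- x) (ι-d^ (p ^ℕ c)) 1# hc x (ι-* p (E (p ^ℕ c)))
    (solve 8 (λ σ d t x u v p e′ →
         σ :* (t :* x) :+ e′ :* x :+ x :* (u :- v) :+ (:- x) :* (:1 :+ p) :+ :1 :* x :+ x :* p
      := d :* (t :* x) :+ x :* ((σ :- d) :* t) :+ (:- x) :* v :+ :1 :* (u :* x) :+ x :* e′)
      refl σ (ι d) (T (p ^ℕ c)) x (σ ^ (p ^ℕ c)) (ι d ^ (p ^ℕ c)) (ι p * ι (E (p ^ℕ c))) (ι (p *ℕ E (p ^ℕ c))))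

  module _ (i r′ : ℕ) where

    module _ (l : Index) (hr : p ^ℕ i *ℕ q p d l ≡ p ^ℕ e *ℕ r′) {x : Carrier} (hx : At x l) where

      term-total : ι (p ^ℕ e) * (ι r′ * (T (h l) * x)) ≈ ι (p ^ℕ i) * (T P * x)
      term-total = begin
        ι (p ^ℕ e) * (ι r′ * (T (h l) * x))    ≈⟨ *-assoc _ _ _ ⟨
        ι (p ^ℕ e) * ι r′ * (T (h l) * x)      ≈⟨ *-congʳ (ι-* (p ^ℕ e) r′) ⟨
        ι (p ^ℕ e *ℕ r′) * (T (h l) * x)       ≡⟨ ≡.cong (λ z → ι z * (T (h l) * x)) hr ⟨
        ι (p ^ℕ i *ℕ q p d l) * (T (h l) * x)  ≈⟨ *-congʳ (ι-* (p ^ℕ i) (q p d l)) ⟩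
        ι (p ^ℕ i) * ι (q p d l) * (T (h l) * x) ≈⟨ *-assoc _ _ _ ⟩
        ι (p ^ℕ i) * (ι (q p d l) * (T (h l) * x)) ≈⟨ *-congˡ (T-q l hx) ⟨
        ι (p ^ℕ i) * (T P * x) ∎

    -- On a field of level c the identity (σ - d) T (p ^ c) = σ ^ (p ^ c) - d ^ (p ^ c) turns into
    -- multiplication by 1 - d ^ (p ^ c), and `E-quotient` rewrites r′ times this as - r p ^ i.
    term-twist : ∀ l → p ^ℕ i *ℕ q p d l ≡ p ^ℕ e *ℕ r′ → ∀ {x} → At x l →
                 σ * (ι r′ * (T (h l) * x)) + ι r * (ι (p ^ℕ i) * x) ≈ ι d * (ι r′ * (T (h l) * x))
    term-twist ⊥₋    hr {x} hx = linear₁ (σ * ι r′ * T 1 + ι r * ι (p ^ℕ i) - ι d * ι r′ * T 1) hx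
      (solve 7 (λ σ r′ t x r u d →
         σ :* (r′ :* (t :* x)) :+ r :* (u :* x) :+ (σ :* r′ :* t :+ r :* u :- d :* r′ :* t) :* con ℤ.0ℤ
         := d :* (r′ :* (t :* x)) :+ (σ :* r′ :* t :+ r :* u :- d :* r′ :* t) :* x)
       refl σ (ι r′) (T 1) x (ι r) (ι (p ^ℕ i)) (ι d))
    term-twist [ c ] hr {x} hx = linear₄ (ι r′) (T-eigen (toℕ c) hx)
        (- x) (reflexive (≡.cong ι (E-quotient (ℕ.s≤s⁻¹ (Fin.toℕ<n c)) i r′ hr)))
        x (ι-* r′ (p *ℕ E (p ^ℕ toℕ c))) (- x) (ι-* (p ^ℕ i) r)
      (solve 10 (λ σ r′ t x r u d f g k →
          σ :* (r′ :* t) :+ r :* (u :* x) :+ r′ :* (d :* t) :+ (:- x) :* g :+ x :* (r′ :* f) :+ (:- x) :* (u :* r)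
          := d :* (r′ :* t) :+ r′ :* (σ :* t :+ f :* x) :+ (:- x) :* k :+ x :* k :+ (:- x) :* g)
        refl σ (ι r′) (T (p ^ℕ toℕ c) * x) x (ι r) (ι (p ^ℕ i)) (ι d) (ι (p *ℕ E (p ^ℕ toℕ c))) (ι (p ^ℕ i *ℕ r))
          (ι (r′ *ℕ (p *ℕ E (p ^ℕ toℕ c)))))

    term-total′ : ∀ {i′} → i ≡ suc i′ → ∀ l → p ^ℕ i *ℕ q p d l ≡ p ^ℕ e *ℕ r′ → ∀ {x} → At x l →
                  ι (p ^ℕ e′) * (ι r′ * (T (h l) * x)) ≈ ι (p ^ℕ i′) * (T P * x)
    term-total′ {i′} ≡.refl l hr {x} hx = begin
      ι (p ^ℕ e′) * (ι r′ * (T (h l) * x))       ≈⟨ *-assoc _ _ _ ⟨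
      ι (p ^ℕ e′) * ι r′ * (T (h l) * x)         ≈⟨ *-congʳ (ι-* (p ^ℕ e′) r′) ⟨
      ι (p ^ℕ e′ *ℕ r′) * (T (h l) * x)          ≡⟨ ≡.cong (λ z → ι z * (T (h l) * x)) cancelled ⟨
      ι (p ^ℕ i′ *ℕ q p d l) * (T (h l) * x)     ≈⟨ *-congʳ (ι-* (p ^ℕ i′) (q p d l)) ⟩
      ι (p ^ℕ i′) * ι (q p d l) * (T (h l) * x)  ≈⟨ *-assoc _ _ _ ⟩
      ι (p ^ℕ i′) * (ι (q p d l) * (T (h l) * x)) ≈⟨ *-congˡ (T-q l hx) ⟨
      ι (p ^ℕ i′) * (T P * x)                    ∎
      where
      cancelled : p ^ℕ i′ *ℕ q p d l ≡ p ^ℕ e′ *ℕ r′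
      cancelled = ℕ.*-cancelˡ-≡ _ _ p (≡.trans (≡.sym (ℕ.*-assoc p _ _)) (≡.trans hr (ℕ.*-assoc p _ _)))

  -- At the bottom slot the p-th part of the norm is formal: N (p ^ (n - 1)) plays the role of N P / p.
  term-bottom : ∀ r′ l → q p d l ≡ p ^ℕ e *ℕ r′ → (∀ c → l ≡ [ c ] → toℕ c < n) → ∀ {x} → At x l →
                ι (p ^ℕ e′) * (ι r′ * (T (h l) * x)) ≈ N (p ^ℕ (n ∸ 1)) * x + Y P * x
  term-bottom r′ ⊥₋ hr l<n {x} hx = linear₁ (ι (p ^ℕ e′) * ι r′ * T 1 - N (p ^ℕ (n ∸ 1)) - Y P) hx
    (solve 6 (λ u r t n y x → u :* (r :* (t :* x)) :+ (u :* r :* t :- n :- y) :* con ℤ.0ℤ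
       := n :* x :+ y :* x :+ (u :* r :* t :- n :- y) :* x) refl (ι (p ^ℕ e′)) (ι r′) (T 1) (N (p ^ℕ (n ∸ 1))) (Y P) x)
  term-bottom r′ [ c ] hr l<n {x} hx = linear₄ (T h′ * x) numbers 1# (sym N-bottom) (- 1#) Y-bottom
      (ι (l′ +ℕ f)) (trans (*-congʳ (T≈N+pY h′)) (trans (distribʳ x (N h′) (ι p * Y h′)) (+-congˡ (*-assoc _ _ _))))
      (linear₂ (- (Y h′ * x)) gsum-numbers (N h′ * x) (ι-+ l′ f)
      (solve 14 (λ u r t l f n y m z g p v w k →
        u :* (r :* t) :+ t :* k :+ :1 :* m :+ (:- :1) :* (f :* n :+ g :* y) :+ k :* (n :+ p :* y) :+ (:- y) :* (p :* k) :+ n :* (l :+ f)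
        := m :+ z :+ t :* (u :* r) :+ :1 :* (l :* n) :+ (:- :1) :* z :+ k :* t :+ (:- y) :* g :+ n :* k)
      refl (ι (p ^ℕ e′)) (ι r′) (T h′ * x) (ι l′) (ι f) (N h′ * x) (Y h′ * x) (N (p ^ℕ (n ∸ 1)) * x)
        (Y P * x) (ι (gsum (d ^ℕ h′) (p ^ℕ (n ∸ toℕ c)))) (ι p) 0# 0# (ι (l′ +ℕ f))))
    where
    c<n : toℕ c < n
    c<n = l<n c ≡.refl
    h′ l′ f : ℕ
    h′ = p ^ℕ toℕ c
    l′ = p ^ℕ (n ∸ 1 ∸ toℕ c)
    f  = gsumQuotient h′ (p ^ℕ (n ∸ toℕ c))
    pl′ : p ^ℕ (n ∸ toℕ c) ≡ p *ℕ l′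
    pl′ = ≡.cong (p ^ℕ_) (∸-suc c<n)
    g≡ : gsum (d ^ℕ h′) (p ^ℕ (n ∸ toℕ c)) ≡ p *ℕ (l′ +ℕ f)
    g≡ = ≡.trans (gsum-quotient h′ (p ^ℕ (n ∸ toℕ c))) (≡.trans (≡.cong (_+ℕ p *ℕ f) pl′) (≡.sym (ℕ.*-distribˡ-+ p l′ f)))
    numbers : ι (p ^ℕ e′) * ι r′ ≈ ι (l′ +ℕ f)
    numbers = trans (sym (ι-* _ r′)) (ι-cong (ℕ.*-cancelˡ-≡ _ _ p
      (≡.trans (≡.sym (ℕ.*-assoc p _ r′)) (≡.trans (≡.sym hr) g≡))))
    gsum-numbers : ι (gsum (d ^ℕ h′) (p ^ℕ (n ∸ toℕ c))) ≈ ι p * ι (l′ +ℕ f)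
    gsum-numbers = trans (ι-cong g≡) (ι-* p _)
    N-bottom : N (p ^ℕ (n ∸ 1)) * x ≈ ι l′ * (N h′ * x)
    N-bottom = trans (*-congʳ (reflexive (≡.cong N (p^-split p (ℕ.∸-monoˡ-≤ 1 c<n))))) (N-* h′ l′ hx)
    Y-bottom : Y P * x ≈ ι f * (N h′ * x) + ι (gsum (d ^ℕ h′) (p ^ℕ (n ∸ toℕ c))) * (Y h′ * x)
    Y-bottom = trans (*-congʳ (reflexive (≡.cong Y (p^-split p (ℕ.<⇒≤ c<n))))) (Y-fixed h′ (p ^ℕ (n ∸ toℕ c)) hx)

  N-bottom : ∀ l → Below l → ∀ {x} → At x l → N P * x ≈ ι p * (N (p ^ℕ (n ∸ 1)) * x)
  N-bottom ⊥₋    l<n {x} hx = linear₁ (N P - ι p * N (p ^ℕ (n ∸ 1))) hx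
    (solve 4 (λ a p b x → a :* x :+ (a :- p :* b) :* con ℤ.0ℤ := p :* (b :* x) :+ (a :- p :* b) :* x)
      refl (N P) (ι p) (N (p ^ℕ (n ∸ 1))) x)
  N-bottom [ c ] l<n {x} hx = trans (*-congʳ (reflexive (≡.cong N P≡))) (N-* (p ^ℕ (n ∸ 1)) p fixed)
    where
    c<n = l<n c ≡.refl
    P≡ : P ≡ p *ℕ p ^ℕ (n ∸ 1)
    P≡ = ≡.cong (p ^ℕ_) (≡.sym (ℕ.suc-pred n ⦃ ℕ.>-nonZero (ℕ.≤-<-trans z≤n c<n) ⦄))
    fixed : σ ^ (p ^ℕ (n ∸ 1)) * x ≈ x
    fixed = trans (*-congʳ (trans (^-congʳ (p^-split p (ℕ.∸-monoˡ-≤ 1 c<n))) (^-swap σ (p ^ℕ (n ∸ 1 ∸ toℕ c)) (p ^ℕ toℕ c))))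
      (fixed-^ (p ^ℕ (n ∸ 1 ∸ toℕ c)) hx)
      where
      ^-congʳ : ∀ {j k} → j ≡ k → σ ^ j ≈ σ ^ k
      ^-congʳ ≡.refl = refl

  S-suc : ∀ {m} (x : Fin (suc m) → Carrier) → S x ≈ x zero + ∑ (λ i → ι (p ^ℕ suc (toℕ i)) * x (suc i))
  S-suc x = trans (∑-suc _) (+-congʳ (trans (*-congʳ ι-1) (*-identityˡ _)))

  -- In the slots after the first, the factor p is taken from p ^ i. Slot zero has none, but its
  -- component lies in a proper subfield, on which N P is p times N (p ^ (n - 1)).
  N-S : ∀ {m l} (x : Fin (suc m) → Carrier) → Below l → At (x zero) l → N P * S x ≈ ι p * L x
  N-S {l = l} x l<n h₀ = begin
    N P * S x
      ≈⟨ *-congˡ (S-suc x) ⟩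
    N P * (x zero + ∑ (λ i → ι (p ^ℕ suc (toℕ i)) * x (suc i)))
      ≈⟨ linear₂ 1# (N-bottom l l<n h₀) 1# total
          (solve 7 (λ N x s p N₁ t z → N :* (x :+ s) :+ :1 :* (p :* (N₁ :* x)) :+ :1 :* (p :* t)
             := p :* (N₁ :* x :+ t) :+ :1 :* (N :* x) :+ :1 :* (N :* s))
            refl (N P) (x zero) (∑ (λ i → ι (p ^ℕ suc (toℕ i)) * x (suc i))) (ι p) (N (p ^ℕ (n ∸ 1)))
              (∑ (λ i → ι (p ^ℕ toℕ i) * (N P * x (suc i)))) 0#) ⟩
    ι p * L x ∎
    where
    total : N P * ∑ (λ i → ι (p ^ℕ suc (toℕ i)) * x (suc i)) ≈ ι p * ∑ (λ i → ι (p ^ℕ toℕ i) * (N P * x (suc i)))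
    total = trans (sym (∑-* (N P) _)) (trans (∑-cong (λ i → trans (*-congˡ (*-congʳ (ι-* p (p ^ℕ toℕ i))))
      (solve 4 (λ N p u x → N :* (p :* u :* x) := p :* (u :* (N :* x))) refl (N P) (ι p) (ι (p ^ℕ toℕ i)) (x (suc i)))))
      (∑-* (ι p) _))

  open IsPair pair

  t : Fin (suc m) → Carrier
  t i = ι (r′ i) * (T (h (level a i)) * x i)

  private
    twist : ∀ i → σ * t i + ι r * (ι (p ^ℕ toℕ i) * x i) ≈ ι d * t i
    twist i = term-twist (toℕ i) (r′ i) (level a i) (levels i) (at i)

    t-zero : ι (p ^ℕ e′) * t zero ≈ N (p ^ℕ (n ∸ 1)) * x zero + Y P * x zero
    t-zero = term-bottom (r′ zero) (level a zero)
      (≡.trans (≡.sym (ℕ.*-identityˡ _)) (levels zero)) bottom (at zero)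

    t-suc : ∀ i → ι (p ^ℕ e′) * t (suc i) ≈ ι (p ^ℕ toℕ i) * (T P * x (suc i))
    t-suc i = term-total′ (suc (toℕ i)) (r′ (suc i)) ≡.refl (level a (suc i)) (levels (suc i)) (at (suc i))

    t-sum : ι (p ^ℕ e′) * ∑ t ≈ L x + Y P * S x
    t-sum = begin
      ι (p ^ℕ e′) * ∑ t
        ≈⟨ ∑-* _ t ⟨
      ∑ (λ i → ι (p ^ℕ e′) * t i)
        ≈⟨ ∑-suc _ ⟩
      ι (p ^ℕ e′) * t zero + ∑ (λ i → ι (p ^ℕ e′) * t (suc i))
        ≈⟨ +-cong t-zero (∑-cong (λ i → trans (t-suc i) (expand i))) ⟩
      N₁ * x zero + Y P * x zero + ∑ (λ i → ι (p ^ℕ toℕ i) * (N P * x (suc i)) + Y P * (ι (p ^ℕ suc (toℕ i)) * x (suc i)))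
        ≈⟨ +-congˡ (trans (∑-+ _ _) (+-congˡ (∑-* (Y P) _))) ⟩
      N₁ * x zero + Y P * x zero + (∑ (λ i → ι (p ^ℕ toℕ i) * (N P * x (suc i))) + Y P * ∑ (λ i → ι (p ^ℕ suc (toℕ i)) * x (suc i)))
        ≈⟨ solve 5 (λ n x y a b → n :* x :+ y :* x :+ (a :+ y :* b) := n :* x :+ a :+ y :* (x :+ b)) refl
             N₁ (x zero) (Y P) _ _ ⟩
      L x + Y P * (x zero + ∑ (λ i → ι (p ^ℕ suc (toℕ i)) * x (suc i)))
        ≈⟨ +-congˡ (*-congˡ (S-suc x)) ⟨
      L x + Y P * S x ∎
      where
      N₁ = N (p ^ℕ (n ∸ 1))
      expand : ∀ i → ι (p ^ℕ toℕ i) * (T P * x (suc i)) ≈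
               ι (p ^ℕ toℕ i) * (N P * x (suc i)) + Y P * (ι (p ^ℕ suc (toℕ i)) * x (suc i))
      expand i = linear₂ (ι (p ^ℕ toℕ i) * x (suc i)) (T≈N+pY P) (- (Y P * x (suc i))) (ι-* p (p ^ℕ toℕ i))
        (solve 7 (λ u t x n y p v → u :* (t :* x) :+ u :* x :* (n :+ p :* y) :+ (:- (y :* x)) :* (p :* u)
          := u :* (n :* x) :+ y :* (v :* x) :+ u :* x :* t :+ (:- (y :* x)) :* v)
         refl (ι (p ^ℕ toℕ i)) (T P) (x (suc i)) (N P) (Y P) (ι p) (ι (p ^ℕ suc (toℕ i))))

  S-diff : S x ≈ (σ - ι d) * y
  S-diff = linear₂ (- 1#) twisted y ι-d
    (solve 6 (λ σ y p s d S → S :+ (:- :1) :* ((:1 :+ p :* s) :* y :+ S) :+ y :* (:1 :+ p :* s)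
      := (σ :- d) :* y :+ (:- :1) :* (σ :* y) :+ y :* d) refl σ y (ι p) (ι s) (ι d) (S x))

  root : Carrier
  root = ι r * y + ∑ t

  -- Slot by slot (σ - d) t i = - r p ^ i x i, and the sum of these cancels r (σ - d) y = r S x.
  root-eigen : σ * root ≈ ι d * root
  root-eigen = linear₃ (ι r) twisted (- (ι r * y)) ι-d 1# t-twist
    (solve 9 (λ σ r y t d p s S x →
        σ :* (r :* y :+ t) :+ r :* ((:1 :+ p :* s) :* y :+ S) :+ (:- (r :* y)) :* (:1 :+ p :* s) :+ :1 :* (d :* t)
        := d :* (r :* y :+ t) :+ r :* (σ :* y) :+ (:- (r :* y)) :* d :+ :1 :* (σ :* t :+ r :* S))
      refl σ (ι r) y (∑ t) (ι d) (ι p) (ι s) (S x) 0#)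
    where
    t-twist : σ * ∑ t + ι r * S x ≈ ι d * ∑ t
    t-twist = trans (+-cong (sym (∑-* σ t)) (sym (∑-* (ι r) (λ i → ι (p ^ℕ toℕ i) * x i))))
      (trans (sym (∑-+ (λ i → σ * t i) _)) (trans (∑-cong twist) (∑-* (ι d) t)))

  -- With p ^ e as factor the result would be T P (S x) + (d ^ P - 1) y = 0. With one factor p less
  -- it is the p-th part of this, L x + Y P (S x) + E P y, and by `Y-twist` this equals s N P y + L
  -- x, the right side of the norm condition.
  root-order : ι (p ^ℕ e′) * root ≈ ξ
  root-order = linear₃ 1# t-sum (Y P) S-diff y (Y-twist P)
    (linear₂ (- y) E-number (- 1#) normed
    (solve 13 (λ u r y t l Y S σ d n s E X →
        u :* (r :* y :+ t) :+ :1 :* (l :+ Y :* S) :+ Y :* ((σ :- d) :* y) :+ y :* (s :* n :- E)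
          :+ (:- y) :* (u :* r) :+ (:- :1) :* (s :* (n :* y) :+ l)
        := X :+ :1 :* (u :* t) :+ Y :* S :+ y :* (Y :* (σ :- d)) :+ (:- y) :* E :+ (:- :1) :* X)
      refl (ι (p ^ℕ e′)) (ι r) y (∑ t) (L x) (Y P) (S x) σ (ι d) (N P) (ι s) (ι (E P)) ξ))
    where
    E-number : ι (E P) ≈ ι (p ^ℕ e′) * ι r
    E-number = trans (ι-cong E≡) (ι-* (p ^ℕ e′) r)

  -- If p does not divide r, then p ^ e * root = 0 expresses p ^ e * (r y) through the x i.
  absorbed-by-power : ¬ p ∣ r → N P * ξ ≈ 0# → Absorbed a e′ y (λ i → - T P * x i)
  absorbed-by-power p∤r Nξ = record
    { v∈M     = λ i → IsIdeal.*-closed M-ideal (- T P) (x∈M i)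
    ; u       = r
    ; p∤u     = p∤r
    ; at      = λ i → At-* (level a i) (- T P) (at i)
    ; twisted = linear₄ (ι p) root-order (- 1#) t-total 1# pξ (ι r * y + ∑ t) (ι-* p (p ^ℕ e′))
        (linear₁ (- 1#) (S-* (- T P) x)
        (solve 11 (λ v u p r y t ξ T S o z →
           v :* (r :* y) :+ p :* ξ :+ (:- :1) :* (T :* S) :+ :1 :* con ℤ.0ℤ :+ (r :* y :+ t) :* (p :* u) :+ (:- :1) :* ((:- T) :* S)
           := o :+ p :* (u :* (r :* y :+ t)) :+ (:- :1) :* (v :* t) :+ :1 :* (p :* ξ) :+ (r :* y :+ t) :* v :+ (:- :1) :* o)
          refl (ι (p ^ℕ e)) (ι (p ^ℕ e′)) (ι p) (ι r) y (∑ t) ξ (T P) (S x) (S (λ i → - T P * x i)) 0#))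
    -- As N ξ = 0, it remains to take the norm of L x + Y P (S x). By N (S x) = p L x it is (N P + p
    -- Y P) L x = T P (L x).
    ; normed  = linear₄ (N P) root-order (- N P) t-sum 1# Nξ (- 1#) (L-* (- T P) x)
        (linear₂ (L x) (T≈N+pY P) (- Y P) (N-S x bottom (at zero))
        (solve 12 (λ u p r y t ξ T N Y S l o →
           u :* (r :* (N :* y)) :+ N :* ξ :+ (:- N) :* (l :+ Y :* S) :+ :1 :* con ℤ.0ℤ :+ (:- :1) :* ((:- T) :* l)
             :+ l :* (N :+ p :* Y) :+ (:- Y) :* (p :* l)
           := o :+ N :* (u :* (r :* y :+ t)) :+ (:- N) :* (u :* t) :+ :1 :* (N :* ξ) :+ (:- :1) :* o
             :+ l :* T :+ (:- Y) :* (N :* S))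
          refl (ι (p ^ℕ e′)) (ι p) (ι r) y (∑ t) ξ (T P) (N P) (Y P) (S x) (L x) (L (λ i → - T P * x i))))
    }
    where
    t-total : ι (p ^ℕ e) * ∑ t ≈ T P * S x
    t-total = trans (sym (∑-* _ t)) (trans (∑-cong (λ i → term-total (toℕ i) (r′ i) (level a i) (levels i) (at i)))
      (S-* (T P) x))

  root∈M : M root
  root∈M = IsIdeal.+-closed M-ideal (IsIdeal.*-closed M-ideal (ι r) y∈M)
    (∑-closed M (IsIdeal.0∈ M-ideal) (IsIdeal.+-closed M-ideal)
      (λ i → IsIdeal.*-closed M-ideal (ι (r′ i)) (IsIdeal.*-closed M-ideal (T (h (level a i))) (x∈M i))))

-- Absorbing through a slot whose coefficient is prime to p.

-- The number k (k - 1) / 2, which enters as the derivative at 1 of 1 + x + ... + x ^ (k - 1).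
tri : ℕ → ℕ
tri zero    = 0
tri (suc k) = tri k +ℕ k

-- Grouping the summands into blocks of the higher level c shows that q can only gain divisibility
-- when the level drops.
gsum-level : ∀ p d {b c n} → b ≤ c → c ≤ n →
  gsum (d ^ℕ (p ^ℕ b)) (p ^ℕ (n ∸ b)) ≡
  gsum (d ^ℕ (p ^ℕ b)) (p ^ℕ (c ∸ b)) *ℕ gsum (d ^ℕ (p ^ℕ c)) (p ^ℕ (n ∸ c))
gsum-level p d {b} {c} {n} b≤c c≤n = begin
  gsum D (p ^ (n ∸ b))                                   ≡⟨ ≡.cong (λ k → gsum D (p ^ k)) exponent ⟨
  gsum D (p ^ (n ∸ c + (c ∸ b)))                         ≡⟨ ≡.cong (gsum D) (ℕ.^-distribˡ-+-* p (n ∸ c) (c ∸ b)) ⟩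
  gsum D (p ^ (n ∸ c) * p ^ (c ∸ b))                     ≡⟨ gsum-* D (p ^ (n ∸ c)) (p ^ (c ∸ b)) ⟩
  gsum D (p ^ (c ∸ b)) * gsum (D ^ (p ^ (c ∸ b))) (p ^ (n ∸ c))
    ≡⟨ ≡.cong (λ z → gsum D (p ^ (c ∸ b)) * gsum z (p ^ (n ∸ c))) power ⟩
  gsum D (p ^ (c ∸ b)) * gsum (d ^ (p ^ c)) (p ^ (n ∸ c)) ∎
  where
  open import Data.Nat.Base using (_+_; _*_; _^_)
  open ≡.≡-Reasoning
  D = d ^ (p ^ b)
  exponent : n ∸ c + (c ∸ b) ≡ n ∸ b
  exponent = ≡.trans (≡.sym (ℕ.+-∸-assoc (n ∸ c) b≤c)) (≡.cong (_∸ b) (ℕ.m∸n+n≡m c≤n))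
  power : D ^ (p ^ (c ∸ b)) ≡ d ^ (p ^ c)
  power = ≡.trans (ℕ.^-*-assoc d (p ^ b) (p ^ (c ∸ b)))
    (≡.cong (d ^_) (≡.trans (ℕ.*-comm (p ^ b) (p ^ (c ∸ b))) (≡.sym (p^-split p b≤c))))

module AbsorbLevel {a₀ ℓ ρ} (C : CyclicModule a₀ ℓ ρ) (D : Data C)
  (b : Fin (suc (Data.m D))) (c : Fin (suc (CyclicModule.n C)))
  (level-b : Levels.level (CyclicModule.n C) (Data.a D) b ≡ [ c ]) (p∤u : ¬ CyclicModule.p C ∣ Data.r′ D b) where
  open CyclicModule C
  open Data D
  private instance
    p≢0 : NonZero p
    p≢0 = prime⇒nonZero p-prime
  open Geometric R
  open Families R
  open Levels n
  open Pairs C hiding (N)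
  open Twisted R σ p s
  open Divided p n s e′ r power
  open Torsion C D
  open import Relation.Binary.Reasoning.Setoid setoid

  open IsPair pair

  module _ where
    u : ℕ
    u = r′ b

    h′ : ℕ
    h′ = p ^ℕ toℕ c

    τ : Carrier
    τ = σ ^ h′

    pᵇ : ℕ
    pᵇ = p ^ℕ toℕ b

    c≤n : toℕ c ≤ n
    c≤n = ℕ.s≤s⁻¹ (Fin.toℕ<n c)

    u-number : pᵇ *ℕ gsum (d ^ℕ h′) (p ^ℕ (n ∸ toℕ c)) ≡ p ^ℕ e *ℕ u
    u-number = ≡.subst (λ l → pᵇ *ℕ q p d l ≡ p ^ℕ e *ℕ u) level-b (levels b)

    Z : Index → Carrier
    Z ⊥₋ = 0#
    Z [ c′ ] with toℕ c′ ℕ.≤? toℕ c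
    ... | yes _ = 0#
    ... | no  _ = slope (ι d ^ h′) τ (p ^ℕ (toℕ c′ ∸ toℕ c)) * T h′

    z : Fin (suc m) → Carrier
    z i = ι (r′ i) * (Z (level a i) * x i)

  module _ (i r″ : ℕ) where
      -- Both u and r″ are quotients by p ^ e of multiples of q, and the two values of q differ by
      -- the geometric sum of `gsum-level`. The same comparison with the levels exchanged gives
      -- `upper`.
      lower : ∀ (c′ : Fin (suc n)) → toℕ c′ ≤ toℕ c → p ^ℕ i *ℕ q p d [ c′ ] ≡ p ^ℕ e *ℕ r″ →
              u *ℕ p ^ℕ i *ℕ gsum (d ^ℕ (p ^ℕ toℕ c′)) (p ^ℕ (toℕ c ∸ toℕ c′)) ≡ pᵇ *ℕ r″
      lower c′ c′≤c hr = ℕ.*-cancelˡ-≡ _ _ (p ^ℕ e) ⦃ ℕ.m^n≢0 p e ⦄ (Q.begin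
          p ^ℕ e *ℕ (u *ℕ p ^ℕ i *ℕ g)    Q.≡⟨ solve′ 4 (λ e u i g → e ⊗ (u ⊗ i ⊗ g) ⊜ i ⊗ g ⊗ (e ⊗ u)) ≡.refl (p ^ℕ e) u (p ^ℕ i) g ⟩
          p ^ℕ i *ℕ g *ℕ (p ^ℕ e *ℕ u)    Q.≡⟨ ≡.cong (p ^ℕ i *ℕ g *ℕ_) u-number ⟨
          p ^ℕ i *ℕ g *ℕ (pᵇ *ℕ g₁)       Q.≡⟨ solve′ 4 (λ i g b g₁ → i ⊗ g ⊗ (b ⊗ g₁) ⊜ b ⊗ (i ⊗ (g ⊗ g₁))) ≡.refl (p ^ℕ i) g pᵇ g₁ ⟩
          pᵇ *ℕ (p ^ℕ i *ℕ (g *ℕ g₁))     Q.≡⟨ ≡.cong (λ k → pᵇ *ℕ (p ^ℕ i *ℕ k)) (gsum-level p d c′≤c c≤n) ⟨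
          pᵇ *ℕ (p ^ℕ i *ℕ q p d [ c′ ])  Q.≡⟨ ≡.cong (pᵇ *ℕ_) hr ⟩
          pᵇ *ℕ (p ^ℕ e *ℕ r″)            Q.≡⟨ solve′ 3 (λ b e r → b ⊗ (e ⊗ r) ⊜ e ⊗ (b ⊗ r)) ≡.refl pᵇ (p ^ℕ e) r″ ⟩
          p ^ℕ e *ℕ (pᵇ *ℕ r″)            Q.∎)
        where
        module Q = ≡.≡-Reasoning
        open +-*-Solver using () renaming (solve to solve′; _:*_ to _⊗_; _:=_ to _⊜_)
        g = gsum (d ^ℕ (p ^ℕ toℕ c′)) (p ^ℕ (toℕ c ∸ toℕ c′))
        g₁ = gsum (d ^ℕ h′) (p ^ℕ (n ∸ toℕ c))

      upper : ∀ (c′ : Fin (suc n)) → toℕ c ≤ toℕ c′ → p ^ℕ i *ℕ q p d [ c′ ] ≡ p ^ℕ e *ℕ r″ →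
              pᵇ *ℕ r″ *ℕ gsum (d ^ℕ h′) (p ^ℕ (toℕ c′ ∸ toℕ c)) ≡ u *ℕ p ^ℕ i
      upper c′ c≤c′ hr = ℕ.*-cancelˡ-≡ _ _ (p ^ℕ e) ⦃ ℕ.m^n≢0 p e ⦄ (Q.begin
          p ^ℕ e *ℕ (pᵇ *ℕ r″ *ℕ g)              Q.≡⟨ solve′ 4 (λ e b r g → e ⊗ (b ⊗ r ⊗ g) ⊜ b ⊗ g ⊗ (e ⊗ r)) ≡.refl (p ^ℕ e) pᵇ r″ g ⟩
          pᵇ *ℕ g *ℕ (p ^ℕ e *ℕ r″)              Q.≡⟨ ≡.cong (pᵇ *ℕ g *ℕ_) hr ⟨
          pᵇ *ℕ g *ℕ (p ^ℕ i *ℕ q p d [ c′ ])    Q.≡⟨ solve′ 4 (λ b g i q → b ⊗ g ⊗ (i ⊗ q) ⊜ i ⊗ (b ⊗ (g ⊗ q))) ≡.refl pᵇ g (p ^ℕ i) (q p d [ c′ ]) ⟩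
          p ^ℕ i *ℕ (pᵇ *ℕ (g *ℕ q p d [ c′ ]))  Q.≡⟨ ≡.cong (λ k → p ^ℕ i *ℕ (pᵇ *ℕ k)) (gsum-level p d c≤c′ (ℕ.s≤s⁻¹ (Fin.toℕ<n c′))) ⟨
          p ^ℕ i *ℕ (pᵇ *ℕ gsum (d ^ℕ h′) (p ^ℕ (n ∸ toℕ c))) Q.≡⟨ ≡.cong (p ^ℕ i *ℕ_) u-number ⟩
          p ^ℕ i *ℕ (p ^ℕ e *ℕ u)                Q.≡⟨ solve′ 3 (λ i e u → i ⊗ (e ⊗ u) ⊜ e ⊗ (u ⊗ i)) ≡.refl (p ^ℕ i) (p ^ℕ e) u ⟩
          p ^ℕ e *ℕ (u *ℕ p ^ℕ i)                Q.∎)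
        where
        module Q = ≡.≡-Reasoning
        open +-*-Solver using () renaming (solve to solve′; _:*_ to _⊗_; _:=_ to _⊜_)
        g = gsum (d ^ℕ h′) (p ^ℕ (toℕ c′ ∸ toℕ c))

      term : ∀ l → p ^ℕ i *ℕ q p d l ≡ p ^ℕ e *ℕ r″ → ∀ {x} → At x l →
             ι u * (T h′ * (ι (p ^ℕ i) * x)) + (τ - 1#) * (ι pᵇ * (ι r″ * (Z l * x)))
             ≈ ι pᵇ * (ι r″ * (T (h l) * x))
      term ⊥₋ hr {x} hx = linear₁ (ι u * T h′ * ι (p ^ℕ i) - ι pᵇ * ι r″ * T 1) hx
        (solve 8 (λ u t i x τ b r t₁ →
           u :* (t :* (i :* x)) :+ (τ :- :1) :* (b :* (r :* (con ℤ.0ℤ :* x))) :+ (u :* t :* i :- b :* r :* t₁) :* con ℤ.0ℤ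
           := b :* (r :* (t₁ :* x)) :+ (u :* t :* i :- b :* r :* t₁) :* x)
         refl (ι u) (T h′) (ι (p ^ℕ i)) x τ (ι pᵇ) (ι r″) (T 1))
      term [ c′ ] hr {x} hx with toℕ c′ ℕ.≤? toℕ c
      ... | yes c′≤c = linear₂ (ι u * ι (p ^ℕ i)) T-lower (T (p ^ℕ toℕ c′) * x) numbers
          (solve 9 (λ u t i x τ b r t₁ g →
           u :* (t :* (i :* x)) :+ (τ :- :1) :* (b :* (r :* (con ℤ.0ℤ :* x))) :+ u :* i :* (g :* (t₁ :* x)) :+ t₁ :* x :* (b :* r)
           := b :* (r :* (t₁ :* x)) :+ u :* i :* (t :* x) :+ t₁ :* x :* (u :* i :* g))
         refl (ι u) (T h′) (ι (p ^ℕ i)) x τ (ι pᵇ) (ι r″) (T (p ^ℕ toℕ c′)) (ι g))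
        where
        g = gsum (d ^ℕ (p ^ℕ toℕ c′)) (p ^ℕ (toℕ c ∸ toℕ c′))
        T-lower : T h′ * x ≈ ι g * (T (p ^ℕ toℕ c′) * x)
        T-lower = trans (*-congʳ (reflexive (≡.cong T (p^-split p c′≤c)))) (T-* (p ^ℕ toℕ c′) (p ^ℕ (toℕ c ∸ toℕ c′)) hx)
        numbers : ι u * ι (p ^ℕ i) * ι g ≈ ι pᵇ * ι r″
        numbers = trans (sym (trans (ι-* (u *ℕ p ^ℕ i) g) (*-congʳ (ι-* u (p ^ℕ i)))))
          (trans (ι-cong (lower c′ c′≤c hr)) (ι-* pᵇ r″))
      ... | no c′≰c = linear₂ (- (ι pᵇ * ι r″ * x)) T-upper (- (T h′ * x)) numbers
          (solve 10 (λ u t i x τ b r t₁ g sl →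
           u :* (t :* (i :* x)) :+ (τ :- :1) :* (b :* (r :* (sl :* t :* x))) :+ (:- (b :* r :* x)) :* (t :* (g :+ (τ :- :1) :* sl)) :+ (:- (t :* x)) :* (u :* i)
           := b :* (r :* (t₁ :* x)) :+ (:- (b :* r :* x)) :* t₁ :+ (:- (t :* x)) :* (b :* r :* g))
         refl (ι u) (T h′) (ι (p ^ℕ i)) x τ (ι pᵇ) (ι r″) (T (p ^ℕ toℕ c′)) (ι g) (slope (ι d ^ h′) τ (p ^ℕ (toℕ c′ ∸ toℕ c))))
        where
        c≤c′ : toℕ c ≤ toℕ c′
        c≤c′ = ℕ.<⇒≤ (ℕ.≰⇒> c′≰c)
        l′ = p ^ℕ (toℕ c′ ∸ toℕ c)
        g = gsum (d ^ℕ h′) l′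
        T-upper : T (p ^ℕ toℕ c′) ≈ T h′ * (ι g + (τ - 1#) * slope (ι d ^ h′) τ l′)
        T-upper = begin
          T (p ^ℕ toℕ c′)                       ≡⟨ ≡.cong T (p^-split p c≤c′) ⟩
          T (l′ *ℕ h′)                          ≈⟨ geom-* (ι d) σ l′ h′ ⟩
          T h′ * geom (ι d ^ h′) τ l′           ≈⟨ *-congˡ (geom-slope (ι d ^ h′) τ l′) ⟩
          T h′ * (geom (ι d ^ h′) 1# l′ + (τ - 1#) * slope (ι d ^ h′) τ l′)
            ≈⟨ *-congˡ (+-congʳ (trans (ι-gsum (d ^ℕ h′) l′) (geom-congˡ l′ (ι-^ d h′)))) ⟨
          T h′ * (ι g + (τ - 1#) * slope (ι d ^ h′) τ l′) ∎
        numbers : ι pᵇ * ι r″ * ι g ≈ ι u * ι (p ^ℕ i)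
        numbers = trans (sym (trans (ι-* (pᵇ *ℕ r″) g) (*-congʳ (ι-* pᵇ r″))))
          (trans (ι-cong (upper c′ c≤c′ hr)) (ι-* u (p ^ℕ i)))

  -- The correction terms z are chosen so that τ - 1 maps u y into multiples of the root. As p ^ e
  -- kills the root, p ^ (e - b) β is fixed by τ and may be placed in slot b.
  β : Carrier
  β = ι u * y + ι pᵇ * ∑ z

  β-equation : (τ - 1#) * β ≈ ι pᵇ * root
  β-equation = linear₄ (- (ι u * y)) (geom-difference (ι d) σ h′) (- (ι u * T h′)) (S-diff) 1# sum-term (ι u * y) (ι-d^ h′)
    (linear₁ y E-number (solve 14 (λ τ u y b z v σ d t S r p e W →
        (τ :- :1) :* (u :* y :+ b :* z) :+ (:- (u :* y)) :* (τ :- v) :+ (:- (u :* t)) :* ((σ :- d) :* y)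
          :+ :1 :* (b :* W) :+ u :* y :* (:1 :+ p :* e) :+ y :* (b :* r)
        := b :* (r :* y :+ W) :+ (:- (u :* y)) :* ((σ :- d) :* t) :+ (:- (u :* t)) :* S
          :+ :1 :* (u :* (t :* S) :+ (τ :- :1) :* (b :* z)) :+ u :* y :* v :+ y :* (u :* (p :* e)))
      refl τ (ι u) y (ι pᵇ) (∑ z) (ι d ^ h′) σ (ι d) (T h′) (S x) (ι r) (ι p) (ι (E h′))
        (∑ (t))))
    where
    sum-term : ι u * (T h′ * S x) + (τ - 1#) * (ι pᵇ * ∑ z) ≈ ι pᵇ * ∑ (t)
    sum-term = begin
      ι u * (T h′ * S x) + (τ - 1#) * (ι pᵇ * ∑ z)
        ≈⟨ +-cong (pull₂ (ι u) (T h′) (λ i → ι (p ^ℕ toℕ i) * x i)) (pull₂ (τ - 1#) (ι pᵇ) z) ⟩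
      ∑ (λ i → ι u * (T h′ * (ι (p ^ℕ toℕ i) * x i))) + ∑ (λ i → (τ - 1#) * (ι pᵇ * z i))
        ≈⟨ ∑-+ _ _ ⟨
      ∑ (λ i → ι u * (T h′ * (ι (p ^ℕ toℕ i) * x i)) + (τ - 1#) * (ι pᵇ * z i))
        ≈⟨ ∑-cong (λ i → term (toℕ i) (r′ i) (level a i) (levels i) (at i)) ⟩
      ∑ (λ i → ι pᵇ * t i)
        ≈⟨ ∑-* (ι pᵇ) _ ⟩
      ι pᵇ * ∑ (t) ∎
      where
      pull₂ : ∀ {k} α α′ (f : Fin k → Carrier) → α * (α′ * ∑ f) ≈ ∑ (λ i → α * (α′ * f i))
      pull₂ α α′ f = trans (*-congˡ (sym (∑-* α′ f))) (sym (∑-* α _))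
    E-number : ι u * (ι p * ι (E h′)) ≈ ι pᵇ * ι r
    E-number = trans (sym (trans (ι-* u (p *ℕ E h′)) (*-congˡ (ι-* p (E h′)))))
      (trans (ι-cong (E-quotient c≤n (toℕ b) u u-number)) (ι-* pᵇ r))

  private
    -- Otherwise p ^ (e + 1) would divide p ^ b q b = p ^ e u, against p not dividing u.
    b≤e : toℕ b ≤ e
    b≤e with toℕ b ℕ.≤? e
    ... | yes b≤e = b≤e
    ... | no  b≰e = contradiction (divides (p ^ℕ (toℕ b ∸ suc e) *ℕ g) (≡.sym (ℕ.*-cancelˡ-≡ _ _ (p ^ℕ e) ⦃ ℕ.m^n≢0 p e ⦄ (Q.begin
        p ^ℕ e *ℕ (k *ℕ g *ℕ p)          Q.≡⟨ solve′ 4 (λ e k g p → e ⊗ (k ⊗ g ⊗ p) ⊜ k ⊗ (p ⊗ e) ⊗ g) ≡.refl (p ^ℕ e) k g p ⟩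
        k *ℕ p ^ℕ suc e *ℕ g             Q.≡⟨ ≡.cong (_*ℕ g) (p^-split p (ℕ.≰⇒> b≰e)) ⟨
        pᵇ *ℕ g                          Q.≡⟨ u-number ⟩
        p ^ℕ e *ℕ u                      Q.∎)))) p∤u
      where
      module Q = ≡.≡-Reasoning
      open +-*-Solver using () renaming (solve to solve′; _:*_ to _⊗_; _:=_ to _⊜_)
      g = gsum (d ^ℕ h′) (p ^ℕ (n ∸ toℕ c))
      k = p ^ℕ (toℕ b ∸ suc e)

    p^e-b : ℕ
    p^e-b = p ^ℕ (e ∸ toℕ b)

    p^e≡ : ι (p ^ℕ e) ≈ ι p^e-b * ι pᵇ
    p^e≡ = trans (ι-cong (p^-split p b≤e)) (ι-* p^e-b pᵇ)

    κ : Carrier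
    κ = ι p^e-b * β

    -- The component κ in slot b contributes p ^ b κ = p ^ e β. The remaining terms subtract p ^ b p
    -- ^ e ∑ z, because p ^ i q i = p ^ e r′ i, so that p ^ e u y is left.
    v : Fin (suc m) → Carrier
    v i = single b κ i + (- ι pᵇ) * (ι (q p d (level a i)) * (Z (level a i) * x i))

    w : Fin (suc m) → Carrier
    w i = ι (q p d (level a i)) * (Z (level a i) * x i)

    S-w : S w ≈ ι (p ^ℕ e) * ∑ z
    S-w = trans (∑-cong (λ i → linear₃ (Z (level a i) * x i) (trans (sym (ι-* (p ^ℕ toℕ i) _)) (ι-cong (levels i)))
          (Z (level a i) * x i) (ι-* (p ^ℕ e) (r′ i)) 0# refl
          (solve 7 (λ k q zx e r o f → k :* (q :* zx) :+ zx :* f :+ zx :* (e :* r) :+ con ℤ.0ℤ :* con ℤ.0ℤ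
            := e :* (r :* zx) :+ zx :* (k :* q) :+ zx :* f :+ con ℤ.0ℤ :* con ℤ.0ℤ)
          refl (ι (p ^ℕ toℕ i)) (ι (q p d (level a i))) (Z (level a i) * x i) (ι (p ^ℕ e)) (ι (r′ i)) 0# (ι (p ^ℕ e *ℕ r′ i)))))
        (∑-* (ι (p ^ℕ e)) z)

    at-z : ∀ i → At (Z (level a i) * x i) (level a i)
    at-z i = At-* (level a i) (Z (level a i)) (at i)

    L-w : L w ≈ ι (p ^ℕ e′) * (N P * ∑ z)
    L-w = begin
      N (p ^ℕ (n ∸ 1)) * w zero + ∑ (λ i → ι (p ^ℕ toℕ i) * (N P * w (suc i)))
        ≈⟨ +-cong zeroth (∑-cong (λ i → successor i)) ⟩
      ι (p ^ℕ e′) * (N P * z zero) + ∑ (λ i → ι (p ^ℕ e′) * (N P * z (suc i)))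
        ≈⟨ ∑-suc (λ i → ι (p ^ℕ e′) * (N P * z i)) ⟨
      ∑ (λ i → ι (p ^ℕ e′) * (N P * z i))
        ≈⟨ trans (∑-* _ _) (*-congˡ (∑-* _ _)) ⟩
      ι (p ^ℕ e′) * (N P * ∑ z) ∎
      where
      zeroth : N (p ^ℕ (n ∸ 1)) * w zero ≈ ι (p ^ℕ e′) * (N P * z zero)
      zeroth = linear₄ (N (p ^ℕ (n ∸ 1)) * Zx) (trans (ι-cong (≡.trans (≡.sym (ℕ.*-identityˡ _)) (levels zero))) (ι-* (p ^ℕ e) (r′ zero)))
          (N (p ^ℕ (n ∸ 1)) * Zx * ι (r′ zero)) (ι-* p (p ^ℕ e′))
          (- (ι (p ^ℕ e′) * ι (r′ zero))) (N-bottom (level a zero) bottom (at-z zero)) 0# refl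
        (solve 9 (λ N₁ q zx e e′ p r N o →
           N₁ :* (q :* zx) :+ N₁ :* zx :* (e :* r) :+ N₁ :* zx :* r :* (p :* e′) :+ (:- (e′ :* r)) :* (p :* (N₁ :* zx)) :+ con ℤ.0ℤ :* con ℤ.0ℤ
           := e′ :* (N :* (r :* zx)) :+ N₁ :* zx :* q :+ N₁ :* zx :* r :* e :+ (:- (e′ :* r)) :* (N :* zx) :+ con ℤ.0ℤ :* con ℤ.0ℤ)
          refl (N (p ^ℕ (n ∸ 1))) (ι (q p d (level a zero))) Zx (ι (p ^ℕ e)) (ι (p ^ℕ e′)) (ι p) (ι (r′ zero)) (N P) 0#)
        where Zx = Z (level a zero) * x zero
      successor : ∀ i → ι (p ^ℕ toℕ i) * (N P * w (suc i)) ≈ ι (p ^ℕ e′) * (N P * z (suc i))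
      successor i = linear₁ (N P * Zx) numbers
        (solve 6 (λ k N q zx e r → k :* (N :* (q :* zx)) :+ N :* zx :* (e :* r) := e :* (N :* (r :* zx)) :+ N :* zx :* (k :* q))
          refl (ι (p ^ℕ toℕ i)) (N P) (ι (q p d (level a (suc i)))) Zx (ι (p ^ℕ e′)) (ι (r′ (suc i))))
        where
        Zx = Z (level a (suc i)) * x (suc i)
        numbers : ι (p ^ℕ toℕ i) * ι (q p d (level a (suc i))) ≈ ι (p ^ℕ e′) * ι (r′ (suc i))
        numbers = trans (sym (ι-* _ _)) (trans (ι-cong (ℕ.*-cancelˡ-≡ _ _ p
          (≡.trans (≡.sym (ℕ.*-assoc p _ _)) (≡.trans (levels (suc i)) (ℕ.*-assoc p _ _))))) (ι-* _ _))

  -- This concerns the norm condition in slot zero. With l = p ^ (n - c), the norm of β is N h′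
  -- applied to l β plus `slope 1# τ l` times (τ - 1) β. After multiplication by p ^ (e - 1) the
  -- slope term is h′ tri l times ξ, which has to vanish.
  module _ (even : toℕ b ≡ 0 → p ∣ h′ *ℕ tri (p ^ℕ (n ∸ toℕ c))) where

    private
      root′ : Carrier
      root′ = root

      at-κ : At κ [ c ]
      at-κ = linear₄ (ι p^e-b) β-equation (- root′) p^e≡ root′ (ι-* p (p ^ℕ e′)) (ι p) (root-order)
        (linear₁ 1# pξ
        (solve 9 (λ τ k β b w e e′ p ξ →
           τ :* (k :* β) :+ k :* (b :* w) :+ (:- w) :* (k :* b) :+ w :* (p :* e′) :+ p :* ξ :+ :1 :* con ℤ.0ℤ
           := k :* β :+ k :* ((τ :- :1) :* β) :+ (:- w) :* e :+ w :* e :+ p :* (e′ :* w) :+ :1 :* (p :* ξ))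
          refl τ (ι p^e-b) β (ι pᵇ) root′ (ι (p ^ℕ e)) (ι (p ^ℕ e′)) (ι p) ξ))

      pᵏξ : ∀ {k} → p ∣ k → ι k * ξ ≈ 0#
      pᵏξ (divides j ≡.refl) = linear₂ ξ (ι-* j p) (ι j) pξ
        (solve 4 (λ k j p ξ → k :* ξ :+ ξ :* (j :* p) :+ j :* con ℤ.0ℤ := con ℤ.0ℤ :+ ξ :* k :+ j :* (p :* ξ)) refl (ι (j *ℕ p)) (ι j) (ι p) ξ)

      -- Since τ fixes ξ, the recursion for the slope only adds up 0, 1, ..., k - 1.
      slope-ξ : ∀ k → slope 1# τ k * ξ ≈ ι (tri k) * ξ
      slope-ξ zero    = *-congʳ (sym ι-0)
      slope-ξ (suc k) = linear₄ τ (slope-ξ k) (ι (tri k)) (fixed-^ h′ σξ) 1# geom-ξ (- ξ) (ι-+ (tri k) k)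
        (solve 8 (λ τ s g ξ t k o u → (τ :* s :+ g) :* ξ :+ τ :* (t :* ξ) :+ t :* ξ :+ :1 :* (k :* ξ) :+ (:- ξ) :* (t :+ k)
           := u :* ξ :+ τ :* (s :* ξ) :+ t :* (τ :* ξ) :+ :1 :* (g :* ξ) :+ (:- ξ) :* u)
          refl τ (slope 1# τ k) (geom 1# 1# k) ξ (ι (tri k)) (ι k) 0# (ι (tri k +ℕ k)))
        where
        geom-ξ : geom 1# 1# k * ξ ≈ ι k * ξ
        geom-ξ = trans (*-congʳ (geom-congˡ k (sym ι-1)))
          (trans (geom-fixed 1 k (*-identityˡ ξ)) (reflexive (≡.cong (λ j → ι j * ξ) (gsum-1 k))))

      L-κ : L (single b κ) ≈ ι (p ^ℕ e′) * (N P * β)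
      L-κ = at-slot b ≡.refl
        where
        at-slot : ∀ j → j ≡ b → L (single j κ) ≈ ι (p ^ℕ e′) * (N P * β)
        at-slot (suc j) ≡.refl = trans (L-single-suc j κ) (linear₁ (N P * β) numbers
          (solve 5 (λ u N k β e → u :* (N :* (k :* β)) :+ N :* β :* e := e :* (N :* β) :+ N :* β :* (u :* k))
            refl (ι (p ^ℕ toℕ j)) (N P) (ι p^e-b) β (ι (p ^ℕ e′))))
          where
          numbers : ι (p ^ℕ toℕ j) * ι p^e-b ≈ ι (p ^ℕ e′)
          numbers = trans (sym (ι-* (p ^ℕ toℕ j) p^e-b)) (ι-cong (≡.sym (≡.trans
            (p^-split p (ℕ.s≤s⁻¹ b≤e)) (ℕ.*-comm p^e-b _))))
        at-slot zero ≡.refl = trans (L-single-zero κ)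
          (linear₄ 1# N-κ (- ι (p ^ℕ e′)) N-β (- (N h′ * sl * ι pᵇ)) (root-order) (- ι pᵇ) N-slope
          (linear₄ (- (ι (p ^ℕ e′) * N h′ * β)) l≡ (ι l′ * N h′ * β) (ι-* p (p ^ℕ e′)) (- (ι l′ * N h′ * β)) p^e≡
            (- (ι l′ * N h′ * β * ι p^e-b)) ι-1
          (solve 16 (λ N₁ k β l′ nₕ e′ l sl b w ξ p e NP o z →
            N₁ :* (k :* β) :+ :1 :* (l′ :* (nₕ :* (k :* β))) :+ (:- e′) :* (nₕ :* (l :* β :+ sl :* (b :* w)))
              :+ (:- (nₕ :* sl :* b)) :* ξ :+ (:- b) :* con ℤ.0ℤ
              :+ (:- (e′ :* nₕ :* β)) :* (p :* l′) :+ l′ :* nₕ :* β :* (p :* e′) :+ (:- (l′ :* nₕ :* β)) :* (k :* b)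
              :+ (:- (l′ :* nₕ :* β :* k)) :* :1
            := e′ :* (NP :* β) :+ :1 :* (N₁ :* (k :* β)) :+ (:- e′) :* (NP :* β)
              :+ (:- (nₕ :* sl :* b)) :* (e′ :* w) :+ (:- b) :* (nₕ :* (sl :* ξ))
              :+ (:- (e′ :* nₕ :* β)) :* l :+ l′ :* nₕ :* β :* e :+ (:- (l′ :* nₕ :* β)) :* e
              :+ (:- (l′ :* nₕ :* β :* k)) :* b)
            refl (N (p ^ℕ (n ∸ 1))) (ι p^e-b) β (ι l′) (N h′) (ι (p ^ℕ e′)) (ι l) sl (ι pᵇ) root′ ξ (ι p) (ι (p ^ℕ e)) (N P) 0# 0#)))
          where
          c<n : toℕ c < n
          c<n = bottom c level-b
          l l′ : ℕ
          l  = p ^ℕ (n ∸ toℕ c)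
          l′ = p ^ℕ (n ∸ 1 ∸ toℕ c)
          sl : Carrier
          sl = slope 1# τ l
          l≡ : ι l ≈ ι p * ι l′
          l≡ = trans (ι-cong (≡.cong (p ^ℕ_) (∸-suc c<n))) (ι-* p l′)
          N-κ : N (p ^ℕ (n ∸ 1)) * κ ≈ ι l′ * (N h′ * κ)
          N-κ = trans (*-congʳ (reflexive (≡.cong N (p^-split p (ℕ.∸-monoˡ-≤ 1 c<n))))) (N-* h′ l′ at-κ)
          N-slope : N h′ * (sl * ξ) ≈ 0#
          N-slope = begin
            N h′ * (sl * ξ)                  ≈⟨ *-congˡ (slope-ξ l) ⟩
            N h′ * (ι (tri l) * ξ)           ≈⟨ solve 3 (λ n t x → n :* (t :* x) := t :* (n :* x)) refl (N h′) (ι (tri l)) ξ ⟩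
            ι (tri l) * (N h′ * ξ)           ≈⟨ *-congˡ (trans (*-congʳ (geom-congˡ h′ (sym ι-1))) (geom-fixed 1 h′ σξ)) ⟩
            ι (tri l) * (ι (gsum 1 h′) * ξ)  ≡⟨ ≡.cong (λ j → ι (tri l) * (ι j * ξ)) (gsum-1 h′) ⟩
            ι (tri l) * (ι h′ * ξ)           ≈⟨ trans (sym (*-assoc _ _ _)) (*-congʳ (trans (*-comm _ _) (sym (ι-* h′ (tri l))))) ⟩
            ι (h′ *ℕ tri l) * ξ              ≈⟨ pᵏξ (even ≡.refl) ⟩
            0#                               ∎
          N-β : N P * β ≈ N h′ * (ι l * β + sl * (ι pᵇ * root′))
          N-β = begin
            N P * β                          ≡⟨ ≡.cong (λ k → N k * β) (p^-split p c≤n) ⟩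
            N (l *ℕ h′) * β                  ≈⟨ *-congʳ (geom-* 1# σ l h′) ⟩
            N h′ * geom (1# ^ h′) τ l * β    ≈⟨ *-assoc _ _ _ ⟩
            N h′ * (geom (1# ^ h′) τ l * β)
              ≈⟨ *-congˡ (*-congʳ (trans (geom-congˡ l (1^ h′)) (geom-slope 1# τ l))) ⟩
            N h′ * ((geom 1# 1# l + (τ - 1#) * sl) * β)
              ≈⟨ *-congˡ (linear₂ 1# geom-β sl β-equation
                   (solve 7 (λ g τ sl β l b w → (g :+ (τ :- :1) :* sl) :* β :+ :1 :* (l :* β) :+ sl :* (b :* w)
                     := l :* β :+ sl :* (b :* w) :+ :1 :* (g :* β) :+ sl :* ((τ :- :1) :* β))
                    refl (geom 1# 1# l) τ sl β (ι l) (ι pᵇ) root′)) ⟩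
            N h′ * (ι l * β + sl * (ι pᵇ * root′)) ∎
            where
            geom-β : geom 1# 1# l * β ≈ ι l * β
            geom-β = trans (*-congʳ (geom-congˡ l (sym ι-1)))
              (trans (geom-fixed 1 l (*-identityˡ β)) (reflexive (≡.cong (λ j → ι j * β) (gsum-1 l))))

    absorbed-by-level : Absorbed a e′ y v
    absorbed-by-level = record
      { v∈M     = λ i → IsIdeal.+-closed M-ideal
          (single-closed M (IsIdeal.0∈ M-ideal) b κ∈M i)
          (IsIdeal.*-closed M-ideal _ (IsIdeal.*-closed M-ideal _ (IsIdeal.*-closed M-ideal _ (x∈M i))))
      ; u       = u
      ; p∤u     = p∤u
      ; at      = λ i → At-+ (level a i) (At-single (level a) b (≡.subst (At κ) (≡.sym level-b) at-κ) i)
          (At-* (level a i) (- ι pᵇ) (At-* (level a i) _ (at-z i)))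
      ; twisted = sym (begin
          S v                                        ≈⟨ S-+ (single b κ) (λ i → - ι pᵇ * w i) ⟩
          S (single b κ) + S (λ i → - ι pᵇ * w i)    ≈⟨ +-cong (S-single b κ) (trans (S-* (- ι pᵇ) w) (*-congˡ S-w)) ⟩
          ι pᵇ * κ + - ι pᵇ * (ι (p ^ℕ e) * ∑ z)
            ≈⟨ linear₁ (- β) p^e≡ (solve 6 (λ b k u y e z → b :* (k :* (u :* y :+ b :* z)) :+ (:- b) :* (e :* z) :+ (:- (u :* y :+ b :* z)) :* (k :* b)
               := e :* (u :* y) :+ (:- (u :* y :+ b :* z)) :* e) refl (ι pᵇ) (ι p^e-b) (ι u) y (ι (p ^ℕ e)) (∑ z)) ⟩
          ι (p ^ℕ e) * (ι u * y)                     ∎)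
      ; normed  = sym (begin
          L v                                        ≈⟨ L-+ (single b κ) (λ i → - ι pᵇ * w i) ⟩
          L (single b κ) + L (λ i → - ι pᵇ * w i)    ≈⟨ +-cong L-κ (trans (L-* (- ι pᵇ) w) (*-congˡ L-w)) ⟩
          ι (p ^ℕ e′) * (N P * β) + - ι pᵇ * (ι (p ^ℕ e′) * (N P * ∑ z))
            ≈⟨ solve 6 (λ b e N u y z → e :* (N :* (u :* y :+ b :* z)) :+ (:- b) :* (e :* (N :* z)) := e :* (u :* (N :* y)))
                 refl (ι pᵇ) (ι (p ^ℕ e′)) (N P) (ι u) y (∑ z) ⟩
          ι (p ^ℕ e′) * (ι u * (N P * y))            ∎)
      }
      where
      κ∈M : M κ
      κ∈M = IsIdeal.*-closed M-ideal _ (IsIdeal.+-closed M-ideal (IsIdeal.*-closed M-ideal _ y∈M)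
        (IsIdeal.*-closed M-ideal _ (∑-closed M (IsIdeal.0∈ M-ideal) (IsIdeal.+-closed M-ideal)
          (λ i → IsIdeal.*-closed M-ideal _ (IsIdeal.*-closed M-ideal _ (x∈M i))))))

prime-∤⇒coprime : ∀ {p u} → Prime p → ¬ p ∣ u → ∀ k → Coprime u (p ^ℕ k)
prime-∤⇒coprime p-prime p∤u zero    (_ , i∣1) = ∣.∣1⇒≡1 i∣1
prime-∤⇒coprime {p} {u} p-prime p∤u (suc k) {i} (i∣u , i∣p^) = prime-∤⇒coprime p-prime p∤u k
  (i∣u , Coprime.coprime-divisor coprime-i i∣p^)
  where
  coprime-i : Coprime i p
  coprime-i {j} (j∣i , j∣p) with prime⇒irreducible p-prime j∣p
  ... | inj₁ j≡1 = j≡1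
  ... | inj₂ ≡.refl = contradiction (∣.∣-trans j∣i i∣u) p∤u

-- Changing the multiplier modulo p ^ e.

module Shifting {a₀ ℓ ρ} (C : CyclicModule a₀ ℓ ρ) where
  open CyclicModule C
  open Geometric R
  open Families R
  open Levels n
  open Pairs C
  open IsIdeal M-ideal
  open import Relation.Binary.Reasoning.Setoid setoid

  level-top : ∀ {m} (a : Vec Index m) → level a (fromℕ m) ≡ [ fromℕ n ]
  level-top []      = ≡.refl
  level-top (_ ∷ a) = level-top a

  At-top : ∀ {m} (a : Vec Index m) {x} → M x → At x (level a (fromℕ m))
  At-top {m} a {x} x∈M = ≡.subst (At x) (≡.sym (level-top a))
    (trans (*-congʳ (reflexive (≡.cong (λ k → σ ^ (p ^ℕ k)) (Fin.toℕ-fromℕ n)))) (σ-order x∈M))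

  S-top : ∀ {m} x → S (single (fromℕ m) x) ≈ ι (p ^ℕ m) * x
  S-top {m} x = trans (S-single (fromℕ m) x) (*-congʳ (ι-cong (≡.cong (p ^ℕ_) (Fin.toℕ-fromℕ m))))

  L-top : ∀ {m} x → L (single (fromℕ (suc m)) x) ≈ ι (p ^ℕ m) * (N P * x)
  L-top {m} x = trans (L-single-suc (fromℕ m) x) (*-congʳ (ι-cong (≡.cong (p ^ℕ_) (Fin.toℕ-fromℕ m))))

  ι-inverse : ∀ {u} → ¬ p ∣ u → ∀ k → ∃[ z ] ∃[ t ] z * ι u ≈ 1# + t * ι (p ^ℕ k)
  ι-inverse {u} p∤u k with coprime-Bézout (prime-∤⇒coprime p-prime p∤u k)
  ... | Bézout.+- x y eq = ι x , ι y , (begin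
    ι x * ι u                ≈⟨ ι-* x u ⟨
    ι (x *ℕ u)               ≡⟨ ≡.cong ι eq ⟨
    ι (1 +ℕ y *ℕ p ^ℕ k)     ≈⟨ ι-suc (y *ℕ p ^ℕ k) ⟩
    1# + ι (y *ℕ p ^ℕ k)     ≈⟨ +-congˡ (ι-* y (p ^ℕ k)) ⟩
    1# + ι y * ι (p ^ℕ k)    ∎)
  ... | Bézout.-+ x y eq = - ι x , - ι y , linear₁ (- 1#) (begin
    1# + ι x * ι u           ≈⟨ +-congˡ (ι-* x u) ⟨
    1# + ι (x *ℕ u)          ≈⟨ ι-suc (x *ℕ u) ⟨
    ι (1 +ℕ x *ℕ u)          ≡⟨ ≡.cong ι eq ⟩
    ι (y *ℕ p ^ℕ k)          ≈⟨ ι-* y (p ^ℕ k) ⟩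
    ι y * ι (p ^ℕ k)         ∎)
    (solve 4 (λ x u y q → (:- x) :* u :+ (:- :1) :* (y :* q) := :1 :+ (:- y) :* q :+ (:- :1) :* (:1 :+ x :* u))
      refl (ι x) (ι u) (ι y) (ι (p ^ℕ k)))

  -- The absorbed relation holds for u y rather than y, and u is invertible only modulo the power of
  -- p belonging to the last slot. The error is a multiple of that power and goes into the last
  -- component, which carries no constraint.
  shift : ∀ {m} {a : Vec Index (suc m)} {S₀ S₁ y e′ x v} ε → IsPair a S₀ y x → Absorbed a e′ y v →
          S₁ ≈ S₀ + ε * ι (p ^ℕ e′) → ∃[ x′ ] IsPair a S₁ y x′
  shift {m} {a} {S₀} {S₁} {y} {e′} {x} {v} ε pair absorbed S₁≈ = x′ , record
    { y∈M     = y∈M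
    ; x∈M     = λ i → +-closed (x∈M i) (+-closed (*-closed _ (v∈M i))
        (*-closed ε (single-closed M 0∈ (fromℕ (suc m)) (*-closed _ y∈M) i)))
    ; at      = λ i → At-+ (level a i) (at i) (At-+ (level a i) (At-* (level a i) _ (A.at i))
        (At-* (level a i) ε (At-single (level a) (fromℕ (suc m)) (At-top a (*-closed _ y∈M)) i)))
    ; twisted = linear₄ 1# twisted (- (ι p * y)) S₁≈ (- 1#) S-x′ (- (ε * z)) A.twisted
        (linear₂ (ε * ι (p ^ℕ suc e′) * y) inverse (ε * y) (ι-* p (p ^ℕ e′))
        (solve 15 (λ σ y p S₀ S₁ X X′ ε z e e′ u t q V →
          σ :* y :+ :1 :* ((:1 :+ p :* S₀) :* y :+ X) :+ (:- (p :* y)) :* (S₀ :+ ε :* e′)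
            :+ (:- :1) :* (X :+ ((:- (ε :* z)) :* V :+ ε :* (q :* (t :* e :* y)))) :+ (:- (ε :* z)) :* V
            :+ ε :* e :* y :* (:1 :+ t :* q) :+ ε :* y :* (p :* e′)
          := (:1 :+ p :* S₁) :* y :+ X′ :+ :1 :* (σ :* y) :+ (:- (p :* y)) :* S₁ :+ (:- :1) :* X′
            :+ (:- (ε :* z)) :* (e :* (u :* y)) :+ ε :* e :* y :* (z :* u) :+ ε :* y :* e)
         refl σ y (ι p) S₀ S₁ (S x) (S x′) ε z (ι (p ^ℕ suc e′)) (ι (p ^ℕ e′)) (ι A.u) t (ι (p ^ℕ suc m)) (S v)))
    ; normed  = linear₄ 1# normed (- (N P * y)) S₁≈ (- 1#) L-x′ (- (ε * z)) A.normed
        (linear₃ (ε * ι (p ^ℕ e′) * (N P * y)) inverse (ε * ι (p ^ℕ e′) * (N P * y) * t) (ι-* p (p ^ℕ m))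
          (- (ε * ι (p ^ℕ m) * t * (N P * y))) (ι-* p (p ^ℕ e′))
        (solve 17 (λ N y p S₀ S₁ X X′ ε z e e′ u t q V q′ ξ →
          ξ :+ :1 :* (S₀ :* (N :* y) :+ X) :+ (:- (N :* y)) :* (S₀ :+ ε :* e′)
            :+ (:- :1) :* (X :+ ((:- (ε :* z)) :* V :+ ε :* (q′ :* (N :* (t :* e :* y))))) :+ (:- (ε :* z)) :* V
            :+ ε :* e′ :* (N :* y) :* (:1 :+ t :* q) :+ ε :* e′ :* (N :* y) :* t :* (p :* q′)
            :+ (:- (ε :* q′ :* t :* (N :* y))) :* (p :* e′)
          := S₁ :* (N :* y) :+ X′ :+ :1 :* ξ :+ (:- (N :* y)) :* S₁ :+ (:- :1) :* X′
            :+ (:- (ε :* z)) :* (e′ :* (u :* (N :* y))) :+ ε :* e′ :* (N :* y) :* (z :* u)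
            :+ ε :* e′ :* (N :* y) :* t :* q :+ (:- (ε :* q′ :* t :* (N :* y))) :* e)
         refl (N P) y (ι p) S₀ S₁ (L x) (L x′) ε z (ι (p ^ℕ suc e′)) (ι (p ^ℕ e′)) (ι A.u) t (ι (p ^ℕ suc m)) (L v) (ι (p ^ℕ m)) ξ))
    }
    where
    open IsPair pair
    module A = Absorbed absorbed
    open Absorbed absorbed using (v∈M)
    z t : Carrier
    z = proj₁ (ι-inverse A.p∤u (suc m))
    t = proj₁ (proj₂ (ι-inverse A.p∤u (suc m)))
    inverse : z * ι A.u ≈ 1# + t * ι (p ^ℕ suc m)
    inverse = proj₂ (proj₂ (ι-inverse A.p∤u (suc m)))
    top : Fin (suc (suc m)) → Carrier
    top = single (fromℕ (suc m)) (t * ι (p ^ℕ suc e′) * y)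
    x′ : Fin (suc (suc m)) → Carrier
    x′ i = x i + (- (ε * z) * v i + ε * top i)
    S-x′ : S x′ ≈ S x + (- (ε * z) * S v + ε * (ι (p ^ℕ suc m) * (t * ι (p ^ℕ suc e′) * y)))
    S-x′ = trans (S-+ x (λ i → - (ε * z) * v i + ε * top i)) (+-congˡ (trans (S-+ (λ i → - (ε * z) * v i) (λ i → ε * top i))
      (+-cong (S-* _ v) (trans (S-* ε top) (*-congˡ (S-top {suc m} _))))))
    L-x′ : L x′ ≈ L x + (- (ε * z) * L v + ε * (ι (p ^ℕ m) * (N P * (t * ι (p ^ℕ suc e′) * y))))
    L-x′ = trans (L-+ x (λ i → - (ε * z) * v i + ε * top i)) (+-congˡ (trans (L-+ (λ i → - (ε * z) * v i) (λ i → ε * top i))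
      (+-cong (L-* _ v) (trans (L-* ε top) (*-congˡ (L-top {m} _))))))

  -- The last component is arbitrary, so y itself can stand there. Hence the multiplier matters only
  -- modulo p ^ (m + 1), where m + 1 is the length.
  absorbed-top : ∀ {m} (a : Vec Index (suc m)) {y} → M y → Absorbed a m y (single (fromℕ (suc m)) y)
  absorbed-top {m} a {y} y∈M = record
    { v∈M     = single-closed M 0∈ (fromℕ (suc m)) y∈M
    ; u       = 1
    ; p∤u     = λ p∣1 → contradiction (∣.∣1⇒≡1 p∣1) (ℕ.nonTrivial⇒≢1 ⦃ prime⇒nonTrivial p-prime ⦄)
    ; at      = At-single (level a) (fromℕ (suc m)) (At-top a y∈M)
    ; twisted = trans (*-congˡ (trans (*-congʳ ι-1) (*-identityˡ y))) (sym (S-top {suc m} y))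
    ; normed  = trans (*-congˡ (trans (*-congʳ ι-1) (*-identityˡ _))) (sym (L-top {m} y))
    }

-- The exponent e and its stability under changes of the multiplier.

module Exponents {p : ℕ} (p-prime : Prime p) (n : ℕ) where
  open Levels n
  open import Data.Nat.Base using (_+_; _*_; _^_)
  private instance
    p≢0 : NonZero p
    p≢0 = prime⇒nonZero p-prime

  q-top : ∀ {m} (a : Vec Index m) d → q p d (level a (fromℕ m)) ≡ 1
  q-top []      d = ≡.cong (λ k → gsum (d ^ (p ^ toℕ (fromℕ n))) (p ^ k))
    (≡.trans (≡.cong (n ∸_) (Fin.toℕ-fromℕ n)) (ℕ.n∸n≡0 n))
  q-top (_ ∷ a) d = q-top a d

  module _ {m} (a : Vec Index m) (s : ℕ) where
    open Multiplier p s

    Divides : ℕ → Set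
    Divides e = p ^ e ∣ p * E (p ^ n) × (∀ i → p ^ e ∣ p ^ toℕ i * q p d (level a i))

    Divides? : ∀ e → Dec (Divides e)
    Divides? e = (p ^ e ∣? p * E (p ^ n)) ×-dec Fin.all? (λ i → p ^ e ∣? p ^ toℕ i * q p d (level a i))

    p∣q : ∀ l → (∀ c → l ≡ [ c ] → toℕ c < n) → p ∣ q p d l
    p∣q ⊥₋    l<n = p ∣.∣0
    p∣q [ c ] l<n = ≡.subst (p ∣_) (≡.sym (gsum-quotient (p ^ toℕ c) (p ^ (n ∸ toℕ c))))
      (∣.∣m∣n⇒∣m+n (≡.subst (λ k → p ∣ p ^ k) (≡.sym (∸-suc (l<n c ≡.refl))) (∣.m∣m*n _)) (∣.m∣m*n _))

    -- Slot zero is the only one without an explicit factor p. There q is congruent to p ^ (n - c)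
    -- modulo p, and c < n.
    divides-1 : (∀ c → level a zero ≡ [ c ] → toℕ c < n) → Divides 1
    divides-1 bottom = ≡.subst (_∣ p * E (p ^ n)) (≡.sym (ℕ.*-identityʳ p)) (∣.m∣m*n _) ,
      λ i → ≡.subst (_∣ p ^ toℕ i * q p d (level a i)) (≡.sym (ℕ.*-identityʳ p)) (slot i)
      where
      slot : ∀ i → p ∣ p ^ toℕ i * q p d (level a i)
      slot zero    = ∣.∣n⇒∣m*n 1 (p∣q (level a zero) bottom)
      slot (suc i) = ∣.∣m⇒∣m*n (q p d (level a (suc i))) (∣.m∣m*n (p ^ toℕ i))

    -- The last slot has level n, where q is an empty-range norm equal to 1, so p ^ m is among the
    -- numbers to be divided.
    divides-bound : ∀ {e} → Divides e → e ≤ m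
    divides-bound {e} (_ , levels) with e ℕ.≤? m
    ... | yes e≤m = e≤m
    ... | no  e≰m = contradiction (∣.∣⇒≤ ⦃ ℕ.m^n≢0 p m ⦄ top) (ℕ.<⇒≱ (ℕ.^-monoʳ-< p (ℕ.nonTrivial⇒n>1 p ⦃ prime⇒nonTrivial p-prime ⦄) (ℕ.≰⇒> e≰m)))
      where
      top : p ^ e ∣ p ^ m
      top = ≡.subst (p ^ e ∣_) (≡.trans (≡.cong₂ (λ k l → p ^ k * l) (Fin.toℕ-fromℕ m) (q-top a d)) (ℕ.*-identityʳ _)) (levels (fromℕ m))

    record Exponent : Set where
      field
        e′      : ℕ
        divides-e : Divides (suc e′)
        maximal : ¬ Divides (suc (suc e′))

    exponent : (∀ c → level a zero ≡ [ c ] → toℕ c < n) → Exponent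
    -- The fuel m suffices: the invariant m ≤ e′ + k leaves at k = 0 no room for a further divisor,
    -- by `divides-bound`.
    exponent bottom = search m 0 ℕ.≤-refl (divides-1 bottom)
      where
      search : ∀ k e′ → m ≤ e′ + k → Divides (suc e′) → Exponent
      search k e′ bound holds with Divides? (suc (suc e′))
      ... | no  fails = record { e′ = e′ ; divides-e = holds ; maximal = fails }
      search zero    e′ bound holds | yes holds′ =
        contradiction (ℕ.≤-trans (divides-bound holds′) (≡.subst (m ≤_) (ℕ.+-identityʳ e′) bound)) (ℕ.<⇒≱ (ℕ.m≤n⇒m≤1+n ℕ.≤-refl))
      search (suc k) e′ bound holds | yes holds′ = search k (suc e′) (≡.subst (m ≤_) (ℕ.+-suc e′ k) bound) holds′

module _ where
  open import Data.Nat.Base using (_+_; _*_; _^_)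
  open +-*-Solver
  open ≡.≡-Reasoning

  -- A first-order Taylor expansion: the derivative k x ^ (k - 1) is k modulo p because x is 1
  -- modulo p, and the higher terms contain y a second time and hence another p.
  ^-shift : ∀ p X Y k → let x = 1 + p * X ; y = p * Y in ∃[ v ] (x + y) ^ k ≡ x ^ k + y * (k + p * v)
  ^-shift p X Y zero    = 0 , (begin
    1                                ≡⟨ solve 2 (λ p y → con 1 := con 1 :+ y :* (con 0 :+ p :* con 0)) ≡.refl p (p * Y) ⟩
    1 + p * Y * (0 + p * 0)          ∎)
  ^-shift p X Y (suc k) = let x = 1 + p * X ; y = p * Y ; v , eq = ^-shift p X Y k ; B = X * gsum x k in
    B + (X + Y) * k + (1 + p * (X + Y)) * v , (begin
    (x + y) * (x + y) ^ k
      ≡⟨ ≡.cong ((x + y) *_) eq ⟩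
    (x + y) * (x ^ k + y * (k + p * v))
      ≡⟨ solve 6 (λ x y u k p v → (x :+ y) :* (u :+ y :* (k :+ p :* v)) := x :* u :+ y :* (u :+ (x :+ y) :* (k :+ p :* v)))
           ≡.refl x y (x ^ k) k p v ⟩
    x * x ^ k + y * (x ^ k + (x + y) * (k + p * v))
      ≡⟨ ≡.cong (λ u → x * x ^ k + y * (u + (x + y) * (k + p * v))) (^-gsum (p * X) k) ⟩
    x * x ^ k + y * (1 + p * X * gsum x k + (x + y) * (k + p * v))
      ≡⟨ solve 7 (λ w p X Y g k v → w :+ p :* Y :* (con 1 :+ p :* X :* g :+ (con 1 :+ p :* X :+ p :* Y) :* (k :+ p :* v))
           := w :+ p :* Y :* (con 1 :+ k :+ p :* (X :* g :+ (X :+ Y) :* k :+ (con 1 :+ p :* (X :+ Y)) :* v)))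
           ≡.refl (x * x ^ k) p X Y (gsum x k) k v ⟩
    x * x ^ k + y * (suc k + p * (B + (X + Y) * k + (1 + p * (X + Y)) * v)) ∎)

  -- Summing the expansions of the powers, the linear coefficient modulo p is 0 + 1 + ... + (k - 1).
  gsum-shift : ∀ p X Y k → let x = 1 + p * X ; y = p * Y in ∃[ v ] gsum (x + y) k ≡ gsum x k + y * (tri k + p * v)
  gsum-shift p X Y zero    = 0 , solve 2 (λ p y → con 0 := con 0 :+ y :* (con 0 :+ p :* con 0)) ≡.refl p (p * Y)
  gsum-shift p X Y (suc k) = let x = 1 + p * X ; y = p * Y ; v , eq = gsum-shift p X Y k ; v′ , eq′ = ^-shift p X Y k in
    v + v′ , (begin
    gsum (x + y) k + (x + y) ^ k
      ≡⟨ ≡.cong₂ _+_ eq eq′ ⟩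
    gsum x k + y * (tri k + p * v) + (x ^ k + y * (k + p * v′))
      ≡⟨ solve 8 (λ g y t p v u k w → g :+ y :* (t :+ p :* v) :+ (u :+ y :* (k :+ p :* w)) := g :+ u :+ y :* (t :+ k :+ p :* (v :+ w)))
           ≡.refl (gsum x k) y (tri k) p v (x ^ k) k v′ ⟩
    gsum x k + x ^ k + y * (tri k + k + p * (v + v′)) ∎)

  2tri : ∀ k → 2 * tri k + k ≡ k * k
  2tri zero    = ≡.refl
  2tri (suc k) = begin
    2 * (tri k + k) + suc k            ≡⟨ solve 2 (λ t k → con 2 :* (t :+ k) :+ (con 1 :+ k) := (con 2 :* t :+ k) :+ (con 1 :+ k :+ k)) ≡.refl (tri k) k ⟩
    2 * tri k + k + (1 + k + k)        ≡⟨ ≡.cong (_+ (1 + k + k)) (2tri k) ⟩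
    k * k + (1 + k + k)                ≡⟨ solve 1 (λ k → k :* k :+ (con 1 :+ k :+ k) := (con 1 :+ k) :* (con 1 :+ k)) ≡.refl k ⟩
    suc k * suc k                      ∎

  -- For c > 0 the first factor suffices. For c = 0 the identity 2 tri l + l = l l settles odd p,
  -- and for p = 2 one factor 2 is lost, which is fatal only for l = 2, where tri l = 1.
  p∣p^c*tri : ∀ {p} → Prime p → ∀ {c n} → c < n → ¬ (p ≡ 2 × n ≡ 1) → p ∣ p ^ c * tri (p ^ (n ∸ c))
  p∣p^c*tri {p} p-prime {suc c} c<n _ = ∣.∣m⇒∣m*n _ (∣.m∣m*n _)
  p∣p^c*tri {p} p-prime {zero} {suc n} _ exceptional = ∣.∣n⇒∣m*n 1 p∣tri
    where
    l k : ℕ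
    k = p ^ n
    l = p * k
    p∣2tri : p ∣ 2 * tri l
    p∣2tri = ∣.∣m+n∣m⇒∣n (≡.subst (p ∣_) (≡.trans (≡.sym (2tri l)) (ℕ.+-comm (2 * tri l) l)) (∣.∣m⇒∣m*n l (∣.m∣m*n k))) (∣.m∣m*n k)
    p∣tri : p ∣ tri l
    p∣tri with euclidsLemma 2 (tri l) p-prime p∣2tri
    ... | inj₂ p∣t = p∣t
    ... | inj₁ p∣2 with p ℕ.≟ 2
    ...   | no p≢2 = contradiction (ℕ.≤-antisym (∣.∣⇒≤ p∣2) (ℕ.nonTrivial⇒n>1 p ⦃ prime⇒nonTrivial p-prime ⦄)) p≢2
    ...   | yes ≡.refl = halved n (λ n≡0 → exceptional (≡.refl , ≡.cong suc n≡0))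
      where
      halved : ∀ n → ¬ n ≡ 0 → 2 ∣ tri (2 * 2 ^ n)
      halved zero    n≢0 = contradiction ≡.refl n≢0
      halved (suc n) _   = ∣.∣m+n∣m⇒∣n (≡.subst (2 ∣_) (≡.trans (≡.sym half) (ℕ.+-comm (tri (2 * k₂)) k₂)) (∣.∣m⇒∣m*n k₂ (∣.m∣m*n k₂))) (∣.m∣m*n (2 ^ n))
        where
        k₂ = 2 ^ suc n
        half : tri (2 * k₂) + k₂ ≡ 2 * k₂ * k₂
        half = ℕ.*-cancelˡ-≡ _ _ 2 (begin
          2 * (tri (2 * k₂) + k₂)        ≡⟨ ℕ.*-distribˡ-+ 2 (tri (2 * k₂)) k₂ ⟩
          2 * tri (2 * k₂) + 2 * k₂      ≡⟨ 2tri (2 * k₂) ⟩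
          2 * k₂ * (2 * k₂)              ≡⟨ solve 1 (λ k → con 2 :* k :* (con 2 :* k) := con 2 :* (con 2 :* k :* k)) ≡.refl k₂ ⟩
          2 * (2 * k₂ * k₂)              ∎)

module Stability {p : ℕ} (p-prime : Prime p) {n : ℕ} (1≤n : 1 ≤ n) where
  open import Data.Nat.Base using (_+_; _*_; _^_)
  open +-*-Solver
  open ≡.≡-Reasoning
  open Levels n
  open Exponents p-prime n

  module _ {m} (a : Vec Index m) (s e′ j : ℕ)
           (good : ∀ c → level a zero ≡ [ c ] → p ∣ p ^ toℕ c * tri (p ^ (n ∸ toℕ c))) where
    private
      s̃ : ℕ
      s̃ = s + p ^ e′ * j

      module O = Multiplier p s
      module Ñ = Multiplier p s̃

      d̃-sum : Ñ.d ≡ 1 + p * s + p * (p ^ e′ * j)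
      d̃-sum = ≡.cong suc (ℕ.*-distribˡ-+ p s _)

      power : ∀ k → ∃[ v ] Ñ.d ^ k ≡ O.d ^ k + p * (p ^ e′ * j) * (k + p * v)
      power k with ^-shift p s (p ^ e′ * j) k
      ... | v , eq = v , ≡.trans (≡.cong (_^ k) d̃-sum) eq

      power-p : ∀ {k} → p ∣ k → ∃[ v ] Ñ.d ^ k ≡ O.d ^ k + p ^ suc (suc e′) * v
      power-p {k} (divides i ≡.refl) with power (i * p)
      ... | v , eq = j * (i + v) , ≡.trans eq (≡.cong (λ z → O.d ^ (i * p) + z)
        (solve 5 (λ p q j i v → p :* (q :* j) :* (i :* p :+ p :* v) := p :* (p :* q) :* (j :* (i :+ v))) ≡.refl p (p ^ e′) j i v))

      total : ∃[ v ] p * Ñ.E (p ^ n) ≡ p * O.E (p ^ n) + p ^ suc (suc e′) * v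
      total with power-p (≡.subst (λ k → p ∣ p ^ k) (ℕ.suc-pred n ⦃ ℕ.>-nonZero 1≤n ⦄) (∣.m∣m*n (p ^ ℕ.pred n)))
      ... | v , eq = v , ℕ.suc-injective (≡.trans (≡.sym (Ñ.d^≡1+pE (p ^ n)))
        (≡.trans eq (≡.cong (_+ p ^ suc (suc e′) * v) (O.d^≡1+pE (p ^ n)))))

      Shifted : Fin (suc n) → Set
      Shifted c = ∃[ v ] q p Ñ.d [ c ] ≡ q p O.d [ c ] + p ^ suc e′ * (p ^ toℕ c * (j * tri (p ^ (n ∸ toℕ c))) + p * v)

      q-shift : ∀ c → Shifted c
      q-shift c with power (p ^ toℕ c)
      ... | v , eq with gsum-shift p (O.E (p ^ toℕ c)) (p ^ e′ * j * (p ^ toℕ c + p * v)) (p ^ (n ∸ toℕ c))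
      ...   | w , eq′ = j * (v * (T + p * w) + h * w) , (begin
        gsum (Ñ.d ^ h) l
          ≡⟨ ≡.cong (λ x → gsum x l) eq ⟩
        gsum (O.d ^ h + p * (p ^ e′ * j) * (h + p * v)) l
          ≡⟨ ≡.cong (λ x → gsum (x + p * (p ^ e′ * j) * (h + p * v)) l) (O.d^≡1+pE h) ⟩
        gsum (1 + p * X + p * (p ^ e′ * j) * (h + p * v)) l
          ≡⟨ ≡.cong (λ y → gsum (1 + p * X + y) l) (ℕ.*-assoc p (p ^ e′ * j) (h + p * v)) ⟩
        gsum (1 + p * X + p * (p ^ e′ * j * (h + p * v))) l
          ≡⟨ eq′ ⟩
        gsum (1 + p * X) l + p * (p ^ e′ * j * (h + p * v)) * (T + p * w)
          ≡⟨ ≡.cong₂ _+_ (≡.cong (λ x → gsum x l) (≡.sym (O.d^≡1+pE h)))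
               (solve 7 (λ p q j h v T w → p :* (q :* j :* (h :+ p :* v)) :* (T :+ p :* w)
                 := p :* q :* (h :* (j :* T) :+ p :* (j :* (v :* (T :+ p :* w) :+ h :* w)))) ≡.refl p (p ^ e′) j h v T w) ⟩
        gsum (O.d ^ h) l + p ^ suc e′ * (h * (j * T) + p * (j * (v * (T + p * w) + h * w))) ∎)
        where
        h = p ^ toℕ c
        l = p ^ (n ∸ toℕ c)
        T = tri l
        X = O.E h

      bottom-slot : ∀ c → Shifted c → p ∣ p ^ toℕ c * tri (p ^ (n ∸ toℕ c)) →
                    ∃[ v ] 1 * q p Ñ.d [ c ] ≡ 1 * q p O.d [ c ] + p ^ suc (suc e′) * v
      bottom-slot c (v , eq) (divides g eq′) = g * j + v , (begin
        1 * q p Ñ.d [ c ]                                               ≡⟨ ℕ.*-identityˡ _ ⟩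
        q p Ñ.d [ c ]                                                   ≡⟨ eq ⟩
        q p O.d [ c ] + p ^ suc e′ * (h * (j * T) + p * v)
          ≡⟨ solve 7 (λ q E h j T p v → q :+ E :* (h :* (j :* T) :+ p :* v) := con 1 :* q :+ E :* ((h :* T) :* j :+ p :* v))
               ≡.refl (q p O.d [ c ]) (p ^ suc e′) h j T p v ⟩
        1 * q p O.d [ c ] + p ^ suc e′ * (h * T * j + p * v)            ≡⟨ ≡.cong (λ z → 1 * q p O.d [ c ] + p ^ suc e′ * (z * j + p * v)) eq′ ⟩
        1 * q p O.d [ c ] + p ^ suc e′ * (g * p * j + p * v)
          ≡⟨ solve 6 (λ q E g p j v → q :+ E :* (g :* p :* j :+ p :* v) := q :+ p :* E :* (g :* j :+ v))
               ≡.refl (1 * q p O.d [ c ]) (p ^ suc e′) g p j v ⟩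
        1 * q p O.d [ c ] + p ^ suc (suc e′) * (g * j + v)              ∎)
        where
        h = p ^ toℕ c
        T = tri (p ^ (n ∸ toℕ c))

      upper-slot : ∀ i c → Shifted c → ∃[ v ] p ^ suc i * q p Ñ.d [ c ] ≡ p ^ suc i * q p O.d [ c ] + p ^ suc (suc e′) * v
      upper-slot i c (v , eq) = p ^ i * W , ≡.trans (≡.cong (p ^ suc i *_) eq)
        (solve 5 (λ p i q E W → p :* i :* (q :+ E :* W) := p :* i :* q :+ p :* E :* (i :* W)) ≡.refl p (p ^ i) (q p O.d [ c ]) (p ^ suc e′) W)
        where W = p ^ toℕ c * (j * tri (p ^ (n ∸ toℕ c))) + p * v

      slot : ∀ i → ∃[ v ] p ^ toℕ i * q p Ñ.d (level a i) ≡ p ^ toℕ i * q p O.d (level a i) + p ^ suc (suc e′) * v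
      slot i = at i (level a i) ≡.refl
        where
        at : ∀ i l → l ≡ level a i → ∃[ v ] p ^ toℕ i * q p Ñ.d l ≡ p ^ toℕ i * q p O.d l + p ^ suc (suc e′) * v
        at i       ⊥₋    l≡ = 0 , solve 2 (λ i e → i :* con 0 := i :* con 0 :+ e :* con 0) ≡.refl (p ^ toℕ i) (p ^ suc (suc e′))
        at zero    [ c ] l≡ = bottom-slot c (q-shift c) (good c (≡.sym l≡))
        at (suc i) [ c ] l≡ = upper-slot (toℕ i) c (q-shift c)

      transfer : ∀ {x y e v} → e ≤ suc (suc e′) → y ≡ x + p ^ suc (suc e′) * v → (p ^ e ∣ x → p ^ e ∣ y) × (p ^ e ∣ y → p ^ e ∣ x)
      transfer {x} {y} {e} {v} e≤ ≡.refl =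
        (λ h → ∣.∣m∣n⇒∣m+n h extra) , λ h → ∣.∣m+n∣m⇒∣n (≡.subst (p ^ e ∣_) (ℕ.+-comm x _) h) extra
        where
        extra : p ^ e ∣ p ^ suc (suc e′) * v
        extra = ∣.∣m⇒∣m*n v (divides (p ^ (suc (suc e′) ∸ e)) (p^-split p e≤))

    -- All the numbers in question change by multiples of p ^ (e + 1), so divisibility by p ^ e and
    -- by p ^ (e + 1) is unaffected. Beyond the p ^ e in the change of d, the extra p comes from the
    -- exponent P in d ^ P, from p ^ i in slots i > 0, and from `good` in slot zero.
    stable : (ex : Exponent a s) → Exponent.e′ ex ≡ e′ → Exponent a s̃
    stable ex ≡.refl = record
      { e′        = e′
      ; divides-e = proj₁ (transfer e≤ (proj₂ total)) (proj₁ (Exponent.divides-e ex)) ,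
          λ i → proj₁ (transfer e≤ (proj₂ (slot i))) (proj₂ (Exponent.divides-e ex) i)
      ; maximal   = λ { (h , hs) → Exponent.maximal ex (proj₂ (transfer ℕ.≤-refl (proj₂ total)) h ,
          λ i → proj₂ (transfer ℕ.≤-refl (proj₂ (slot i))) (hs i)) }
      }
      where
      e≤ : suc e′ ≤ suc (suc e′)
      e≤ = ℕ.n≤1+n (suc e′)

-- Replacing a component by one from a smaller field.

module Lowering {a₀ ℓ ρ} (C : CyclicModule a₀ ℓ ρ) where
  open CyclicModule C
  private instance
    p≢0 : NonZero p
    p≢0 = prime⇒nonZero p-prime

  open Geometric R
  open Families R
  open Levels n
  open Pairs C
  open IsIdeal M-ideal
  open Shifting C
  open import Relation.Binary.Reasoning.Setoid setoid

  private
    module W₀ = Twisted R σ p 0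

  N-fixed : ∀ {c} → c ≤ n → ∀ {x} → σ ^ (p ^ℕ c) * x ≈ x → N P * x ≈ ι (p ^ℕ (n ∸ c)) * (N (p ^ℕ c) * x)
  N-fixed {c} c≤n {x} hx = trans (*-congʳ (reflexive (≡.cong N (p^-split p c≤n)))) (W₀.N-* (p ^ℕ c) (p ^ℕ (n ∸ c)) hx)

  N-fixed′ : ∀ {c} → c < n → ∀ {x} → σ ^ (p ^ℕ c) * x ≈ x →
             N (p ^ℕ (n ∸ 1)) * x ≈ ι (p ^ℕ (n ∸ 1 ∸ c)) * (N (p ^ℕ c) * x)
  N-fixed′ {c} c<n {x} hx = trans (*-congʳ (reflexive (≡.cong N (p^-split p (ℕ.∸-monoˡ-≤ 1 c<n)))))
    (W₀.N-* (p ^ℕ c) (p ^ℕ (n ∸ 1 ∸ c)) hx)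

  N-twice : ∀ {c} → c ≤ n → N P ≈ N (p ^ℕ c) * geom 1# (σ ^ (p ^ℕ c)) (p ^ℕ (n ∸ c))
  N-twice {c} c≤n = trans (reflexive (≡.cong N (p^-split p c≤n)))
    (trans (geom-* 1# σ (p ^ℕ (n ∸ c)) (p ^ℕ c)) (*-congˡ (W₀.geom-congˡ (p ^ℕ (n ∸ c)) (W₀.1^ (p ^ℕ c)))))

  N-difference : ∀ k → (σ - 1#) * N k ≈ σ ^ k - 1#
  N-difference k = trans (geom-difference 1# σ k) (+-congˡ (-‿cong (W₀.1^ k)))

  σ-fixed-^ : ∀ {x} k → σ * x ≈ x → σ ^ k * x ≈ x
  σ-fixed-^ k = W₀.fixed-^ k

  N-σ-fixed : ∀ {x} k → σ * x ≈ x → N k * x ≈ ι k * x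
  N-σ-fixed {x} k hx = trans (*-congʳ (W₀.geom-congˡ k (sym ι-1)))
    (trans (W₀.geom-fixed 1 k hx) (reflexive (≡.cong (λ j → ι j * x) (W₀.gsum-1 k))))

  N-kills : ∀ {γ} → M γ → N P * ((σ - 1#) * γ) ≈ 0#
  N-kills {γ} γ∈M = linear₂ γ (N-difference P) 1# (σ-order γ∈M)
    (solve 4 (λ N σ γ u → N :* ((σ :- :1) :* γ) :+ γ :* (u :- :1) :+ :1 :* γ
      := con ℤ.0ℤ :+ γ :* ((σ :- :1) :* N) :+ :1 :* (u :* γ)) refl (N P) σ γ (σ ^ P))

  kernel-N : ∀ {x} → M x → N P * x ≈ 0# → ∃[ γ ] M γ × x ≈ (σ - 1#) * γ
  kernel-N {x} x∈M Nx≈0 = proj₁ h90 , proj₁ (proj₂ h90) , trans (proj₂ (proj₂ h90)) (*-congʳ (+-congʳ (*-identityʳ σ)))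
    where
    geom-congʳ : ∀ {y y′} k → y ≈ y′ → geom 1# y k ≈ geom 1# y′ k
    geom-congʳ zero    h = refl
    geom-congʳ (suc k) h = +-cong (*-cong h (geom-congʳ k h)) refl
    h90 = hilbert90 0 z≤n x∈M (trans (*-congʳ (geom-congʳ P (*-identityʳ σ))) Nx≈0)

  -- Ĥ⁰(Gal (K_c / F), K_c) embeds into Ĥ⁰(Gal (K / F), K) by multiplication by p ^ (n - c).
  inflation : ∀ {c} → c ≤ n → ∀ {f x} → M f → M x → σ * f ≈ f → ι (p ^ℕ (n ∸ c)) * f ≈ N P * x →
              ∃[ k ] M k × σ ^ (p ^ℕ c) * k ≈ k × N (p ^ℕ c) * k ≈ f
  inflation {c} c≤n {f} {x} f∈M x∈M σf pf≈Nx = k , k∈M , fixed , norm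
    where
    geom-f : geom 1# (σ ^ (p ^ℕ c)) (p ^ℕ (n ∸ c)) * f ≈ ι (p ^ℕ (n ∸ c)) * f
    geom-f = trans (*-congʳ (W₀.geom-congˡ (p ^ℕ (n ∸ c)) (sym ι-1)))
      (trans (W₀.geom-fixed 1 (p ^ℕ (n ∸ c)) (σ-fixed-^ (p ^ℕ c) σf))
        (reflexive (≡.cong (λ j → ι j * f) (W₀.gsum-1 (p ^ℕ (n ∸ c))))))
    -- The element N (p ^ c) x - f is killed by the relative norm of K over the field fixed by σ ^
    -- (p ^ c). Hilbert 90 for that extension then provides the γ by which x is corrected.
    geom-zero : geom 1# (σ ^ (p ^ℕ c)) (p ^ℕ (n ∸ c)) * (N (p ^ℕ c) * x + - 1# * f) ≈ 0#
    geom-zero = linear₃ (- 1#) pf≈Nx (- x) (N-twice c≤n) (- 1#) geom-f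
      (solve 6 (λ g n x f k N → g :* (n :* x :+ (:- :1) :* f) :+ (:- :1) :* (N :* x) :+ (:- x) :* (n :* g) :+ (:- :1) :* (k :* f)
        := con ℤ.0ℤ :+ (:- :1) :* (k :* f) :+ (:- x) :* N :+ (:- :1) :* (g :* f))
       refl (geom 1# (σ ^ (p ^ℕ c)) (p ^ℕ (n ∸ c))) (N (p ^ℕ c)) x f (ι (p ^ℕ (n ∸ c))) (N P))
    h90 = hilbert90 c c≤n (+-closed (*-closed (N (p ^ℕ c)) x∈M) (*-closed (- 1#) f∈M)) geom-zero
    γ : Carrier
    γ = proj₁ h90
    γ∈M : M γ
    γ∈M = proj₁ (proj₂ h90)
    eq : N (p ^ℕ c) * x + - 1# * f ≈ (σ ^ (p ^ℕ c) - 1#) * γ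
    eq = proj₂ (proj₂ h90)
    k : Carrier
    k = x + - 1# * ((σ - 1#) * γ)
    k∈M : M k
    k∈M = +-closed x∈M (*-closed _ (*-closed _ γ∈M))
    norm : N (p ^ℕ c) * k ≈ f
    norm = linear₂ 1# eq (- γ) (N-difference (p ^ℕ c))
      (solve 6 (λ n x σ γ f τ → n :* (x :+ (:- :1) :* ((σ :- :1) :* γ)) :+ :1 :* ((τ :- :1) :* γ) :+ (:- γ) :* (τ :- :1)
        := f :+ :1 :* (n :* x :+ (:- :1) :* f) :+ (:- γ) :* ((σ :- :1) :* n)) refl (N (p ^ℕ c)) x σ γ f (σ ^ (p ^ℕ c)))
    fixed : σ ^ (p ^ℕ c) * k ≈ k
    fixed = linear₃ (- k) (N-difference (p ^ℕ c)) (σ - 1#) norm 1# σf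
      (solve 5 (λ τ k σ n f → τ :* k :+ (:- k) :* (τ :- :1) :+ (σ :- :1) :* f :+ :1 :* f
        := k :+ (:- k) :* ((σ :- :1) :* n) :+ (σ :- :1) :* (n :* k) :+ :1 :* (σ :* f)) refl (σ ^ (p ^ℕ c)) k σ (N (p ^ℕ c)) f)

  infix 4 _<ᴸ_
  data _<ᴸ_ : Index → Fin (suc n) → Set where
    absent : ∀ {c} → ⊥₋ <ᴸ c
    below  : ∀ {c c′ : Fin (suc n)} → toℕ c′ < toℕ c → [ c′ ] <ᴸ c

  -- The later levels are all raised to n, so that no condition on the later components survives. In
  -- the lexicographic order this costs nothing once slot b has dropped.
  lowered : ∀ {m} → Vec Index m → Fin m → Index → Vec Index m
  lowered (_ ∷ a) zero    l = l ∷ replicate _ [ fromℕ n ]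
  lowered (l′ ∷ a) (suc b) l = l′ ∷ lowered a b l

  At-resp : ∀ l {x y} → x ≈ y → At x l → At y l
  At-resp ⊥₋    h hx = trans (sym h) hx
  At-resp [ c ] h hx = trans (*-congˡ (sym h)) (trans hx h)

  At-n : ∀ {x} → M x → At x [ fromℕ n ]
  At-n x∈M = At-top [] x∈M

  At-lowered : ∀ {m} (a : Vec Index m) (b : Fin m) {l} (x : Fin (suc m) → Carrier) → (∀ i → M (x i)) →
               (∀ i → toℕ i < toℕ b → At (x i) (level a i)) → At (x (inject₁ b)) l → ∀ i → At (x i) (level (lowered a b l) i)
  At-lowered (_ ∷ a) zero    x x∈M above at zero    = at
  At-lowered (_ ∷ a) zero    x x∈M above at (suc i) = full _ i (λ j → x (suc j)) (λ j → x∈M (suc j))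
    where
    full : ∀ m i (x : Fin (suc m) → Carrier) → (∀ i → M (x i)) → At (x i) (level (replicate m [ fromℕ n ]) i)
    full zero    zero    x x∈M = At-n (x∈M zero)
    full (suc m) zero    x x∈M = At-n (x∈M zero)
    full (suc m) (suc i) x x∈M = full m i (λ j → x (suc j)) (λ j → x∈M (suc j))
  At-lowered (_ ∷ a) (suc b) x x∈M above at zero    = above zero (s≤s z≤n)
  At-lowered (_ ∷ a) (suc b) x x∈M above at (suc i) =
    At-lowered a b (λ j → x (suc j)) (λ j → x∈M (suc j)) (λ j j<b → above (suc j) (s≤s j<b)) at i

  -- The new component replacing x_b, together with its correction terms.
  record Replacement (c : Fin (suc n)) (w f : Carrier) : Set (a₀ ⊔ ℓ ⊔ ρ) where
    field
      l       : Index
      l<c     : l <ᴸ c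
      k₀ k₁ γ : Carrier
      k₀∈M    : M k₀
      k₁∈M    : M k₁
      γ∈M     : M γ
      at-k₀   : At k₀ l
      w≈      : w ≈ k₀ + ι p * k₁ + (σ - 1#) * γ
      norm    : toℕ c < n → N (p ^ℕ (n ∸ 1)) * k₀ + N P * k₁ ≈ ι (p ^ℕ (n ∸ toℕ c)) * f

  -- At level 0 the element w - p f has norm zero, as N f = P f, so the slot is emptied and f
  -- becomes the correction `k₁`. At a positive level c, inflation makes f a norm of some k from
  -- level c - 1, and w - k has norm zero. Hilbert 90 supplies γ in both cases.
  replacement : ∀ c {w f} → M w → M f → σ * f ≈ f → ι p * (ι (p ^ℕ (n ∸ toℕ c)) * f) ≈ N P * w → Replacement c w f
  replacement zero {w} {f} w∈M f∈M σf pf≈Nw = record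
    { l = ⊥₋ ; l<c = absent ; k₀ = 0# ; k₁ = f ; γ = proj₁ h90 ; k₀∈M = 0∈ ; k₁∈M = f∈M ; γ∈M = proj₁ (proj₂ h90) ; at-k₀ = refl
    ; w≈ = linear₁ 1# (proj₂ (proj₂ h90)) (solve 5 (λ w p f σ γ → w :+ :1 :* ((σ :- :1) :* γ)
        := con ℤ.0ℤ :+ p :* f :+ (σ :- :1) :* γ :+ :1 :* (w :+ (:- p) :* f)) refl w (ι p) f σ (proj₁ h90))
    ; norm = λ _ → trans (+-cong (zeroʳ _) (N-σ-fixed P σf)) (+-identityˡ _)
    }
    where
    vanishes : N P * (w + - ι p * f) ≈ 0#
    vanishes = linear₂ (- 1#) pf≈Nw (- ι p) (N-σ-fixed P σf)
      (solve 5 (λ N w p f q → N :* (w :+ (:- p) :* f) :+ (:- :1) :* (N :* w) :+ (:- p) :* (q :* f)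
        := con ℤ.0ℤ :+ (:- :1) :* (p :* (q :* f)) :+ (:- p) :* (N :* f)) refl (N P) w (ι p) f (ι P))
    h90 = kernel-N (+-closed w∈M (*-closed (- ι p) f∈M)) vanishes
  replacement (suc c) {w} {f} w∈M f∈M σf pf≈Nw = record
    { l = [ inject₁ c ] ; l<c = below (≡.subst (_< suc (toℕ c)) (≡.sym (Fin.toℕ-inject₁ c)) ℕ.≤-refl)
    ; k₀ = k ; k₁ = 0# ; γ = proj₁ h90 ; k₀∈M = proj₁ (proj₂ descent) ; k₁∈M = 0∈ ; γ∈M = proj₁ (proj₂ h90)
    ; at-k₀ = trans (*-congʳ (reflexive (≡.cong (λ j → σ ^ (p ^ℕ j)) (Fin.toℕ-inject₁ c)))) fixed
    ; w≈ = linear₁ 1# (proj₂ (proj₂ h90)) (solve 5 (λ w p k σ γ → w :+ :1 :* ((σ :- :1) :* γ)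
        := k :+ p :* con ℤ.0ℤ :+ (σ :- :1) :* γ :+ :1 :* (w :+ (:- :1) :* k)) refl w (ι p) k σ (proj₁ h90))
    ; norm = λ _ → trans (+-cong (trans (N-fixed′ (Fin.toℕ<n c) fixed) (*-cong
        (ι-cong (≡.cong (p ^ℕ_) (ℕ.∸-+-assoc n 1 (toℕ c)))) Nk≈f)) (zeroʳ _)) (+-identityʳ _)
    }
    where
    c≤n : toℕ c ≤ n
    c≤n = ℕ.<⇒≤ (Fin.toℕ<n c)
    exponent : ι (p ^ℕ (n ∸ toℕ c)) ≈ ι p * ι (p ^ℕ (n ∸ suc (toℕ c)))
    exponent = trans (ι-cong (≡.cong (p ^ℕ_) (≡.trans (∸-suc (Fin.toℕ<n c)) (≡.cong suc (ℕ.∸-+-assoc n 1 (toℕ c))))))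
      (ι-* p (p ^ℕ (n ∸ suc (toℕ c))))
    descent : ∃[ k ] M k × σ ^ (p ^ℕ toℕ c) * k ≈ k × N (p ^ℕ toℕ c) * k ≈ f
    descent = inflation c≤n f∈M w∈M σf (trans (trans (*-congʳ exponent) (*-assoc _ _ _)) pf≈Nw)
    k : Carrier
    k = proj₁ descent
    fixed : σ ^ (p ^ℕ toℕ c) * k ≈ k
    fixed = proj₁ (proj₂ (proj₂ descent))
    Nk≈f : N (p ^ℕ toℕ c) * k ≈ f
    Nk≈f = proj₂ (proj₂ (proj₂ descent))
    vanishes : N P * (w + - 1# * k) ≈ 0#
    vanishes = linear₄ (- 1#) pf≈Nw (- 1#) (N-fixed c≤n fixed) (- ι (p ^ℕ (n ∸ toℕ c))) Nk≈f (- f) exponent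
      (solve 8 (λ N w k q n f p q′ → N :* (w :+ (:- :1) :* k) :+ (:- :1) :* (N :* w) :+ (:- :1) :* (q :* (n :* k)) :+ (:- q) :* f :+ (:- f) :* (p :* q′)
         := con ℤ.0ℤ :+ (:- :1) :* (p :* (q′ :* f)) :+ (:- :1) :* (N :* k) :+ (:- q) :* (n :* k) :+ (:- f) :* q)
       refl (N P) w k (ι (p ^ℕ (n ∸ toℕ c))) (N (p ^ℕ toℕ c)) f (ι p) (ι (p ^ℕ (n ∸ suc (toℕ c)))))
    h90 = kernel-N (+-closed w∈M (*-closed (- 1#) (proj₁ (proj₂ descent)))) vanishes

  single-same : ∀ {k} (j : Fin k) v → single j v j ≡ v
  single-same zero    v = ≡.refl
  single-same (suc j) v = single-same j v

  single-other : ∀ {k} (j i : Fin k) v → ¬ i ≡ j → single j v i ≡ 0#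
  single-other zero    zero    v i≢j = contradiction ≡.refl i≢j
  single-other zero    (suc i) v i≢j = ≡.refl
  single-other (suc j) zero    v i≢j = ≡.refl
  single-other (suc j) (suc i) v i≢j = single-other j i v (λ eq → i≢j (≡.cong suc eq))

  N-At-fixed : ∀ l {x} → At x l → σ * (N (p ^ℕ height l) * x) ≈ N (p ^ℕ height l) * x
  N-At-fixed ⊥₋    {x} hx = linear₁ (σ * N 1 - N 1) hx
    (solve 3 (λ σ n x → σ :* (n :* x) :+ (σ :* n :- n) :* con ℤ.0ℤ := n :* x :+ (σ :* n :- n) :* x) refl σ (N 1) x)
  N-At-fixed [ c ] {x} hx = linear₂ x (N-difference (p ^ℕ toℕ c)) 1# hx
    (solve 4 (λ σ n x τ → σ :* (n :* x) :+ x :* (τ :- :1) :+ :1 :* x := n :* x :+ x :* ((σ :- :1) :* n) :+ :1 :* (τ :* x))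
      refl σ (N (p ^ℕ toℕ c)) x (σ ^ (p ^ℕ toℕ c)))

  record LowerableData : Set (a₀ ⊔ ℓ ⊔ ρ) where
    field
      D : Data C
    open Data D
    open Multiplier p s using (d)
    field
      r₁      : ℕ
      r≡      : r ≡ p *ℕ r₁
      b′      : Fin m
      c       : Fin (suc n)
      level-b : level a (inject₁ b′) ≡ [ c ]
      p∤u     : ¬ p ∣ r′ (inject₁ b′)
      smaller : ∀ i → toℕ i < toℕ (inject₁ b′) → p ∣ r′ i
      η       : Carrier
      η∈M     : M η
      pη      : ι p * η ≈ Torsion.root C D
      ση      : σ * η ≈ ι d * η

  module _ (lowerable : LowerableData) where
    open LowerableData lowerable
    open Data D
    open Multiplier p s using (d; E)
    private
      module W = Twisted R σ p s
      module Div = Divided p n s e′ r power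
      module T = Torsion C D
      module AL = AbsorbLevel C D (inject₁ b′) c level-b p∤u

    open IsPair pair

    private
      b : Fin (suc m)
      b = inject₁ b′

      u : ℕ
      u = r′ b

      h : Fin (suc m) → ℕ
      h i = p ^ℕ height (level a i)

      φ : Fin (suc m) → Carrier
      φ i = ι (r′ i) * (N (h i) * x i)

      g : Fin (suc m) → Carrier
      g i = ι (r′ i) * (W.Y (h i) * x i)

      t : Fin (suc m) → Carrier
      t = T.t

      c≤n : toℕ c ≤ n
      c≤n = ℕ.s≤s⁻¹ (Fin.toℕ<n c)

      at-b : σ ^ (p ^ℕ toℕ c) * x b ≈ x b
      at-b = ≡.subst (At (x b)) level-b (at b)

      φ-b : φ b ≈ ι u * (N (p ^ℕ toℕ c) * x b)
      φ-b = reflexive (≡.cong (λ l → ι u * (N (p ^ℕ height l) * x b)) level-b)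

      ι-r : ι r ≈ ι p * ι r₁
      ι-r = trans (ι-cong r≡) (ι-* p r₁)

      -- In p η = r y + ∑ t with T = N + p Y, the parts p r₁ y and p ∑ g are moved to the side of η.
      -- What remains presents p f₀ as ∑ φ, a sum of multiples of norms from the fields of the slots
      -- to F.
      f₀ : Carrier
      f₀ = η - ι r₁ * y - ∑ g

      f₀∈M : M f₀
      f₀∈M = resp (solve 4 (λ η r y g → η :+ ((:- r) :* y :+ (:- :1) :* g) := η :- r :* y :- g) refl η (ι r₁) y (∑ g))
        (+-closed η∈M (+-closed (*-closed _ y∈M) (*-closed _ (∑-closed M 0∈ +-closed (λ i → *-closed _ (*-closed _ (x∈M i)))))))

      ∑t≈ : ∑ t ≈ ∑ φ + ι p * ∑ g
      ∑t≈ = trans (∑-cong (λ i → linear₁ (ι (r′ i) * x i) (W.T≈N+pY (h i))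
          (solve 6 (λ r t x n p y → r :* (t :* x) :+ r :* x :* (n :+ p :* y) := r :* (n :* x) :+ p :* (r :* (y :* x)) :+ r :* x :* t)
            refl (ι (r′ i)) (W.T (h i)) (x i) (N (h i)) (ι p) (W.Y (h i)))))
        (trans (∑-+ φ (λ i → ι p * g i)) (+-congˡ (∑-* (ι p) g)))

      pf₀ : ι p * f₀ ≈ ∑ φ
      pf₀ = linear₃ 1# pη 1# ∑t≈ y ι-r
        (solve 8 (λ p η r y g φ t pr → p :* (η :- r :* y :- g) :+ :1 :* (pr :* y :+ t) :+ :1 :* (φ :+ p :* g) :+ y :* (p :* r)
            := φ :+ :1 :* (p :* η) :+ :1 :* t :+ y :* pr)
          refl (ι p) η (ι r₁) y (∑ g) (∑ φ) (∑ t) (ι r))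

      g-twist : ∀ i → (σ - 1#) * g i + ι r₁ * (ι (p ^ℕ toℕ i) * x i) ≈ ι s * t i
      g-twist i = slot (toℕ i) (r′ i) (level a i) (levels i) (at i)
        where
        slot : ∀ i r″ l → p ^ℕ i *ℕ q p d l ≡ p ^ℕ suc e′ *ℕ r″ → ∀ {x} → At x l →
               (σ - 1#) * (ι r″ * (W.Y (p ^ℕ height l) * x)) + ι r₁ * (ι (p ^ℕ i) * x) ≈ ι s * (ι r″ * (W.T (p ^ℕ height l) * x))
        slot i r″ ⊥₋ hr {x} hx = linear₁ ((σ - 1#) * (ι r″ * W.Y 1) + ι r₁ * ι (p ^ℕ i) - ι s * (ι r″ * W.T 1)) hx
          (solve 8 (λ σ r y x r₁ i s t → (σ :- :1) :* (r :* (y :* x)) :+ r₁ :* (i :* x) :+ ((σ :- :1) :* (r :* y) :+ r₁ :* i :- s :* (r :* t)) :* con ℤ.0ℤ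
             := s :* (r :* (t :* x)) :+ ((σ :- :1) :* (r :* y) :+ r₁ :* i :- s :* (r :* t)) :* x)
            refl σ (ι r″) (W.Y 1) x (ι r₁) (ι (p ^ℕ i)) (ι s) (W.T 1))
        slot i r″ [ c ] hr {x} hx = linear₂ (ι r″ * x) (W.Y-difference (p ^ℕ toℕ c)) (- x) numbers
          (solve 9 (λ σ r y x r₁ i s t E → (σ :- :1) :* (r :* (y :* x)) :+ r₁ :* (i :* x) :+ r :* x :* (s :* t :- E) :+ (:- x) :* (i :* r₁)
             := s :* (r :* (t :* x)) :+ r :* x :* ((σ :- :1) :* y) :+ (:- x) :* (r :* E))
            refl σ (ι r″) (W.Y (p ^ℕ toℕ c)) x (ι r₁) (ι (p ^ℕ i)) (ι s) (W.T (p ^ℕ toℕ c)) (ι (E (p ^ℕ toℕ c))))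
          where
          numbers : ι r″ * ι (E (p ^ℕ toℕ c)) ≈ ι (p ^ℕ i) * ι r₁
          numbers = trans (sym (ι-* r″ _)) (trans (ι-cong (ℕ.*-cancelˡ-≡ _ _ p (≡.trans (swap p r″ _)
            (≡.trans (Div.E-quotient (ℕ.s≤s⁻¹ (Fin.toℕ<n c)) i r″ hr) (≡.trans (≡.cong (p ^ℕ i *ℕ_) r≡) (swap (p ^ℕ i) p r₁)))))) (ι-* _ r₁))
            where
            open +-*-Solver using () renaming (solve to solve′; _:*_ to _⊗_; _:=_ to _⊜_)
            swap : ∀ j k l → j *ℕ (k *ℕ l) ≡ k *ℕ (j *ℕ l)
            swap = solve′ 3 (λ j k l → j ⊗ (k ⊗ l) ⊜ k ⊗ (j ⊗ l)) ≡.refl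

      -- On the one hand (σ - 1) η = p s η = s root. On the other hand r₁ (σ - 1) y = s r y + r₁ S x
      -- and (σ - 1) ∑ g = s ∑ t - r₁ S x, which also add up to s root.
      σf₀ : σ * f₀ ≈ f₀
      σf₀ = linear₄ 1# ση (- ι r₁) twisted (- 1#) g-total (ι s) pη
        (linear₃ η W.ι-d (- 1#) refl (ι s * y) ι-r
        (solve 12 (λ σ η r₁ y g d p s X t pr o →
          σ :* (η :- r₁ :* y :- g) :+ :1 :* (d :* η) :+ (:- r₁) :* ((:1 :+ p :* s) :* y :+ X) :+ (:- :1) :* (s :* t) :+ s :* (pr :* y :+ t)
            :+ η :* (:1 :+ p :* s) :+ (:- :1) :* o :+ s :* y :* (p :* r₁)
          := η :- r₁ :* y :- g :+ :1 :* (σ :* η) :+ (:- r₁) :* (σ :* y) :+ (:- :1) :* ((σ :- :1) :* g :+ r₁ :* X) :+ s :* (p :* η)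
            :+ η :* d :+ (:- :1) :* o :+ s :* y :* pr)
         refl σ η (ι r₁) y (∑ g) (ι d) (ι p) (ι s) (S x) (∑ t) (ι r) 0#))
        where
        g-total : (σ - 1#) * ∑ g + ι r₁ * S x ≈ ι s * ∑ t
        g-total = trans (+-cong (sym (∑-* _ g)) (sym (∑-* (ι r₁) (λ i → ι (p ^ℕ toℕ i) * x i))))
          (trans (sym (∑-+ (λ i → (σ - 1#) * g i) (λ i → ι r₁ * (ι (p ^ℕ toℕ i) * x i))))
            (trans (∑-cong g-twist) (∑-* (ι s) t)))

      k k′ : ℕ
      k  = p ^ℕ (n ∸ 1 ∸ toℕ c)
      k′ = p ^ℕ (n ∸ toℕ c)

      k′≡ : toℕ c < n → ι k′ ≈ ι p * ι k
      k′≡ c<n = trans (ι-cong (≡.cong (p ^ℕ_) (∸-suc c<n))) (ι-* p k)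

      -- Up to a power of p, each φ i with i ≠ b is p times a fixed element or a norm from K. Slot
      -- zero needs the exponent n - 1 - c of `P₁`, which makes sense only for c < n. `P₂` has one
      -- more factor p and remains valid for c = n.
      record Rest (i : Fin (suc m)) : Set (a₀ ⊔ ℓ ⊔ ρ) where
        field
          f v : Carrier
          f∈M : M f
          v∈M : M v
          σf  : σ * f ≈ f
          P₁  : toℕ c < n → ι k * φ i ≈ ι k * single b (φ b) i + ι k * (ι p * f) + N P * v
          P₂  : ι k′ * φ i ≈ ι k′ * single b (φ b) i + ι k′ * (ι p * f) + ι p * (N P * v)

      rest : ∀ i → Rest i
      rest i with i Fin.≟ b
      ... | yes ≡.refl = record
        { f = 0# ; v = 0# ; f∈M = 0∈ ; v∈M = 0∈ ; σf = zeroʳ σ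
        ; P₁ = λ _ → same k ; P₂ = trans (same k′) (+-congˡ (trans (zeroʳ _) (trans (sym (zeroʳ _)) (*-congˡ (sym (zeroʳ _)))))) }
        where
        same : ∀ k → ι k * φ b ≈ ι k * single b (φ b) b + ι k * (ι p * 0#) + N P * 0#
        same k = trans (solve 4 (λ k φ p N → k :* φ := k :* φ :+ k :* (p :* con ℤ.0ℤ) :+ N :* con ℤ.0ℤ) refl (ι k) (φ b) (ι p) (N P))
          (+-congʳ (+-congʳ (*-congˡ (reflexive (≡.sym (single-same b (φ b)))))))
      ... | no i≢b with p ∣? r′ i
      ...   | yes (divides j r′≡) = record
        { f = ι j * (N (h i) * x i) ; v = 0# ; f∈M = *-closed _ (*-closed _ (x∈M i)) ; v∈M = 0∈
        ; σf = trans (solve 3 (λ σ j x → σ :* (j :* x) := j :* (σ :* x)) refl σ (ι j) (N (h i) * x i)) (*-congˡ (N-At-fixed (level a i) (at i)))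
        ; P₁ = λ _ → linear₁ (ι k * (N (h i) * x i)) numbers (trans (+-congʳ refl) (other k))
        ; P₂ = linear₁ (ι k′ * (N (h i) * x i)) numbers (trans (other k′) (+-congʳ (+-congˡ (trans (zeroʳ _) (trans (sym (zeroʳ _)) (*-congˡ (sym (zeroʳ _)))))))) }
        where
        numbers : ι (r′ i) ≈ ι j * ι p
        numbers = trans (ι-cong r′≡) (ι-* j p)
        other : ∀ k → ι k * φ i + ι k * (N (h i) * x i) * (ι j * ι p) ≈
                ι k * single b (φ b) i + ι k * (ι p * (ι j * (N (h i) * x i))) + N P * 0# + ι k * (N (h i) * x i) * ι (r′ i)
        other k = trans (solve 6 (λ k r x j p N → k :* (r :* x) :+ k :* x :* (j :* p)
            := k :* con ℤ.0ℤ :+ k :* (p :* (j :* x)) :+ N :* con ℤ.0ℤ :+ k :* x :* r) refl (ι k) (ι (r′ i)) (N (h i) * x i) (ι j) (ι p) (N P))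
          (+-congʳ (+-congʳ (+-congʳ (*-congˡ (reflexive (≡.sym (single-other b i (φ b) i≢b)))))))
      -- Such an i comes after b by the choice of b, and its level c′ exceeds c, as otherwise
      -- `lower` would give p ∣ r′ i. A higher level makes p ^ (n - 1 - c) φ i the norm of p ^ (c′ -
      -- c - 1) r′ i x i.
      ...   | no p∤r′ = above (level a i) (levels i) (at i) ≡.refl
        where
        b<i : toℕ b < toℕ i
        b<i with ℕ.<-cmp (toℕ b) (toℕ i)
        ... | tri< b<i _ _ = b<i
        ... | tri≈ _ b≡i _ = contradiction (Fin.toℕ-injective (≡.sym b≡i)) i≢b
        ... | tri> _ _ b>i = contradiction (smaller i b>i) p∤r′
        above : ∀ l → p ^ℕ toℕ i *ℕ q p d l ≡ p ^ℕ suc e′ *ℕ r′ i → At (x i) l → l ≡ level a i → Rest i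
        above ⊥₋ hr hx l≡ = contradiction (≡.subst (p ∣_) (ℕ.*-cancelˡ-≡ 0 (r′ i) (p ^ℕ suc e′) ⦃ ℕ.m^n≢0 p (suc e′) ⦄
          (≡.trans (ℕ.*-zeroʳ (p ^ℕ suc e′)) (≡.trans (≡.sym (ℕ.*-zeroʳ (p ^ℕ toℕ i))) hr))) (p ∣.∣0)) p∤r′
        above [ c′ ] hr hx l≡ with toℕ c′ ℕ.≤? toℕ c
        ... | yes c′≤c = contradiction (divides-r′ (AL.lower (toℕ i) (r′ i) c′ c′≤c hr)) p∤r′
          where
          divides-r′ : ∀ {G} → u *ℕ p ^ℕ toℕ i *ℕ G ≡ p ^ℕ toℕ b *ℕ r′ i → p ∣ r′ i
          divides-r′ {G} eq = divides (u *ℕ p ^ℕ (toℕ i ∸ suc (toℕ b)) *ℕ G) (ℕ.*-cancelˡ-≡ _ _ (p ^ℕ toℕ b) ⦃ ℕ.m^n≢0 p (toℕ b) ⦄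
            (≡.trans (≡.sym eq) (≡.trans (≡.cong (λ z → u *ℕ z *ℕ G) (p^-split p b<i))
              (solve′ 5 (λ u j p b G → u ⊗ (j ⊗ (p ⊗ b)) ⊗ G ⊜ b ⊗ (u ⊗ j ⊗ G ⊗ p)) ≡.refl u (p ^ℕ (toℕ i ∸ suc (toℕ b))) p (p ^ℕ toℕ b) G))))
            where open +-*-Solver using () renaming (solve to solve′; _:*_ to _⊗_; _:=_ to _⊜_)
        ... | no c′≰c = record
          { f = 0# ; v = v ; f∈M = 0∈ ; v∈M = *-closed _ (*-closed _ (x∈M i)) ; σf = zeroʳ σ
          ; P₁ = λ _ → trans kφ P₁-form
          ; P₂ = trans (*-congʳ (k′≡ c<n)) (trans (*-assoc _ _ _) (trans (*-congˡ kφ) P₂-form)) }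
          where
          c<c′ : toℕ c < toℕ c′
          c<c′ = ℕ.≰⇒> c′≰c
          c′≤n : toℕ c′ ≤ n
          c′≤n = ℕ.s≤s⁻¹ (Fin.toℕ<n c′)
          c<n : toℕ c < n
          c<n = ℕ.<-≤-trans c<c′ c′≤n
          j : ℕ
          j = p ^ℕ (toℕ c′ ∸ suc (toℕ c))
          v : Carrier
          v = ι j * (ι (r′ i) * x i)
          k≡ : ι k ≈ ι j * ι (p ^ℕ (n ∸ toℕ c′))
          k≡ = trans (ι-cong (≡.trans (≡.cong (p ^ℕ_) exponents) (ℕ.^-distribˡ-+-* p (toℕ c′ ∸ suc (toℕ c)) (n ∸ toℕ c′)))) (ι-* j _)
            where
            exponents : n ∸ 1 ∸ toℕ c ≡ toℕ c′ ∸ suc (toℕ c) +ℕ (n ∸ toℕ c′)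
            exponents = ≡.trans (ℕ.∸-+-assoc n 1 (toℕ c)) (≡.trans (≡.cong (_∸ suc (toℕ c)) (≡.sym (ℕ.m+[n∸m]≡n c′≤n)))
              (ℕ.+-∸-comm (n ∸ toℕ c′) c<c′))
          kφ : ι k * φ i ≈ N P * v
          kφ = trans (*-congˡ (reflexive (≡.cong (λ l → ι (r′ i) * (N (p ^ℕ height l) * x i)) (≡.sym l≡))))
            (linear₂ (ι (r′ i) * (N (p ^ℕ toℕ c′) * x i)) k≡ (- (ι j * ι (r′ i))) (N-fixed c′≤n hx)
              (solve 7 (λ k r n x j z N → k :* (r :* (n :* x)) :+ r :* (n :* x) :* (j :* z) :+ (:- (j :* r)) :* (z :* (n :* x))
                := N :* (j :* (r :* x)) :+ r :* (n :* x) :* k :+ (:- (j :* r)) :* (N :* x))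
               refl (ι k) (ι (r′ i)) (N (p ^ℕ toℕ c′)) (x i) (ι j) (ι (p ^ℕ (n ∸ toℕ c′))) (N P)))
          zero-single : ∀ k → 0# ≈ ι k * single b (φ b) i + ι k * (ι p * 0#)
          zero-single k = trans (solve 2 (λ k p → con ℤ.0ℤ := k :* con ℤ.0ℤ :+ k :* (p :* con ℤ.0ℤ)) refl (ι k) (ι p))
            (+-congʳ (*-congˡ (reflexive (≡.sym (single-other b i (φ b) i≢b)))))
          P₁-form : N P * v ≈ ι k * single b (φ b) i + ι k * (ι p * 0#) + N P * v
          P₁-form = trans (sym (+-identityˡ _)) (+-congʳ (zero-single k))
          P₂-form : ι p * (N P * v) ≈ ι k′ * single b (φ b) i + ι k′ * (ι p * 0#) + ι p * (N P * v)
          P₂-form = trans (sym (+-identityˡ _)) (+-congʳ (zero-single k′))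

      f v w : Carrier
      f = f₀ - ∑ (λ i → Rest.f (rest i))
      v = ∑ (λ i → Rest.v (rest i))
      w = ι u * x b + ι p * v

      f∈M : M f
      f∈M = resp (+-congˡ (solve 1 (λ x → (:- :1) :* x := :- x) refl _))
        (+-closed f₀∈M (*-closed (- 1#) (∑-closed M 0∈ +-closed (λ i → Rest.f∈M (rest i)))))

      v∈M : M v
      v∈M = ∑-closed M 0∈ +-closed (λ i → Rest.v∈M (rest i))

      w∈M : M w
      w∈M = +-closed (*-closed _ (x∈M b)) (*-closed _ v∈M)

      σf : σ * f ≈ f
      σf = linear₂ 1# σf₀ (- 1#) (trans (sym (∑-* σ (λ i → Rest.f (rest i)))) (∑-cong (λ i → Rest.σf (rest i))))
        (solve 3 (λ σ f g → σ :* (f :- g) :+ :1 :* f :+ (:- :1) :* g := f :- g :+ :1 :* (σ :* f) :+ (:- :1) :* (σ :* g)) refl σ f₀ _)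

      -- Applied with κ = p ^ (n - 1 - c) and κ = p ^ (n - c).
      total : ∀ κ V → (∀ i → ι κ * φ i ≈ ι κ * single b (φ b) i + ι κ * (ι p * Rest.f (rest i)) + V * Rest.v (rest i)) →
              ι κ * (ι p * f) ≈ ι κ * φ b + V * v
      total κ V slots = linear₂ (ι κ) pf₀ 1# summed
        (solve 7 (λ κ p f₀ F φ φb Vv → κ :* (p :* (f₀ :- F)) :+ κ :* φ :+ :1 :* (κ :* φb :+ κ :* (p :* F) :+ Vv)
           := κ :* φb :+ Vv :+ κ :* (p :* f₀) :+ :1 :* (κ :* φ)) refl (ι κ) (ι p) f₀ (∑ (λ i → Rest.f (rest i))) (∑ φ) (φ b) (V * v))
        where
        F₁ F₂ F₃ : Fin (suc m) → Carrier
        F₁ i = ι κ * single b (φ b) i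
        F₂ i = ι κ * (ι p * Rest.f (rest i))
        F₃ i = V * Rest.v (rest i)
        summed : ι κ * ∑ φ ≈ ι κ * φ b + ι κ * (ι p * ∑ (λ i → Rest.f (rest i))) + V * v
        summed = trans (sym (∑-* (ι κ) φ)) (trans (∑-cong slots) (trans (∑-+ (λ i → F₁ i + F₂ i) F₃)
          (+-cong (trans (∑-+ F₁ F₂) (+-cong (∑-single (λ _ → ι κ) b (φ b))
            (trans (∑-* (ι κ) (λ i → ι p * Rest.f (rest i))) (*-congˡ (∑-* (ι p) _))))) (∑-* V _))))

      norm-w : ι p * (ι k′ * f) ≈ N P * w
      norm-w = linear₃ 1# (total k′ (ι p * N P) (λ i → trans (Rest.P₂ (rest i)) (+-congˡ (sym (*-assoc _ _ _)))))
          (ι k′) φ-b (- ι u) (N-fixed c≤n at-b)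
        (solve 10 (λ p k f N u x v φ n o → p :* (k :* f) :+ :1 :* (k :* φ :+ p :* N :* v) :+ k :* (u :* (n :* x)) :+ (:- u) :* (k :* (n :* x))
          := N :* (u :* x :+ p :* v) :+ :1 :* (k :* (p :* f)) :+ k :* φ :+ (:- u) :* (N :* x))
         refl (ι p) (ι k′) f (N P) (ι u) (x b) v (φ b) (N (p ^ℕ toℕ c)) 0#)

      module New = Replacement (replacement c w∈M f∈M σf norm-w)
      open New using (k₀; k₁; γ)

      inverse : ∃[ z ] ∃[ t ] z * ι u ≈ 1# + t * ι (p ^ℕ 1)
      inverse = ι-inverse p∤u 1

      z t′ : Carrier
      z = proj₁ inverse
      t′ = proj₁ (proj₂ inverse)

      zu≈ : z * ι u ≈ 1# + t′ * ι p
      zu≈ = trans (proj₂ (proj₂ inverse)) (+-congˡ (*-congˡ (ι-cong (ℕ.*-identityʳ p))))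

      -- Solving for x b by means of z u = 1 + t′ p gives x b = z k₀ + (σ - 1) (z γ) - p Q. Changing
      -- y by - p ^ b z γ removes the middle term and, since σ - d = σ - 1 - p s, creates p ^ (b +
      -- 1) s z γ. This and - p Q are collected as B in slot b + 1.
      Q A B y′ : Carrier
      Q = z * v - z * k₁ + t′ * x b
      A = z * k₀ - x b
      B = ι s * (z * γ) - Q
      y′ = y - ι (p ^ℕ toℕ b′) * (z * γ)

      x′ : Fin (suc m) → Carrier
      x′ i = x i + (single b A i + single (suc b′) B i)

      pᵇ : ι (p ^ℕ toℕ b) ≈ ι (p ^ℕ toℕ b′)
      pᵇ = ι-cong (≡.cong (p ^ℕ_) (Fin.toℕ-inject₁ b′))

      S-x′ : S x′ ≈ S x + (ι (p ^ℕ toℕ b′) * A + ι (p ^ℕ suc (toℕ b′)) * B)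
      S-x′ = trans (S-+ x (λ i → single b A i + single (suc b′) B i)) (+-congˡ (trans (S-+ (single b A) (single (suc b′) B))
        (+-cong (trans (S-single b A) (*-congʳ pᵇ)) (S-single (suc b′) B))))

      L-A : L (single b A) ≈ ι (p ^ℕ toℕ b′) * (N P * Q)
      L-A = at-slot b′ ≡.refl
        where
        at-slot : ∀ j → j ≡ b′ → L (single (inject₁ j) A) ≈ ι (p ^ℕ toℕ j) * (N P * Q)
        at-slot (suc j) ≡.refl = trans (L-single-suc (inject₁ j) A)
          (trans (*-congʳ (ι-cong (≡.cong (p ^ℕ_) (Fin.toℕ-inject₁ j))))
          (linear₄ (ι (p ^ℕ toℕ j) * z) (*-congˡ (sym New.w≈)) (ι (p ^ℕ toℕ j) * N P * x b) zu≈
             (- (N P * Q)) (ι-* p (p ^ℕ toℕ j)) (- (ι (p ^ℕ toℕ j) * z)) (N-kills New.γ∈M)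
          (solve 14 (λ q N z k₀ x v k₁ t p u σ γ q′ o →
            let C′ = z :* v :- z :* k₁ :+ t :* x in
            q :* (N :* (z :* k₀ :- x)) :+ q :* z :* (N :* (u :* x :+ p :* v)) :+ q :* N :* x :* (:1 :+ t :* p) :+ (:- (N :* C′)) :* (p :* q) :+ (:- (q :* z)) :* con ℤ.0ℤ
            := q′ :* (N :* C′) :+ q :* z :* (N :* (k₀ :+ p :* k₁ :+ (σ :- :1) :* γ)) :+ q :* N :* x :* (z :* u) :+ (:- (N :* C′)) :* q′ :+ (:- (q :* z)) :* (N :* ((σ :- :1) :* γ)))
           refl (ι (p ^ℕ toℕ j)) (N P) z k₀ (x b) v k₁ t′ (ι p) (ι u) σ γ (ι (p ^ℕ suc (toℕ j))) 0#)))
        -- In slot zero the norm of A is taken with N (p ^ (n - 1)). The identities for N P are p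
        -- times too coarse here, so the sharper `P₁` and `New.norm` are used.
        at-slot zero ≡.refl = trans (L-single-zero A)
          (linear₄ z (New.norm c<n) (z * f) (k′≡ c<n) z (total k (N P) (λ i → Rest.P₁ (rest i) c<n)) (z * ι k) φ-b
          (linear₄ (- (z * ι u)) (N-fixed′ c<n at-b) (N₁ * x b) zu≈ (- t′) N-bottom′ (- (N P * Q)) ι-1
          (solve 16 (λ N₁ z k₀ x k₁ N k′ f k p φ v u n t q →
            let C′ = z :* v :- z :* k₁ :+ t :* x in
            N₁ :* (z :* k₀ :- x) :+ z :* (k′ :* f) :+ z :* f :* (p :* k) :+ z :* (k :* φ :+ N :* v) :+ z :* k :* (u :* (n :* x))
              :+ (:- (z :* u)) :* (k :* (n :* x)) :+ N₁ :* x :* (:1 :+ t :* p) :+ (:- t) :* (p :* (N₁ :* x)) :+ (:- (N :* C′)) :* :1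
            := q :* (N :* C′) :+ z :* (N₁ :* k₀ :+ N :* k₁) :+ z :* f :* k′ :+ z :* (k :* (p :* f)) :+ z :* k :* φ
              :+ (:- (z :* u)) :* (N₁ :* x) :+ N₁ :* x :* (z :* u) :+ (:- t) :* (N :* x) :+ (:- (N :* C′)) :* q)
           refl N₁ z k₀ (x b) k₁ (N P) (ι k′) f (ι k) (ι p) (φ b) v (ι u) (N (p ^ℕ toℕ c)) t′ (ι (p ^ℕ 0)))))
          where
          N₁ : Carrier
          N₁ = N (p ^ℕ (n ∸ 1))
          c<n : toℕ c < n
          c<n = bottom c level-b
          N-bottom′ : N P * x b ≈ ι p * (N₁ * x b)
          N-bottom′ = T.N-bottom [ c ] (λ { _ ≡.refl → c<n }) at-b

      L-x′ : L x′ ≈ L x + (ι (p ^ℕ toℕ b′) * (N P * Q) + ι (p ^ℕ toℕ b′) * (N P * B))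
      L-x′ = trans (L-+ x (λ i → single b A i + single (suc b′) B i)) (+-congˡ (trans (L-+ (single b A) (single (suc b′) B))
        (+-cong L-A (L-single-suc b′ B))))

    lower-level : ∃[ l ] l <ᴸ c × ∃[ y′ ] ∃[ x′ ] IsPair (lowered a b′ l) (ι s) y′ x′
    lower-level = New.l , New.l<c , y′ , x′ , record
      { y∈M     = resp (+-congˡ (solve 2 (λ q x → (:- q) :* x := :- (q :* x)) refl _ _)) (+-closed y∈M (*-closed (- ι (p ^ℕ toℕ b′)) (*-closed z New.γ∈M)))
      ; x∈M     = x′∈M
      ; at      = At-lowered a b′ x′ x′∈M
          (λ i i<b → At-resp (level a i) (sym (unchanged i i<b)) (at i)) (At-resp New.l (sym changed) (At-* New.l z New.at-k₀))
      ; twisted = linear₃ 1# twisted (- 1#) S-x′ (- B) (ι-* p (p ^ℕ toℕ b′))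
          (linear₂ (ι (p ^ℕ toℕ b′) * z) New.w≈ (- (ι (p ^ℕ toℕ b′) * x b)) zu≈
          (solve 18 (λ σ y q z γ p s X X′ k₀ x v k₁ t u q′ o o′ →
            let C′ = z :* v :- z :* k₁ :+ t :* x
                A′ = z :* k₀ :- x
                B′ = s :* (z :* γ) :- C′ in
            σ :* (y :- q :* (z :* γ)) :+ :1 :* ((:1 :+ p :* s) :* y :+ X) :+ (:- :1) :* (X :+ (q :* A′ :+ q′ :* B′)) :+ (:- B′) :* (p :* q)
              :+ q :* z :* (k₀ :+ p :* k₁ :+ (σ :- :1) :* γ) :+ (:- (q :* x)) :* (:1 :+ t :* p)
            := (:1 :+ p :* s) :* (y :- q :* (z :* γ)) :+ X′ :+ :1 :* (σ :* y) :+ (:- :1) :* X′ :+ (:- B′) :* q′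
              :+ q :* z :* (u :* x :+ p :* v) :+ (:- (q :* x)) :* (z :* u))
           refl σ y (ι (p ^ℕ toℕ b′)) z γ (ι p) (ι s) (S x) (S x′) k₀ (x b) v k₁ t′ (ι u) (ι (p ^ℕ suc (toℕ b′))) 0# 0#))
      ; normed  = linear₂ 1# normed (- 1#) L-x′
          (solve 10 (λ ξ s N y q zγ l l′ Q o →
            ξ :+ :1 :* (s :* (N :* y) :+ l) :+ (:- :1) :* (l :+ (q :* (N :* Q) :+ q :* (N :* (s :* zγ :- Q))))
            := s :* (N :* (y :- q :* zγ)) :+ l′ :+ :1 :* ξ :+ (:- :1) :* l′)
           refl ξ (ι s) (N P) y (ι (p ^ℕ toℕ b′)) (z * γ) (L x) (L x′) Q 0#)
      }
      where
      A∈M : M A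
      A∈M = resp (+-congˡ (solve 1 (λ x → (:- :1) :* x := :- x) refl _)) (+-closed (*-closed z New.k₀∈M) (*-closed (- 1#) (x∈M b)))
      B∈M : M B
      B∈M = resp (solve 6 (λ s zγ z v k t → s :* zγ :+ ((:- z) :* v :+ (z :* k :+ (:- :1) :* t)) := s :* zγ :- (z :* v :- z :* k :+ t))
          refl (ι s) (z * γ) z v k₁ (t′ * x b))
        (+-closed (*-closed _ (*-closed z New.γ∈M)) (+-closed (*-closed _ v∈M) (+-closed (*-closed z New.k₁∈M) (*-closed _ (*-closed t′ (x∈M b))))))
      x′∈M : ∀ i → M (x′ i)
      x′∈M i = +-closed (x∈M i) (+-closed (single-closed M 0∈ b A∈M i) (single-closed M 0∈ (suc b′) B∈M i))
      unchanged : ∀ i → toℕ i < toℕ b′ → x′ i ≈ x i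
      unchanged i i<b = trans (+-congˡ (trans (+-cong
        (reflexive (single-other b i A λ eq → ℕ.<⇒≢ i<b (≡.trans (≡.cong toℕ eq) (Fin.toℕ-inject₁ b′))))
        (reflexive (single-other (suc b′) i B λ eq → ℕ.<⇒≢ (ℕ.m<n⇒m<1+n i<b) (≡.cong toℕ eq))))
        (+-identityˡ 0#))) (+-identityʳ _)
      changed : x′ b ≈ z * k₀
      changed = trans (+-congˡ (+-cong (reflexive (single-same b A))
        (reflexive (single-other (suc b′) b B λ eq → ℕ.<⇒≢ (ℕ.n<1+n (toℕ b′)) (≡.trans (≡.sym (Fin.toℕ-inject₁ b′)) (≡.cong toℕ eq))))))
        (solve 2 (λ x k → x :+ (k :- x :+ con ℤ.0ℤ) := k) refl (x b) (z * k₀))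

-- Consequences of the minimality of a.

module Minimality {a₀ ℓ ρ} (C : CyclicModule a₀ ℓ ρ) where
  open CyclicModule C
  private instance
    p≢0 : NonZero p
    p≢0 = prime⇒nonZero p-prime

  open Geometric R
  open Levels n
  open Pairs C
  open IsIdeal M-ideal
  open Shifting C
  open Lowering C
  open Exponents p-prime n
  open Stability p-prime 1≤n
  open AddInfimum (Fin._<_ {suc n}) using (_<₋_; ⊥₋<[_]; [_])
  open import Relation.Binary.Reasoning.Setoid setoid

  HasPair : ∀ {m} → Vec Index m → Carrier → Set (a₀ ⊔ ℓ ⊔ ρ)
  HasPair a S′ = ∃[ y ] ∃[ x ] IsPair a S′ y x

  Minimal : ∀ {m} → Vec Index m → Set (a₀ ⊔ ℓ ⊔ ρ)
  Minimal {m} a = ∀ (a′ : Vec Index m) s → HasPair a′ (ι s) → Below (level a′ zero) → ¬ Lex-< _≡_ _<₋_ a′ a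

  -- The p-torsion is generated by ξ = p ^ k w. A multiple of w is subtracted from x to lower its
  -- order, and the induction continues with p w in place of w.
  generates : ∀ k {w x} → M w → M x → ι (p ^ℕ k) * w ≈ ξ → ι (p ^ℕ suc k) * x ≈ 0# → ∃[ j ] x ≈ ι j * w
  generates zero    {w} {x} w∈M x∈M pw px = proj₁ j , trans (proj₂ j) (*-congˡ (sym (trans (sym (trans (*-congʳ ι-1) (*-identityˡ w))) pw)))
    where
    j = p-torsion x∈M (trans (*-congʳ (ι-cong (≡.sym (ℕ.*-identityʳ p)))) px)
  generates (suc k) {w} {x} w∈M x∈M pw px = proj₁ j +ℕ proj₁ i *ℕ p , (begin
    x                                       ≈⟨ solve 2 (λ x y → x := y :+ (x :- y)) refl x (ι (proj₁ j) * w) ⟩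
    ι (proj₁ j) * w + (x - ι (proj₁ j) * w) ≈⟨ +-congˡ (proj₂ i) ⟩
    ι (proj₁ j) * w + ι (proj₁ i) * (ι p * w)
      ≈⟨ linear₂ (- w) (ι-+ (proj₁ j) (proj₁ i *ℕ p)) (- w) (ι-* (proj₁ i) p)
           (solve 6 (λ j w i p t k → j :* w :+ i :* (p :* w) :+ (:- w) :* (j :+ k) :+ (:- w) :* (i :* p) := t :* w :+ (:- w) :* t :+ (:- w) :* k)
             refl (ι (proj₁ j)) w (ι (proj₁ i)) (ι p) (ι (proj₁ j +ℕ proj₁ i *ℕ p)) (ι (proj₁ i *ℕ p))) ⟩
    ι (proj₁ j +ℕ proj₁ i *ℕ p) * w         ∎)
    where
    split : ∀ k → ι (p ^ℕ suc k) ≈ ι p * ι (p ^ℕ k)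
    split k = ι-* p (p ^ℕ k)
    j : ∃[ j ] ι (p ^ℕ suc k) * x ≈ ι j * ξ
    j = p-torsion (*-closed _ x∈M) (trans (sym (*-assoc _ _ _)) (trans (*-congʳ (sym (split (suc k)))) px))
    difference : Carrier
    difference = x - ι (proj₁ j) * w
    killed : ι (p ^ℕ suc k) * difference ≈ 0#
    killed = linear₂ 1# (proj₂ j) (- ι (proj₁ j)) pw
      (solve 5 (λ q x j w ξ → q :* (x :- j :* w) :+ :1 :* (j :* ξ) :+ (:- j) :* ξ := con ℤ.0ℤ :+ :1 :* (q :* x) :+ (:- j) :* (q :* w))
        refl (ι (p ^ℕ suc k)) x (ι (proj₁ j)) w ξ)
    i : ∃[ i ] difference ≈ ι i * (ι p * w)
    i = generates k (*-closed _ w∈M) (resp (+-congˡ (solve 2 (λ j w → (:- j) :* w := :- (j :* w)) refl _ _)) (+-closed x∈M (*-closed _ w∈M)))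
      (trans (solve 3 (λ q p w → q :* (p :* w) := p :* q :* w) refl (ι (p ^ℕ k)) (ι p) w) (trans (*-congʳ (sym (split k))) pw)) killed

  torsion-coprime : ∀ {j x} → ¬ p ∣ j → ι p * x ≈ 0# → ι j * x ≈ 0# → x ≈ 0#
  torsion-coprime {j} {x} p∤j px jx = linear₄ (- x) (proj₂ (proj₂ inverse)) z jx (- (t * x)) (ι-cong (ℕ.*-identityʳ p)) (- t) px
    (solve 6 (λ x z j t q p → x :+ (:- x) :* (:1 :+ t :* q) :+ z :* con ℤ.0ℤ :+ (:- (t :* x)) :* p :+ (:- t) :* con ℤ.0ℤ
      := con ℤ.0ℤ :+ (:- x) :* (z :* j) :+ z :* (j :* x) :+ (:- (t :* x)) :* q :+ (:- t) :* (p :* x))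
     refl x z (ι j) t (ι (p ^ℕ 1)) (ι p))
    where
    inverse = ι-inverse p∤j 1
    z = proj₁ inverse
    t = proj₁ (proj₂ inverse)

  order-step : ∀ k {w j} → ι (p ^ℕ k) * w ≈ ξ → ι j * w ≈ 0# → p ^ℕ k ∣ j → p ^ℕ suc k ∣ j
  order-step k {w} pw jw (divides i ≡.refl) with p ∣? i
  ... | yes p∣i = ∣.*-monoˡ-∣ (p ^ℕ k) p∣i
  ... | no  p∤i = contradiction (torsion-coprime p∤i pξ (linear₃ (- ι i) pw 1# jw (- w) (ι-* i (p ^ℕ k))
      (solve 5 (λ i ξ q w j → i :* ξ :+ (:- i) :* ξ :+ :1 :* con ℤ.0ℤ :+ (:- w) :* (i :* q)
        := con ℤ.0ℤ :+ (:- i) :* (q :* w) :+ :1 :* (j :* w) :+ (:- w) :* j) refl (ι i) ξ (ι (p ^ℕ k)) w (ι (i *ℕ p ^ℕ k))))) ξ≉0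

  order : ∀ k {w j} → ι (p ^ℕ k) * w ≈ ξ → ι j * w ≈ 0# → p ^ℕ suc k ∣ j
  order zero    {w} {j} pw jw = order-step 0 pw jw (∣.1∣ j)
  order (suc k) {w} {j} pw jw = order-step (suc k) pw jw (order k
    (trans (solve 3 (λ q p w → q :* (p :* w) := p :* q :* w) refl (ι (p ^ℕ k)) (ι p) w) (trans (*-congʳ (sym (ι-* p (p ^ℕ k)))) pw))
    (trans (solve 3 (λ q p w → q :* (p :* w) := p :* (q :* w)) refl (ι j) (ι p) w) (trans (*-congˡ jw) (zeroʳ (ι p)))))

  -- Fails only for p = 2, n = 1 and level 0 in the first slot.
  Good : ∀ {m} → Vec Index m → Set
  Good a = ∀ c → level a zero ≡ [ c ] → p ∣ p ^ℕ toℕ c *ℕ tri (p ^ℕ (n ∸ toℕ c))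

  module Analysis {m} (a : Vec Index m) (s : ℕ) (bottom : Below (level a zero)) (good : Good a) (ex : Exponent a s) where
    open Multiplier p s
    open Exponent ex

    r : ℕ
    r = ∣.quotient (proj₁ divides-e)

    r′ : Fin (suc m) → ℕ
    r′ i = ∣.quotient (proj₂ divides-e i)

    pE≡ : p *ℕ E P ≡ p ^ℕ suc e′ *ℕ r
    pE≡ = ≡.trans (∣._∣_.equality (proj₁ divides-e)) (ℕ.*-comm r _)

    power : d ^ℕ P ≡ 1 +ℕ p ^ℕ suc e′ *ℕ r
    power = ≡.trans (d^≡1+pE P) (≡.cong suc pE≡)

    levels : ∀ i → p ^ℕ toℕ i *ℕ q p d (level a i) ≡ p ^ℕ suc e′ *ℕ r′ i
    levels i = ≡.trans (∣._∣_.equality (proj₂ divides-e i)) (ℕ.*-comm (r′ i) _)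

    level-present : ∀ b → ¬ p ∣ r′ b → ∃[ c ] level a b ≡ [ c ]
    level-present b p∤ = present (level a b) (levels b) ≡.refl
      where
      present : ∀ l → p ^ℕ toℕ b *ℕ q p d l ≡ p ^ℕ suc e′ *ℕ r′ b → l ≡ level a b → ∃[ c ] level a b ≡ [ c ]
      present [ c ] hr l≡ = c , ≡.sym l≡
      present ⊥₋    hr l≡ = contradiction (≡.subst (p ∣_) (ℕ.*-cancelˡ-≡ 0 (r′ b) (p ^ℕ suc e′) ⦃ ℕ.m^n≢0 p (suc e′) ⦄
        (≡.trans (ℕ.*-zeroʳ (p ^ℕ suc e′)) (≡.trans (≡.sym (ℕ.*-zeroʳ (p ^ℕ toℕ b))) hr))) (p ∣.∣0)) p∤

    private
      raise : ∀ {x k} → x ≡ p ^ℕ suc e′ *ℕ k → p ∣ k → p ^ℕ suc (suc e′) ∣ x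
      raise {x} {k} eq p∣k = ≡.subst₂ _∣_ (ℕ.*-comm (p ^ℕ suc e′) p) (≡.sym eq) (∣.*-monoʳ-∣ (p ^ℕ suc e′) p∣k)

    some-unit : p ∣ r → ¬ (∀ i → p ∣ r′ i)
    some-unit p∣r p∣r′ = maximal (raise pE≡ p∣r , λ i → raise (levels i) (p∣r′ i))

    module _ {y x} (pair : IsPair a (ι s) y x) where

      D : Data C
      D = record
        { a = a ; s = s ; y = y ; x = x ; pair = pair ; bottom = bottom ; e′ = e′ ; r = r ; r′ = r′
        ; power = power ; levels = levels }

      private
        module T = Torsion C D
        module AL = AbsorbLevel C D

      root : Carrier
      root = T.root

      root∈M : M root
      root∈M = T.root∈M

      root-eigen : σ * root ≈ ι d * root
      root-eigen = T.root-eigen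

      root-order : ι (p ^ℕ e′) * root ≈ ξ
      root-order = T.root-order

      absorbed : ∃[ v ] Absorbed a e′ y v
      absorbed = cases (p ∣? r)
        where
        by-level : ∀ b → ¬ p ∣ r′ b → ∃[ c ] level a b ≡ [ c ] → ∃[ v ] Absorbed a e′ y v
        by-level b p∤ (c , level-b) = _ , AL.absorbed-by-level b c level-b p∤
          (λ b≡0 → good c (≡.trans (≡.cong (level a) (≡.sym (Fin.toℕ-injective b≡0))) level-b))
        cases : Dec (p ∣ r) → ∃[ v ] Absorbed a e′ y v
        cases (no  p∤r) = _ , T.absorbed-by-power p∤r
          (trans (N-σ-fixed P σξ) (pᵏξ P (≡.subst (λ k → p ∣ p ^ℕ k) (ℕ.suc-pred n ⦃ ℕ.>-nonZero 1≤n ⦄) (∣.m∣m*n (p ^ℕ ℕ.pred n)))))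
          where
          pᵏξ : ∀ k → p ∣ k → ι k * ξ ≈ 0#
          pᵏξ k (divides j k≡) = linear₂ ξ (trans (ι-cong k≡) (ι-* j p)) (ι j) pξ
            (solve 4 (λ k j p ξ → k :* ξ :+ ξ :* (j :* p) :+ j :* con ℤ.0ℤ := con ℤ.0ℤ :+ ξ :* k :+ j :* (p :* ξ)) refl (ι k) (ι j) (ι p) ξ)
        cases (yes p∣r) = let b , p∤ = Fin.¬∀⟶∃¬ (suc m) (λ i → p ∣ r′ i) (λ i → p ∣? r′ i) (some-unit p∣r) in
          by-level b p∤ (level-present b p∤)

  lookup-level : ∀ {m} (a : Vec Index m) b → lookup a b ≡ level a (inject₁ b)
  lookup-level (_ ∷ a) zero    = ≡.refl
  lookup-level (_ ∷ a) (suc b) = lookup-level a b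

  <ᴸ⇒<₋ : ∀ {l c} → l <ᴸ c → l <₋ [ c ]
  <ᴸ⇒<₋ absent    = ⊥₋<[ _ ]
  <ᴸ⇒<₋ (below h) = [ h ]

  lowered-< : ∀ {m} (a : Vec Index m) b {l c} → level a (inject₁ b) ≡ [ c ] → l <ᴸ c → Lex-< _≡_ _<₋_ (lowered a b l) a
  lowered-< (_ ∷ a) zero    ≡.refl l<c = this (<ᴸ⇒<₋ l<c) ≡.refl
  lowered-< (_ ∷ a) (suc b) eq     l<c = next ≡.refl (lowered-< a b eq l<c)

  lowered-below : ∀ {m} (a : Vec Index m) b {l c} → level a (inject₁ b) ≡ [ c ] → l <ᴸ c →
                  Below (level a zero) → Below (level (lowered a b l) zero)
  lowered-below (_ ∷ a) zero    ≡.refl (below c′<c) bot _ ≡.refl = ℕ.<-trans c′<c (bot _ ≡.refl)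
  lowered-below (_ ∷ a) (suc b) eq     l<c   bot = bot

  record Conclusion {m} (a : Vec Index m) (s : ℕ) : Set (a₀ ⊔ ℓ ⊔ ρ) where
    field
      e′         : ℕ
      e≤m        : suc e′ ≤ m
      root       : Carrier
      root∈M     : M root
      root-order : ι (p ^ℕ e′) * root ≈ ξ
      root-eigen : σ * root ≈ ι (suc (p *ℕ s)) * root
      indivisible : suc e′ < m → ∀ {η} → M η → ¬ ι p * η ≈ root
      shifts     : ∀ {S₁} ε → S₁ ≈ ι s + ε * ι (p ^ℕ e′) → HasPair a S₁

  conclusion : ∀ {m} (a : Vec Index (suc m)) s → Below (level a zero) → Good a → Minimal a → HasPair a (ι s) → Conclusion a s
  conclusion {m} a s bot good minimal (y , x , pair) = record
    { e′ = e′ ; e≤m = divides-bound a s divides-e ; root = A.root pair ; root∈M = A.root∈M pair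
    ; root-order = A.root-order pair ; root-eigen = A.root-eigen pair ; indivisible = indivisible ; shifts = shifts }
    where
    ex = exponent a s bot
    open Exponent ex
    module A = Analysis a s bot good ex

    shifts : ∀ {S₁} ε → S₁ ≈ ι s + ε * ι (p ^ℕ e′) → HasPair a S₁
    shifts ε S₁≈ = y , shift ε pair (proj₂ (A.absorbed pair)) S₁≈

    indivisible : suc e′ < suc m → ∀ {η} → M η → ¬ ι p * η ≈ A.root pair
    indivisible e<m {η} η∈M pη = minimal (lowered a b′ l) s̃ lowered-pair
        (lowered-below a b′ level-b l<c bot) (lowered-< a b′ level-b l<c)
      where
      d = suc (p *ℕ s)

      η-order : ι (p ^ℕ suc e′) * η ≈ ξ
      η-order = trans (*-congʳ (trans (ι-* p (p ^ℕ e′)) (*-comm _ _))) (trans (*-assoc _ _ _) (trans (*-congˡ pη) (A.root-order pair)))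

      defect : ∃[ j ] (σ - ι d) * η ≈ ι j * ξ
      defect = p-torsion (*-closed _ η∈M) (linear₃ (σ - ι d) pη 1# (A.root-eigen pair) 0# refl
        (solve 6 (λ p σ d η w o → p :* ((σ :- d) :* η) :+ (σ :- d) :* w :+ :1 :* (d :* w) :+ con ℤ.0ℤ :* o
          := con ℤ.0ℤ :+ (σ :- d) :* (p :* η) :+ :1 :* (σ :* w) :+ con ℤ.0ℤ :* o) refl (ι p) σ (ι d) η (A.root pair) 0#))

      -- The element (σ - d) η is killed by p, hence equals j ξ = j p ^ e η. So d + p ^ e j acts on
      -- η as σ does, and s has to grow by p ^ (e - 1) j.
      j s̃ d̃ : ℕ
      j = proj₁ defect
      s̃ = s +ℕ p ^ℕ e′ *ℕ j
      d̃ = suc (p *ℕ s̃)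

      ι-s̃ : ι s̃ ≈ ι s + ι j * ι (p ^ℕ e′)
      ι-s̃ = trans (ι-+ s _) (+-congˡ (trans (ι-* (p ^ℕ e′) j) (*-comm _ _)))

      ι-d̃ : ι d̃ ≈ ι d + ι j * ι (p ^ℕ suc e′)
      ι-d̃ = trans (ι-cong (≡.trans (≡.cong suc (≡.trans (ℕ.*-distribˡ-+ p s _) (≡.cong (p *ℕ s +ℕ_) (≡.sym (ℕ.*-assoc p (p ^ℕ e′) j))))) ≡.refl))
        (trans (ι-+ d (p ^ℕ suc e′ *ℕ j)) (+-congˡ (trans (ι-* (p ^ℕ suc e′) j) (*-comm _ _))))

      ση : σ * η ≈ ι d̃ * η
      ση = linear₃ 1# (proj₂ defect) (- η) ι-d̃ (- ι j) η-order
        (solve 7 (λ σ η d d̃ j ξ q → σ :* η :+ :1 :* (j :* ξ) :+ (:- η) :* (d :+ j :* q) :+ (:- j) :* ξ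
          := d̃ :* η :+ :1 :* ((σ :- d) :* η) :+ (:- η) :* d̃ :+ (:- j) :* (q :* η)) refl σ η (ι d) (ι d̃) (ι j) ξ (ι (p ^ℕ suc e′)))

      ex̃ : Exponent a s̃
      ex̃ = stable a s e′ j good ex ≡.refl

      module Ã = Analysis a s̃ bot good ex̃
      module Mult = Multiplier p s̃

      σ^η : ∀ k → σ ^ k * η ≈ ι (d̃ ^ℕ k) * η
      σ^η zero    = *-congʳ (sym ι-1)
      σ^η (suc k) = trans (*-assoc σ (σ ^ k) η) (trans (*-congˡ (σ^η k)) (linear₂ (ι (d̃ ^ℕ k)) ση (- η) (ι-* d̃ (d̃ ^ℕ k))
        (solve 5 (λ σ η D d̃ t → σ :* (D :* η) :+ D :* (d̃ :* η) :+ (:- η) :* (d̃ :* D) := t :* η :+ D :* (σ :* η) :+ (:- η) :* t)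
          refl σ η (ι (d̃ ^ℕ k)) (ι d̃) (ι (d̃ *ℕ d̃ ^ℕ k)))))

      -- The number d̃ ^ P acts on η as σ ^ P = 1, and η has order p ^ (e + 1). As e is unchanged, p
      -- divides the new r, so some slot must have a coefficient prime to p.
      p^∣pE : p ^ℕ suc (suc e′) ∣ p *ℕ Mult.E P
      p^∣pE = order (suc e′) η-order (linear₄ 1# (sym (σ^η P)) 1# (σ-order η∈M) (- η) (trans (ι-cong (Mult.d^≡1+pE P)) (ι-suc _)) 0# refl
        (solve 6 (λ D η u t o z → t :* η :+ :1 :* (u :* η) :+ :1 :* η :+ (:- η) :* (:1 :+ t) :+ con ℤ.0ℤ :* o
          := con ℤ.0ℤ :+ :1 :* (D :* η) :+ :1 :* (u :* η) :+ (:- η) :* D :+ con ℤ.0ℤ :* o) refl (ι (d̃ ^ℕ P)) η (σ ^ P) (ι (p *ℕ Mult.E P)) 0# 0#))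

      p∣r : p ∣ Ã.r
      p∣r = ∣.*-cancelˡ-∣ (p ^ℕ suc e′) ⦃ ℕ.m^n≢0 p (suc e′) ⦄
        (≡.subst₂ _∣_ (ℕ.*-comm p (p ^ℕ suc e′)) Ã.pE≡ p^∣pE)

      r₁ : ℕ
      r₁ = ∣.quotient p∣r

      r≡ : Ã.r ≡ p *ℕ r₁
      r≡ = ≡.trans (∣._∣_.equality p∣r) (ℕ.*-comm r₁ p)

      pairs : ∃[ x̃ ] IsPair a (ι s̃) y x̃
      pairs = shift (ι j) pair (proj₂ (A.absorbed pair)) ι-s̃

      w̃ : Carrier
      w̃ = Ã.root (proj₂ pairs)

      w̃∈M : M w̃
      w̃∈M = Ã.root∈M (proj₂ pairs)

      w̃-order : ι (p ^ℕ e′) * w̃ ≈ ξ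
      w̃-order = Ã.root-order (proj₂ pairs)

      -- The shifted pair has a root of its own, for which η need not be a p-th part. Both roots
      -- generate the same cyclic group, so a multiple of η serves.
      multiple : ∃[ k ] w̃ ≈ ι k * A.root pair
      multiple = generates e′ (A.root∈M pair) w̃∈M (A.root-order pair)
        (trans (*-congʳ (ι-* p (p ^ℕ e′))) (trans (*-assoc _ _ _) (trans (*-congˡ w̃-order) pξ)))

      η̃ : Carrier
      η̃ = ι (proj₁ multiple) * η

      pη̃ : ι p * η̃ ≈ w̃
      pη̃ = trans (solve 3 (λ p k η → p :* (k :* η) := k :* (p :* η)) refl (ι p) (ι (proj₁ multiple)) η)
        (trans (*-congˡ pη) (sym (proj₂ multiple)))

      ση̃ : σ * η̃ ≈ ι d̃ * η̃
      ση̃ = trans (solve 3 (λ p k η → p :* (k :* η) := k :* (p :* η)) refl σ (ι (proj₁ multiple)) η)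
        (trans (*-congˡ ση) (solve 3 (λ p k η → k :* (p :* η) := p :* (k :* η)) refl (ι d̃) (ι (proj₁ multiple)) η))

      smallest = Fin.¬∀⟶∃¬-smallest (suc (suc m)) (λ i → p ∣ Ã.r′ i) (λ i → p ∣? Ã.r′ i) (Ã.some-unit p∣r)

      b : Fin (suc (suc m))
      b = proj₁ smallest

      -- In the last slot q = 1, so its coefficient is a power of p, with positive exponent because
      -- e is less than the length. The first slot with a coefficient prime to p is therefore not
      -- the last one, and slot b + 1 exists.
      p∣top : p ∣ Ã.r′ (fromℕ (suc m))
      p∣top = divides (p ^ℕ (suc m ∸ suc (suc e′))) (ℕ.*-cancelˡ-≡ _ _ (p ^ℕ suc e′) ⦃ ℕ.m^n≢0 p (suc e′) ⦄
        (≡.trans (≡.sym (Ã.levels (fromℕ (suc m)))) (≡.trans (≡.cong₂ (λ k l → p ^ℕ k *ℕ l) (Fin.toℕ-fromℕ (suc m)) (q-top a d̃))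
          (≡.trans (ℕ.*-identityʳ _) (≡.trans (p^-split p e<m) (swap (p ^ℕ (suc m ∸ suc (suc e′))) p (p ^ℕ suc e′)))))))
        where
        open +-*-Solver using () renaming (solve to solve′; _:*_ to _⊗_; _:=_ to _⊜_)
        swap : ∀ k p q → k *ℕ (p *ℕ q) ≡ q *ℕ (k *ℕ p)
        swap = solve′ 3 (λ k p q → k ⊗ (p ⊗ q) ⊜ q ⊗ (k ⊗ p)) ≡.refl

      b≢top : ¬ suc m ≡ toℕ b
      b≢top eq = proj₁ (proj₂ smallest) (≡.subst (λ i → p ∣ Ã.r′ i)
        (Fin.toℕ-injective (≡.trans (Fin.toℕ-fromℕ (suc m)) eq)) p∣top)

      b′ : Fin (suc m)
      b′ = lower₁ b b≢top

      b≡ : inject₁ b′ ≡ b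
      b≡ = Fin.inject₁-lower₁ b b≢top

      p∤u : ¬ p ∣ Ã.r′ (inject₁ b′)
      p∤u = ≡.subst (λ i → ¬ p ∣ Ã.r′ i) (≡.sym b≡) (proj₁ (proj₂ smallest))

      smaller : ∀ i → toℕ i < toℕ (inject₁ b′) → p ∣ Ã.r′ i
      smaller i i<b = ≡.subst (λ i → p ∣ Ã.r′ i) (Fin.toℕ-injective (≡.trans (Fin.toℕ-inject (Fin.fromℕ< i<b″)) (Fin.toℕ-fromℕ< i<b″)))
        (proj₂ (proj₂ smallest) (Fin.fromℕ< i<b″))
        where
        i<b″ : toℕ i < toℕ b
        i<b″ = ≡.subst (λ b → toℕ i < toℕ b) b≡ i<b

      c : Fin (suc n)
      c = proj₁ (Ã.level-present (inject₁ b′) p∤u)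

      level-b : level a (inject₁ b′) ≡ [ c ]
      level-b = proj₂ (Ã.level-present (inject₁ b′) p∤u)

      lowering = lower-level record
        { D = Ã.D (proj₂ pairs) ; r₁ = r₁ ; r≡ = r≡ ; b′ = b′ ; c = c ; level-b = level-b ; p∤u = p∤u
        ; smaller = smaller ; η = η̃ ; η∈M = *-closed _ η∈M ; pη = pη̃ ; ση = ση̃ }

      l : Index
      l = proj₁ lowering

      l<c : l <ᴸ c
      l<c = proj₁ (proj₂ lowering)

      lowered-pair : HasPair (lowered a b′ l) (ι s̃)
      lowered-pair = proj₂ (proj₂ lowering)

-- Linear systems, independence of characters and roots of unity.

module LinearAlgebra {c ℓ₁ ℓ₂} s (em : ExcludedMiddle (c ⊔ ℓ₁ ⊔ ℓ₂ ⊔ s)) (K : HeytingField c ℓ₁ ℓ₂) where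

  private module H = HeytingField K
  open Geometric (FieldOps.commutativeRing K) public
  open import Relation.Binary.Reasoning.Setoid setoid

  infix 4 _≈?_
  _≈?_ : ∀ x y → Dec (x ≈ y)
  x ≈? y = map′ Level.lower lift (em {Lift (c ⊔ ℓ₂ ⊔ s) (x ≈ y)})

  1≉0 : ¬ 1# ≈ 0#
  1≉0 1≈0 = H.#-irrefl 1≈0 (H.invertible⇒# (1# , trans (*-identityˡ _) one , trans (*-identityʳ _) one))
    where
    one : 1# - 0# ≈ 1#
    one = solve 0 (:1 :- con ℤ.0ℤ := :1) refl

  recip : ∀ {x} → ¬ x ≈ 0# → ∃[ y ] x * y ≈ 1#
  recip {x} x≉0 with em {Lift (c ⊔ ℓ₁ ⊔ s) (H._#_ x 0#)}
  ... | no  ¬x#0 = contradiction (proj₁ (H.tight x 0#) (λ h → ¬x#0 (lift h))) x≉0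
  ... | yes (lift x#0) = let y , yx , xy = H.#⇒invertible x#0 in
    y , trans (solve 2 (λ x y → x :* y := (x :- con ℤ.0ℤ) :* y) refl x y) xy

  *-cancel-0 : ∀ {x y} → ¬ x ≈ 0# → x * y ≈ 0# → y ≈ 0#
  *-cancel-0 {x} {y} x≉0 xy≈0 = let x⁻¹ , xx⁻¹ = recip x≉0 in
    linear₂ (- y) xx⁻¹ x⁻¹ xy≈0
      (solve 3 (λ x y z → y :+ (:- y) :* :1 :+ z :* con ℤ.0ℤ := con ℤ.0ℤ :+ (:- y) :* (x :* z) :+ z :* (x :* y)) refl x y x⁻¹)

  Nontrivial : ∀ {d} → (Fin d → Carrier) → Set ℓ₁
  Nontrivial x = ∃[ j ] ¬ x j ≈ 0#

  underdetermined : ∀ {r d} → r < d → (A : Fin r → Fin d → Carrier) →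
                    ∃[ x ] Nontrivial x × (∀ i → ∑ (λ j → A i j * x j) ≈ 0#)
  underdetermined {zero}  {suc d} _ A = (λ _ → 1#) , (zero , 1≉0) , λ ()
  underdetermined {suc r} {suc d} (s≤s r<d) A = cases (Fin.any? (λ i → ¬? (A i zero ≈? 0#)))
    where
    Goal = ∃[ x ] Nontrivial x × (∀ i → ∑ (λ j → A i j * x j) ≈ 0#)
    pivot : ∀ i → ¬ A i zero ≈ 0# → Goal
    pivot i₀ a≉0 = x , (suc (proj₁ nontrivial) , proj₂ nontrivial) , equation
      where
      a⁻¹ : Carrier
      a⁻¹ = proj₁ (recip a≉0)
      aa⁻¹ : A i₀ zero * a⁻¹ ≈ 1#
      aa⁻¹ = proj₂ (recip a≉0)
      B : Fin r → Fin d → Carrier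
      B i j = A (punchIn i₀ i) (suc j) - A (punchIn i₀ i) zero * (a⁻¹ * A i₀ (suc j))
      solution = underdetermined r<d B
      x′ = proj₁ solution
      nontrivial = proj₁ (proj₂ solution)
      row₀ : Carrier
      row₀ = ∑ (λ j → A i₀ (suc j) * x′ j)
      x : Fin (suc d) → Carrier
      x zero    = - (a⁻¹ * row₀)
      x (suc j) = x′ j
      row : Fin (suc r) → Carrier
      row i = ∑ (λ j → A i (suc j) * x′ j)
      reduced : ∀ i → row (punchIn i₀ i) - A (punchIn i₀ i) zero * (a⁻¹ * row₀) ≈ 0#
      reduced i = begin
        row i′ - A i′ zero * (a⁻¹ * row₀)
          ≈⟨ solve 4 (λ r a b s → r :- a :* (b :* s) := r :+ (:- (a :* b)) :* s) refl (row i′) (A i′ zero) a⁻¹ row₀ ⟩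
        row i′ + - (A i′ zero * a⁻¹) * row₀
          ≈⟨ +-congˡ (∑-* (- (A i′ zero * a⁻¹)) (λ j → A i₀ (suc j) * x′ j)) ⟨
        row i′ + ∑ (λ j → - (A i′ zero * a⁻¹) * (A i₀ (suc j) * x′ j))
          ≈⟨ ∑-+ (λ j → A i′ (suc j) * x′ j) (λ j → - (A i′ zero * a⁻¹) * (A i₀ (suc j) * x′ j)) ⟨
        ∑ (λ j → A i′ (suc j) * x′ j + - (A i′ zero * a⁻¹) * (A i₀ (suc j) * x′ j))
          ≈⟨ ∑-cong (λ j → solve 5 (λ p a b q x → p :* x :+ (:- (a :* b)) :* (q :* x) := (p :- a :* (b :* q)) :* x) refl
               (A i′ (suc j)) (A i′ zero) a⁻¹ (A i₀ (suc j)) (x′ j)) ⟩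
        ∑ (λ j → B i j * x′ j)
          ≈⟨ proj₂ (proj₂ solution) i ⟩
        0# ∎
        where i′ = punchIn i₀ i
      full : ∀ i → A i zero * x zero + row i ≈ 0# → ∑ (λ j → A i j * x j) ≈ 0#
      full i h = trans (∑-suc (λ j → A i j * x j)) h
      equation : ∀ i → ∑ (λ j → A i j * x j) ≈ 0#
      equation i with i Fin.≟ i₀
      ... | yes ≡.refl = full i (linear₁ (- row₀) aa⁻¹ (solve 3 (λ a b r → a :* (:- (b :* r)) :+ r :+ (:- r) :* :1
              := con ℤ.0ℤ :+ (:- r) :* (a :* b)) refl (A i zero) a⁻¹ row₀))
      ... | no i≢i₀ = full i (≡.subst (λ i → A i zero * x zero + row i ≈ 0#) (Fin.punchIn-punchOut (i≢i₀ ∘ ≡.sym))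
              (trans (solve 4 (λ a b r s → a :* (:- (b :* s)) :+ r := r :- a :* (b :* s)) refl
                 (A (punchIn i₀ k) zero) a⁻¹ (row (punchIn i₀ k)) row₀) (reduced k)))
        where k = punchOut (i≢i₀ ∘ ≡.sym)
    cases : Dec (∃[ i ] ¬ A i zero ≈ 0#) → Goal
    cases (yes (i₀ , a≉0)) = pivot i₀ a≉0
    cases (no none) = x , (zero , 1≉0) , λ i → trans (∑-suc (λ j → A i j * x j))
      (trans (+-cong (trans (*-congʳ (decidable-stable (A i zero ≈? 0#) (λ h → none (i , h)))) (zeroˡ 1#)) (∑-zero (λ j → zeroʳ _))) (+-identityˡ 0#))
      where
      x : Fin (suc d) → Carrier
      x zero    = 1#
      x (suc j) = 0#

  -- The relation translated by b minus χ zero b times the relation no longer contains the first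
  -- character. The general operation allows characters of ℕ, of K and of the intermediate fields
  -- alike.
  dedekind : ∀ {t} {T : Set t} (_·_ : T → T → T) (e : T) {k} (χ : Fin k → T → Carrier) →
             (∀ j a b → χ j (a · b) ≈ χ j a * χ j b) → (∀ j → χ j e ≈ 1#) →
             (∀ i j → ¬ i ≡ j → ∃[ a ] ¬ χ i a ≈ χ j a) →
             (x : Fin k → Carrier) → (∀ a → ∑ (λ j → x j * χ j a) ≈ 0#) → ∀ j → x j ≈ 0#
  dedekind _·_ e {suc k} χ χ-· χ-e distinct x relation = λ { zero → head≈0 ; (suc j) → tail≈0 j }
    where
    tail : ∀ b j → x (suc j) * (χ (suc j) b - χ zero b) ≈ 0#
    tail b = dedekind _·_ e (χ ∘ suc) (χ-· ∘ suc) (χ-e ∘ suc)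
      (λ i j i≢j → distinct (suc i) (suc j) (i≢j ∘ Fin.suc-injective))
      (λ j → x (suc j) * (χ (suc j) b - χ zero b)) λ a → begin
        ∑ (λ j → x (suc j) * (χ (suc j) b - χ zero b) * χ (suc j) a)
          ≈⟨ ∑-cong (λ j → linear₁ (- x (suc j)) (χ-· (suc j) b a) (solve 5 (λ x u v w z →
               x :* (u :- v) :* w :+ (:- x) :* (u :* w) := x :* z :+ (:- v) :* (x :* w) :+ (:- x) :* z) refl
               (x (suc j)) (χ (suc j) b) (χ zero b) (χ (suc j) a) (χ (suc j) (b · a)))) ⟩
        ∑ (λ j → x (suc j) * χ (suc j) (b · a) + - χ zero b * (x (suc j) * χ (suc j) a))
          ≈⟨ trans (∑-+ (λ j → x (suc j) * χ (suc j) (b · a)) (λ j → - χ zero b * (x (suc j) * χ (suc j) a))) (+-congˡ (∑-* _ _)) ⟩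
        ∑ (λ j → x (suc j) * χ (suc j) (b · a)) + - χ zero b * ∑ (λ j → x (suc j) * χ (suc j) a)
          ≈⟨ linear₃ 1# (trans (sym (∑-suc (λ j → x j * χ j (b · a)))) (relation (b · a)))
               (- χ zero b) (trans (sym (∑-suc (λ j → x j * χ j a))) (relation a)) (- x zero) (χ-· zero b a)
             (solve 6 (λ x₀ u v z S T → S :+ (:- u) :* T :+ :1 :* con ℤ.0ℤ :+ (:- u) :* con ℤ.0ℤ :+ (:- x₀) :* (u :* v)
               := con ℤ.0ℤ :+ :1 :* (x₀ :* z :+ S) :+ (:- u) :* (x₀ :* v :+ T) :+ (:- x₀) :* z) refl
              (x zero) (χ zero b) (χ zero a) (χ zero (b · a)) (∑ (λ j → x (suc j) * χ (suc j) (b · a))) (∑ (λ j → x (suc j) * χ (suc j) a))) ⟩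
        0# ∎
    tail≈0 : ∀ j → x (suc j) ≈ 0#
    tail≈0 j = let b , χ≉ = distinct (suc j) zero λ () in
      *-cancel-0 (λ h → χ≉ (linear₁ 1# h (solve 2 (λ u v → u :+ :1 :* con ℤ.0ℤ := v :+ :1 :* (u :- v)) refl _ _)))
        (trans (*-comm _ _) (tail b j))
    head≈0 : x zero ≈ 0#
    head≈0 = linear₃ 1# (trans (sym (∑-suc (λ j → x j * χ j e))) (relation e)) (- x zero) (χ-e zero)
      (- 1#) (∑-zero (λ j → trans (*-congʳ (tail≈0 j)) (zeroˡ _)))
      (solve 3 (λ x u S → x :+ :1 :* con ℤ.0ℤ :+ (:- x) :* :1 :+ (:- :1) :* con ℤ.0ℤ
        := con ℤ.0ℤ :+ :1 :* (x :* u :+ S) :+ (:- x) :* u :+ (:- :1) :* S) refl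
       (x zero) (χ zero e) (∑ (λ j → x (suc j) * χ (suc j) e)))

  ^-one : ∀ k → 1# ^ k ≈ 1#
  ^-one zero    = refl
  ^-one (suc k) = trans (*-identityˡ _) (^-one k)

  ^-periodic : ∀ {x} r .{{_ : NonZero r}} → x ^ r ≈ 1# → ∀ i → x ^ i ≈ x ^ (i ℕ.% r)
  ^-periodic {x} r xʳ i = begin
    x ^ i                                   ≡⟨ ≡.cong (x ^_) (ℕ.m≡m%n+[m/n]*n i r) ⟩
    x ^ (i ℕ.% r +ℕ (i ℕ./ r) *ℕ r)         ≈⟨ ^-homo-* x (i ℕ.% r) _ ⟩
    x ^ (i ℕ.% r) * x ^ ((i ℕ./ r) *ℕ r)    ≈⟨ *-congˡ (trans (^-swap x (i ℕ./ r) r) (trans (^-congˡ (i ℕ./ r) xʳ) (^-one (i ℕ./ r)))) ⟩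
    x ^ (i ℕ.% r) * 1#                      ≈⟨ *-identityʳ _ ⟩
    x ^ (i ℕ.% r)                           ∎

  -- A further root of X ^ r - 1 would give r + 1 distinct characters of ℕ factoring through ℕ / r.
  roots-of-unity : ∀ r .{{_ : NonZero r}} {ζ} → FieldOps.IsPrimitiveRoot K r ζ → ∀ {x} → x ^ r ≈ 1# → ∃[ j ] x ≈ ζ ^ j
  roots-of-unity r {ζ} (ζʳ , minimal) {x} xʳ with Fin.any? (λ (j : Fin r) → x ≈? ζ ^ toℕ j)
  ... | yes (j , eq) = toℕ j , eq
  ... | no  none = contradiction (independent (proj₁ (proj₁ (proj₂ dependence)))) (proj₂ (proj₁ (proj₂ dependence)))
    where
    root : Fin (suc r) → Carrier
    root zero    = x
    root (suc j) = ζ ^ toℕ j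
    root-r : ∀ j → root j ^ r ≈ 1#
    root-r zero    = xʳ
    root-r (suc j) = trans (^-assocʳ ζ (toℕ j) r) (trans (^-swap ζ (toℕ j) r) (trans (^-congˡ (toℕ j) ζʳ) (^-one (toℕ j))))
    ζ^-distinct : ∀ {i j} → i < j → j < r → ¬ ζ ^ i ≈ ζ ^ j
    ζ^-distinct {i} {j} i<j j<r eq = contradiction (∣.∣⇒≤ ⦃ ℕ.>-nonZero (ℕ.m<n⇒0<n∸m i<j) ⦄ (minimal (j ∸ i) power))
      (ℕ.<⇒≱ (ℕ.≤-<-trans (ℕ.m∸n≤m j i) j<r))
      where
      i≤r : i ≤ r
      i≤r = ℕ.<⇒≤ (ℕ.<-trans i<j j<r)
      inverse : ζ ^ (r ∸ i) * ζ ^ i ≈ 1#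
      inverse = trans (sym (^-homo-* ζ (r ∸ i) i)) (trans (reflexive (≡.cong (ζ ^_) (ℕ.m∸n+n≡m i≤r))) ζʳ)
      power : ζ ^ (j ∸ i) ≈ 1#
      power = linear₄ (- (ζ ^ (j ∸ i))) inverse (- (ζ ^ (r ∸ i))) eq 1# inverse
        (ζ ^ (r ∸ i)) (trans (sym (^-homo-* ζ (j ∸ i) i)) (reflexive (≡.cong (ζ ^_) (ℕ.m∸n+n≡m (ℕ.<⇒≤ i<j)))))
        (solve 4 (λ d k u v → d :+ (:- d) :* :1 :+ (:- k) :* v :+ :1 :* :1 :+ k :* v
          := :1 :+ (:- d) :* (k :* u) :+ (:- k) :* u :+ :1 :* (k :* u) :+ k :* (d :* u)) refl
          (ζ ^ (j ∸ i)) (ζ ^ (r ∸ i)) (ζ ^ i) (ζ ^ j))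
    distinct : ∀ i j → ¬ i ≡ j → ∃[ a ] ¬ root i ^ a ≈ root j ^ a
    distinct i j i≢j = 1 , λ eq → base i j i≢j (trans (sym (*-identityʳ _)) (trans eq (*-identityʳ _)))
      where
      base : ∀ i j → ¬ i ≡ j → ¬ root i ≈ root j
      base zero    zero    i≢j = contradiction ≡.refl i≢j
      base zero    (suc j) i≢j eq = none (j , eq)
      base (suc i) zero    i≢j eq = none (i , sym eq)
      base (suc i) (suc j) i≢j eq with ℕ.<-cmp (toℕ i) (toℕ j)
      ... | tri< i<j _ _ = ζ^-distinct i<j (Fin.toℕ<n j) eq
      ... | tri≈ _ i≡j _ = i≢j (≡.cong suc (Fin.toℕ-injective i≡j))
      ... | tri> _ _ j<i = ζ^-distinct j<i (Fin.toℕ<n i) (sym eq)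
    dependence = underdetermined (ℕ.n<1+n r) (λ i j → root j ^ toℕ i)
    y = proj₁ dependence
    independent : ∀ j → y j ≈ 0#
    independent = dedekind _+ℕ_ 0 (λ j i → root j ^ i) (λ j → ^-homo-* (root j)) (λ _ → refl) distinct y λ i → begin
      ∑ (λ j → y j * root j ^ i)
        ≈⟨ ∑-cong (λ j → trans (*-comm _ _) (*-congʳ (trans (^-periodic r (root-r j) i)
             (reflexive (≡.cong (root j ^_) (≡.sym (Fin.toℕ-fromℕ< (ℕ.m%n<n i r)))))))) ⟩
      ∑ (λ j → root j ^ toℕ (fromℕ< (ℕ.m%n<n i r)) * y j)
        ≈⟨ proj₂ (proj₂ dependence) (fromℕ< (ℕ.m%n<n i r)) ⟩
      0# ∎

  ^-^ : ∀ x j k → (x ^ j) ^ k ≈ x ^ (k *ℕ j)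
  ^-^ x j k = trans (^-assocʳ x j k) (reflexive (≡.cong (x ^_) (ℕ.*-comm j k)))

  ^-product : ∀ x y k → (x * y) ^ k ≈ x ^ k * y ^ k
  ^-product x y zero    = sym (*-identityˡ 1#)
  ^-product x y (suc k) = trans (*-congˡ (^-product x y k))
    (solve 4 (λ x y u v → x :* y :* (u :* v) := x :* u :* (y :* v)) refl x y (x ^ k) (y ^ k))

  -- Since z ^ (p ^ k) is a p-th root of unity, it equals (w ^ j) ^ (p ^ k) for some j. Dividing z
  -- by w ^ j lowers its order, and the induction proceeds with w ^ p. The inverse of w ^ j is
  -- written as a power of w with natural exponent.
  prime-power-roots : ∀ p .{{_ : NonZero p}} {ζ} → FieldOps.IsPrimitiveRoot K p ζ → ∀ k {w z} →
                      w ^ (p ^ℕ k) ≈ ζ → z ^ (p ^ℕ suc k) ≈ 1# → ∃[ j ] z ≈ w ^ j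
  prime-power-roots p {ζ} ζ-root zero {w} {z} wζ z1 = proj₁ found , trans (proj₂ found) (^-congˡ (proj₁ found) (trans (sym wζ) (*-identityʳ w)))
    where
    found = roots-of-unity p ζ-root (trans (reflexive (≡.cong (z ^_) (≡.sym (ℕ.*-identityʳ p)))) z1)
  prime-power-roots p {ζ} ζ-root (suc k) {w} {z} wζ z1 = p *ℕ proj₁ rest +ℕ j , (begin
      z                                  ≈⟨ trans (sym (*-identityʳ z)) (*-congˡ (sym inverse)) ⟩
      z * (w ^ (N *ℕ j) * w ^ j)         ≈⟨ *-assoc z _ _ ⟨
      z * w ^ (N *ℕ j) * w ^ j           ≈⟨ *-congʳ (trans (proj₂ rest) (^-assocʳ w p (proj₁ rest))) ⟩
      w ^ (p *ℕ proj₁ rest) * w ^ j      ≈⟨ ^-homo-* w (p *ℕ proj₁ rest) j ⟨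
      w ^ (p *ℕ proj₁ rest +ℕ j)         ∎)
    where
    pᵏ⁺¹ N : ℕ
    pᵏ⁺¹ = p ^ℕ suc k
    N = ℕ.pred (p *ℕ pᵏ⁺¹)
    found = roots-of-unity p ζ-root (trans (^-^ z pᵏ⁺¹ p) z1)
    j = proj₁ found
    w-order : w ^ (p *ℕ pᵏ⁺¹) ≈ 1#
    w-order = trans (sym (^-^ w pᵏ⁺¹ p)) (trans (^-congˡ p wζ) (proj₁ ζ-root))
    inverse : w ^ (N *ℕ j) * w ^ j ≈ 1#
    inverse = begin
      w ^ (N *ℕ j) * w ^ j               ≈⟨ ^-homo-* w (N *ℕ j) j ⟨
      w ^ (N *ℕ j +ℕ j)                  ≡⟨ ≡.cong (w ^_) (≡.trans (ℕ.+-comm (N *ℕ j) j) (≡.trans (≡.cong (_*ℕ j) (ℕ.suc-pred (p *ℕ pᵏ⁺¹) ⦃ ℕ.m^n≢0 p (suc (suc k)) ⦄)) (ℕ.*-comm (p *ℕ pᵏ⁺¹) j))) ⟩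
      w ^ (j *ℕ (p *ℕ pᵏ⁺¹))             ≈⟨ ^-^ w (p *ℕ pᵏ⁺¹) j ⟨
      (w ^ (p *ℕ pᵏ⁺¹)) ^ j              ≈⟨ trans (^-congˡ j w-order) (^-one j) ⟩
      1#                                 ∎
    killed : (z * w ^ (N *ℕ j)) ^ pᵏ⁺¹ ≈ 1#
    killed = begin
      (z * w ^ (N *ℕ j)) ^ pᵏ⁺¹                    ≈⟨ ^-product z (w ^ (N *ℕ j)) pᵏ⁺¹ ⟩
      z ^ pᵏ⁺¹ * (w ^ (N *ℕ j)) ^ pᵏ⁺¹             ≈⟨ *-congʳ (trans (proj₂ found) (^-congˡ j (sym wζ))) ⟩
      (w ^ pᵏ⁺¹) ^ j * (w ^ (N *ℕ j)) ^ pᵏ⁺¹       ≈⟨ *-congʳ (trans (^-assocʳ w pᵏ⁺¹ j) (sym (^-^ w j pᵏ⁺¹))) ⟩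
      (w ^ j) ^ pᵏ⁺¹ * (w ^ (N *ℕ j)) ^ pᵏ⁺¹       ≈⟨ ^-product (w ^ j) (w ^ (N *ℕ j)) pᵏ⁺¹ ⟨
      (w ^ j * w ^ (N *ℕ j)) ^ pᵏ⁺¹                ≈⟨ trans (^-congˡ pᵏ⁺¹ (trans (*-comm _ _) inverse)) (^-one pᵏ⁺¹) ⟩
      1#                                           ∎
    rest : ∃[ i ] z * w ^ (N *ℕ j) ≈ (w ^ p) ^ i
    rest = prime-power-roots p ζ-root k (trans (^-^ w p (p ^ℕ k)) (trans (reflexive (≡.cong (w ^_) (ℕ.*-comm (p ^ℕ k) p))) wζ)) killed

-- Galois theory of the powers of σ.

module _ {a} {A : Set a} (f : A → A) where
  iterate-suc : ∀ x k → iterate f x (suc k) ≡ f (iterate f x k)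
  iterate-suc x zero    = ≡.refl
  iterate-suc x (suc k) = iterate-suc (f x) k

  iterate-+ : ∀ x j k → iterate f x (j +ℕ k) ≡ iterate f (iterate f x j) k
  iterate-+ x zero    k = ≡.refl
  iterate-+ x (suc j) k = iterate-+ (f x) j k

least : ∀ {ℓ} (Q : ℕ → Set ℓ) → (∀ k → Dec (Q k)) → ∀ k → Q k → ∃[ j ] j ≤ k × Q j × (∀ i → i < j → ¬ Q i)
least Q Q? zero    Q0 = zero , z≤n , Q0 , λ _ ()
least Q Q? (suc k) Qk with Q? 0
... | yes Q0 = zero , z≤n , Q0 , λ _ ()
... | no ¬Q0 = let j , j≤k , Qj , min = least (Q ∘ suc) (Q? ∘ suc) k Qk in
  suc j , s≤s j≤k , Qj , λ { zero _ → ¬Q0 ; (suc i) (s≤s i<j) → min i i<j }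

module GaloisTheory {c ℓ₁ ℓ₂ s} (em : ExcludedMiddle (c ⊔ ℓ₁ ⊔ ℓ₂ ⊔ s)) (K : HeytingField c ℓ₁ ℓ₂)
                    {p n : ℕ} (K/F : CyclicExtension K s p n) where

  open LinearAlgebra s em K
  open CyclicExtension K/F hiding (norm)
  open import Relation.Binary.Reasoning.Setoid setoid

  private
    module σ = Automorphism σ
    module Iso = RingMorphisms.IsRingIsomorphism σ.isRingIsomorphism
    σ′ : Carrier → Carrier
    σ′ = σ.⟦_⟧

  σ^ : ℕ → Carrier → Carrier
  σ^ k x = iterate σ′ x k

  σ^-suc : ∀ k x → σ^ (suc k) x ≈ σ′ (σ^ k x)
  σ^-suc k x = reflexive (iterate-suc σ′ x k)

  σ^-∘ : ∀ j k x → σ^ j (σ^ k x) ≈ σ^ (k +ℕ j) x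
  σ^-∘ j k x = reflexive (≡.sym (iterate-+ σ′ x k j))

  σ^-cong : ∀ k {x y} → x ≈ y → σ^ k x ≈ σ^ k y
  σ^-cong zero    h = h
  σ^-cong (suc k) h = σ^-cong k (Iso.⟦⟧-cong h)

  σ^-* : ∀ k x y → σ^ k (x * y) ≈ σ^ k x * σ^ k y
  σ^-* zero    x y = refl
  σ^-* (suc k) x y = trans (σ^-cong k (Iso.*-homo x y)) (σ^-* k _ _)

  σ^-+ : ∀ k x y → σ^ k (x + y) ≈ σ^ k x + σ^ k y
  σ^-+ zero    x y = refl
  σ^-+ (suc k) x y = trans (σ^-cong k (Iso.+-homo x y)) (σ^-+ k _ _)

  σ^-0 : ∀ k → σ^ k 0# ≈ 0#
  σ^-0 zero    = refl
  σ^-0 (suc k) = trans (σ^-cong k Iso.0#-homo) (σ^-0 k)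

  σ^-1 : ∀ k → σ^ k 1# ≈ 1#
  σ^-1 zero    = refl
  σ^-1 (suc k) = trans (σ^-cong k Iso.1#-homo) (σ^-1 k)

  σ^-injective : ∀ k {x y} → σ^ k x ≈ σ^ k y → x ≈ y
  σ^-injective zero    h = h
  σ^-injective (suc k) h = Iso.injective (σ^-injective k h)

  σ^-∑ : ∀ k {j} (x : Fin j → Carrier) → σ^ k (∑ x) ≈ ∑ (λ i → σ^ k (x i))
  σ^-∑ k {zero}  x = trans (σ^-cong k (∑-zero {x = x} λ ())) (trans (σ^-0 k) (sym (∑-zero {x = λ i → σ^ k (x i)} λ ())))
  σ^-∑ k {suc j} x = trans (σ^-cong k (∑-suc x)) (trans (σ^-+ k _ _)
    (trans (+-congˡ (σ^-∑ k (λ i → x (suc i)))) (sym (∑-suc (λ i → σ^ k (x i))))))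

  σ^-multiple : ∀ {k x} → σ^ k x ≈ x → ∀ i → σ^ (i *ℕ k) x ≈ x
  σ^-multiple h zero    = refl
  σ^-multiple {k} {x} h (suc i) = trans (sym (σ^-∘ (i *ℕ k) k x)) (trans (σ^-cong (i *ℕ k) h) (σ^-multiple h i))

  σ^-% : ∀ {k x} .{{_ : NonZero k}} → σ^ k x ≈ x → ∀ i → σ^ i x ≈ σ^ (i ℕ.% k) x
  σ^-% {k} {x} h i = trans (reflexive (≡.cong (λ j → σ^ j x) (≡.trans (ℕ.m≡m%n+[m/n]*n i k) (ℕ.+-comm (i ℕ.% k) _))))
    (trans (sym (σ^-∘ (i ℕ.% k) ((i ℕ./ k) *ℕ k) x)) (σ^-cong (i ℕ.% k) (σ^-multiple h (i ℕ./ k))))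

  F-fixed : ∀ {x} → x ∈ Subfield.member F → σ′ x ≈ x
  F-fixed = σ.fixesBase

  fixed⇒F : ∀ {x} → σ′ x ≈ x → x ∈ Subfield.member F
  fixed⇒F {x} h = galois x λ τ → trans (proj₂ (generates τ) x) (fixed (proj₁ (generates τ)))
    where
    fixed : ∀ k → σ^ k x ≈ x
    fixed zero    = refl
    fixed (suc k) = trans (σ^-cong k h) (fixed k)

  σ^-F : ∀ k {x} → x ∈ Subfield.member F → σ^ k x ≈ x
  σ^-F zero    h = refl
  σ^-F (suc k) h = trans (σ^-cong k (F-fixed h)) (σ^-F k h)

  module _ {E : Pred Carrier s} {d} (degree : HasDegree K F E d) (1∈E : 1# ∈ E)
           (*∈E : ∀ {x y} → x ∈ E → y ∈ E → x * y ∈ E) where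
    open HasDegree degree

    Fixes : ℕ → Set (c ⊔ ℓ₁ ⊔ s)
    Fixes k = ∀ x → x ∈ E → σ^ k x ≈ x

    Fixes? : ∀ k → Dec (Fixes k)
    Fixes? k = map′ Level.lower lift (em {Lift ℓ₂ (Fixes k)})

    moves : ∀ {k} → ¬ Fixes k → ∃[ x ] x ∈ E × ¬ σ^ k x ≈ x
    moves {k} ¬fixes with em {Lift ℓ₂ (∃[ x ] x ∈ E × ¬ σ^ k x ≈ x)}
    ... | yes (lift found) = found
    ... | no  none         = contradiction (λ x x∈E → decidable-stable (σ^ k x ≈? x) (λ h → none (lift (x , x∈E , h)))) ¬fixes

    -- By Dedekind, at most d powers of σ are distinct on an extension of degree d.
    period : ∃[ k ] k < d × Fixes (suc k)
    period = cases (Fin.any? (λ (k : Fin d) → Fixes? (suc (toℕ k))))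
      where
      cases : Dec (∃[ k ] Fixes (suc (toℕ k))) → ∃[ k ] k < d × Fixes (suc k)
      cases (yes (k , fixes)) = toℕ k , Fin.toℕ<n k , fixes
      cases (no none) = contradiction (independence (proj₁ (proj₁ (proj₂ dependence)))) (proj₂ (proj₁ (proj₂ dependence)))
        where
        dependence = underdetermined (ℕ.n<1+n d) (λ i j → σ^ (toℕ j) (basis i))
        y = proj₁ dependence
        EE : Set (c ⊔ s)
        EE = Σ Carrier E
        χ : Fin (suc d) → EE → Carrier
        χ j x = σ^ (toℕ j) (proj₁ x)
        relation : ∀ x → ∑ (λ j → y j * χ j x) ≈ 0#
        relation (x , x∈E) = begin
          ∑ (λ j → y j * σ^ (toℕ j) x)
            ≈⟨ ∑-cong (λ j → *-congˡ (trans (σ^-cong (toℕ j) (trans x≈ (reflexive (≡.sym (∑≡sum (λ i → f i * basis i))))))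
                 (trans (σ^-∑ (toℕ j) (λ i → f i * basis i)) (∑-cong (λ i → trans (σ^-* (toℕ j) (f i) (basis i)) (*-congʳ (σ^-F (toℕ j) (f∈F i)))))))) ⟩
          ∑ (λ j → y j * ∑ (λ i → f i * σ^ (toℕ j) (basis i)))
            ≈⟨ ∑-cong (λ j → sym (∑-* (y j) (λ i → f i * σ^ (toℕ j) (basis i)))) ⟩
          ∑ (λ j → ∑ (λ i → y j * (f i * σ^ (toℕ j) (basis i))))
            ≈⟨ ∑-comm (λ j i → y j * (f i * σ^ (toℕ j) (basis i))) ⟩
          ∑ (λ i → ∑ (λ j → y j * (f i * σ^ (toℕ j) (basis i))))
            ≈⟨ ∑-cong (λ i → trans (∑-cong (λ j → solve 3 (λ y f b → y :* (f :* b) := f :* (b :* y)) refl (y j) (f i) (σ^ (toℕ j) (basis i))))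
                 (trans (∑-* (f i) (λ j → σ^ (toℕ j) (basis i) * y j)) (trans (*-congˡ (proj₂ (proj₂ dependence) i)) (zeroʳ (f i))))) ⟩
          ∑ {d} (λ i → 0#)
            ≈⟨ ∑-zero {d} (λ _ → refl) ⟩
          0# ∎
          where
          f = proj₁ (spanning x∈E)
          f∈F = proj₁ (proj₂ (spanning x∈E))
          x≈ = proj₂ (proj₂ (spanning x∈E))
        apart : ∀ {i j} → i < j → j ≤ d → ∃[ x ] x ∈ E × ¬ σ^ i x ≈ σ^ j x
        apart {i} {j} i<j j≤d = let x , x∈E , moved = moves {suc (j ∸ suc i)} (fixes-none (j ∸ suc i) (ℕ.<-≤-trans (≡.subst (j ∸ suc i <_) (ℕ.m∸n+n≡m i<j) (ℕ.m<m+n (j ∸ suc i) z<s)) j≤d)) in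
            x , x∈E , λ eq → moved (σ^-injective i {σ^ (suc (j ∸ suc i)) x} {x} (trans (σ^-∘ i (suc (j ∸ suc i)) x)
              (trans (reflexive (≡.cong (λ k → σ^ k x) (≡.trans (≡.sym (ℕ.+-suc (j ∸ suc i) i)) (ℕ.m∸n+n≡m i<j)))) (sym eq))))
          where
          fixes-none : ∀ k → k < d → ¬ Fixes (suc k)
          fixes-none k k<d fixes = none (fromℕ< k<d , ≡.subst (λ k → Fixes (suc k)) (≡.sym (Fin.toℕ-fromℕ< k<d)) fixes)
        distinct : ∀ i j → ¬ i ≡ j → ∃[ x ] ¬ χ i x ≈ χ j x
        distinct i j i≢j with ℕ.<-cmp (toℕ i) (toℕ j)
        ... | tri< i<j _ _ = let x , x∈E , h = apart i<j (ℕ.s≤s⁻¹ (Fin.toℕ<n j)) in (x , x∈E) , h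
        ... | tri≈ _ i≡j _ = contradiction (Fin.toℕ-injective i≡j) i≢j
        ... | tri> _ _ j<i = let x , x∈E , h = apart j<i (ℕ.s≤s⁻¹ (Fin.toℕ<n i)) in (x , x∈E) , λ eq → h (sym eq)
        independence : ∀ j → y j ≈ 0#
        independence = dedekind (λ { (x , x∈E) (x′ , x′∈E) → x * x′ , *∈E x∈E x′∈E }) (1# , 1∈E) χ
          (λ j x x′ → σ^-* (toℕ j) _ _) (λ j → σ^-1 (toℕ j)) distinct y relation

  record IsOrder (P : ℕ) : Set (c ⊔ ℓ₁) where
    field
      positive : 0 < P
      identity : ∀ x → σ^ P x ≈ x
      distinct : ∀ {j} → 0 < j → j < P → ∃[ x ] ¬ σ^ j x ≈ x

  module _ {P} (order : IsOrder P) where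
    open IsOrder order

    trace : Carrier → Carrier
    trace x = ∑ {P} (λ l → σ^ (toℕ l) x)

    σ-trace : ∀ x → σ′ (trace x) ≈ trace x
    σ-trace x = begin
      σ^ 1 (trace x)                              ≈⟨ σ^-∑ 1 {P} (λ l → σ^ (toℕ l) x) ⟩
      ∑ {P} (λ l → σ^ 1 (σ^ (toℕ l) x))           ≈⟨ ∑-cong {P} (λ l → σ^-suc (toℕ l) x) ⟨
      ∑ {P} (λ l → σ^ (suc (toℕ l)) x)
        ≈⟨ linear₂ (- 1#) (∑-suc {P} (λ l → σ^ (toℕ l) x)) 1# (trans (∑-last {P} (λ l → σ^ l x)) (+-congˡ (identity x)))
             (solve 4 (λ S x T W → S :+ (:- :1) :* (x :+ S) :+ :1 :* (T :+ x) := T :+ (:- :1) :* W :+ :1 :* W) refl _ x (trace x) _) ⟩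
      trace x                                     ∎

    apart : ∀ {i j} → i < j → j < P → ∃[ x ] ¬ σ^ i x ≈ σ^ j x
    apart {i} {j} i<j j<P = let x , moved = distinct (ℕ.m<n⇒0<n∸m i<j) (ℕ.≤-<-trans (ℕ.m∸n≤m j i) j<P) in
      x , λ eq → moved (σ^-injective i (trans (σ^-∘ i (j ∸ i) x)
        (trans (reflexive (≡.cong (λ k → σ^ k x) (ℕ.m∸n+n≡m (ℕ.<⇒≤ i<j)))) (sym eq))))

    powers-independent : ∀ h l → 0 < h → (∀ j → j < l → h *ℕ j < P) → (x : Fin l → Carrier) →
                         (∀ θ → ∑ (λ j → x j * σ^ (h *ℕ toℕ j) θ) ≈ 0#) → ∀ j → x j ≈ 0#
    powers-independent h l h>0 bound = dedekind _*_ 1# (λ j → σ^ (h *ℕ toℕ j)) (λ j → σ^-* (h *ℕ toℕ j)) (λ j → σ^-1 (h *ℕ toℕ j)) different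
      where
      instance
        h≢0 : NonZero h
        h≢0 = ℕ.>-nonZero h>0
      different : ∀ (i j : Fin l) → ¬ i ≡ j → ∃[ x ] ¬ σ^ (h *ℕ toℕ i) x ≈ σ^ (h *ℕ toℕ j) x
      different i j i≢j with ℕ.<-cmp (toℕ i) (toℕ j)
      ... | tri< i<j _ _ = apart (ℕ.*-monoʳ-< h i<j) (bound (toℕ j) (Fin.toℕ<n j))
      ... | tri≈ _ i≡j _ = contradiction (Fin.toℕ-injective i≡j) i≢j
      ... | tri> _ _ j<i = let x , h = apart (ℕ.*-monoʳ-< h j<i) (bound (toℕ i) (Fin.toℕ<n i)) in x , λ eq → h (sym eq)

    some-value : ∀ {k} {x : Fin k → Carrier} (f : Carrier → Fin k → Carrier) →
                 ((∀ θ → ∑ (λ j → x j * f θ j) ≈ 0#) → ∀ j → x j ≈ 0#) → ∀ j → ¬ x j ≈ 0# → ∃[ θ ] ¬ ∑ (λ j → x j * f θ j) ≈ 0#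
    some-value {k} {x} f independent j x≉0 with em {Lift (ℓ₂ ⊔ s) (∃[ θ ] ¬ ∑ (λ j → x j * f θ j) ≈ 0#)}
    ... | yes (lift found) = found
    ... | no  none = contradiction (independent (λ θ → decidable-stable (∑ (λ j → x j * f θ j) ≈? 0#) (λ h → none (lift (θ , h)))) j) x≉0

    nonzero-trace : ∃[ θ ] ¬ trace θ ≈ 0#
    nonzero-trace = let θ , h = some-value {P} {λ _ → 1#} (λ θ j → σ^ (1 *ℕ toℕ j) θ)
                          (powers-independent 1 P z<s (λ j j<P → ≡.subst (_< P) (≡.sym (ℕ.*-identityˡ j)) j<P) (λ _ → 1#)) (fromℕ< positive) 1≉0 in
      θ , λ h′ → h (trans (∑-cong {P} (λ j → trans (*-identityˡ _) (reflexive (≡.cong (λ k → σ^ k θ) (ℕ.*-identityˡ (toℕ j)))))) h′)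

    -- The k conjugates of a relation among the x j form a system with fewer equations than
    -- unknowns, and by periodicity its solution w satisfies all conjugate relations. After scaling
    -- one coordinate to an element of non-zero trace, the sum of the conjugates of the relation has
    -- coefficients in F.
    artin : ∀ {k d} → 0 < k → k < d → (x : Fin d → Carrier) → (∀ j → σ^ k (x j) ≈ x j) →
            ∃[ y ] (∀ j → y j ∈ Subfield.member F) × Nontrivial y × ∑ (λ j → y j * x j) ≈ 0#
    artin {k} {d} k>0 k<d x fixed = y , (λ j → fixed⇒F (σ-trace (z j))) , (j₀ , nonzero) , relation
      where
      instance
        k≢0 : NonZero k
        k≢0 = ℕ.>-nonZero k>0
      dependence = underdetermined k<d (λ i j → σ^ (toℕ i) (x j))
      w = proj₁ dependence
      j₀ = proj₁ (proj₁ (proj₂ dependence))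
      w⁻¹ = recip (proj₂ (proj₁ (proj₂ dependence)))
      θ = proj₁ nonzero-trace
      z y : Fin d → Carrier
      z j = θ * proj₁ w⁻¹ * w j
      y j = trace (z j)
      nonzero : ¬ y j₀ ≈ 0#
      nonzero h = proj₂ nonzero-trace (trans (∑-cong {P} (λ l → σ^-cong (toℕ l) z≈θ)) h)
        where
        z≈θ : θ ≈ z j₀
        z≈θ = linear₁ (- θ) (proj₂ w⁻¹) (solve 3 (λ θ w v → θ :+ (:- θ) :* :1 := θ :* v :* w :+ (:- θ) :* (w :* v)) refl θ (w j₀) (proj₁ w⁻¹))
      all : ∀ i → ∑ (λ j → σ^ i (x j) * w j) ≈ 0#
      all i = trans (∑-cong (λ j → *-congʳ (trans (σ^-% (fixed j) i) (reflexive (≡.cong (λ i → σ^ i (x j)) (≡.sym (Fin.toℕ-fromℕ< (ℕ.m%n<n i k))))))))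
        (proj₂ (proj₂ dependence) (fromℕ< (ℕ.m%n<n i k)))
      relation : ∑ (λ j → y j * x j) ≈ 0#
      relation = begin
        ∑ (λ j → trace (z j) * x j)
          ≈⟨ ∑-cong (λ j → trans (*-comm _ _) (sym (∑-* {P} (x j) (λ l → σ^ (toℕ l) (z j))))) ⟩
        ∑ (λ j → ∑ {P} (λ l → x j * σ^ (toℕ l) (z j)))
          ≈⟨ ∑-comm (λ j (l : Fin P) → x j * σ^ (toℕ l) (z j)) ⟩
        ∑ {P} (λ l → ∑ (λ j → x j * σ^ (toℕ l) (z j)))
          ≈⟨ ∑-zero {P} (λ l → conjugate (toℕ l)) ⟩
        0# ∎
        where
        conjugate : ∀ l → ∑ (λ j → x j * σ^ l (z j)) ≈ 0#
        conjugate l = begin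
          ∑ (λ j → x j * σ^ l (z j))
            ≈⟨ ∑-cong (λ j → *-congʳ (trans (σ^-∘ l (l *ℕ ℕ.pred P) (x j)) (trans (reflexive (≡.cong (λ k → σ^ k (x j)) exponent)) (σ^-multiple (identity (x j)) l)))) ⟨
          ∑ (λ j → σ^ l (σ^ (l *ℕ ℕ.pred P) (x j)) * σ^ l (z j))
            ≈⟨ ∑-cong (λ j → σ^-* l _ _) ⟨
          ∑ (λ j → σ^ l (σ^ (l *ℕ ℕ.pred P) (x j) * z j))
            ≈⟨ σ^-∑ l _ ⟨
          σ^ l (∑ (λ j → σ^ (l *ℕ ℕ.pred P) (x j) * z j))
            ≈⟨ σ^-cong l (trans (∑-cong (λ j → solve 4 (λ u θ v w → u :* (θ :* v :* w) := θ :* v :* (u :* w)) refl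
                 (σ^ (l *ℕ ℕ.pred P) (x j)) θ (proj₁ w⁻¹) (w j)))
                 (trans (∑-* (θ * proj₁ w⁻¹) _) (trans (*-congˡ (all (l *ℕ ℕ.pred P))) (zeroʳ _)))) ⟩
          σ^ l 0#
            ≈⟨ σ^-0 l ⟩
          0# ∎
          where
          exponent : l *ℕ ℕ.pred P +ℕ l ≡ l *ℕ P
          exponent = ≡.trans (ℕ.+-comm (l *ℕ ℕ.pred P) l) (≡.trans (≡.sym (ℕ.*-suc l (ℕ.pred P))) (≡.cong (l *ℕ_) (ℕ.suc-pred P ⦃ ℕ.>-nonZero positive ⦄)))

    -- Hilbert 90 for τ = σ ^ h, where h l = P: the partial norms y j of x satisfy y l = 1.
    hilbert90 : ∀ {h l x} → 0 < h → h *ℕ suc l ≡ P → (y : ℕ → Carrier) → y 0 ≈ 1# → (∀ j → y (suc j) ≈ x * σ^ h (y j)) →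
                y (suc l) ≈ 1# → ∃[ β ] ¬ β ≈ 0# × x * σ^ h β ≈ β
    hilbert90 {h} {l} {x} h>0 hl y y₀ y-suc y-l = β , proj₂ value , (begin
        x * σ^ h β
          ≈⟨ *-congˡ (σ^-∑ h (λ j → y (toℕ j) * σ^ (h *ℕ toℕ j) θ)) ⟩
        x * ∑ (λ (j : Fin (suc l)) → σ^ h (y (toℕ j) * σ^ (h *ℕ toℕ j) θ))
          ≈⟨ ∑-* x _ ⟨
        ∑ (λ (j : Fin (suc l)) → x * σ^ h (y (toℕ j) * σ^ (h *ℕ toℕ j) θ))
          ≈⟨ ∑-cong (λ (j : Fin (suc l)) → step (toℕ j)) ⟩
        ∑ (λ (j : Fin (suc l)) → f (suc (toℕ j)))
          ≈⟨ linear₃ (- 1#) (∑-suc (λ j → f (toℕ j))) 1# (∑-last {suc l} f) 1# ends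
               (solve 5 (λ S T W u v → S :+ (:- :1) :* (u :+ S) :+ :1 :* (T :+ v) :+ :1 :* u := T :+ (:- :1) :* W :+ :1 :* W :+ :1 :* v) refl
                 (∑ (λ (j : Fin (suc l)) → f (suc (toℕ j)))) β (∑ {suc (suc l)} (λ j → f (toℕ j))) (f 0) (f (suc l))) ⟩
        β ∎)
      where
      f : ℕ → Carrier
      f j = y j * σ^ (h *ℕ j) (proj₁ value)
        where
        value = some-value {suc l} {λ j → y (toℕ j)} (λ θ j → σ^ (h *ℕ toℕ j) θ)
          (powers-independent h (suc l) h>0 (λ j j<l → ≡.subst (h *ℕ j <_) hl (ℕ.*-monoʳ-< h ⦃ ℕ.>-nonZero h>0 ⦄ j<l)) (λ j → y (toℕ j))) zero
          (λ h → 1≉0 (trans (sym y₀) h))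
      value = some-value {suc l} {λ j → y (toℕ j)} (λ θ j → σ^ (h *ℕ toℕ j) θ)
          (powers-independent h (suc l) h>0 (λ j j<l → ≡.subst (h *ℕ j <_) hl (ℕ.*-monoʳ-< h ⦃ ℕ.>-nonZero h>0 ⦄ j<l)) (λ j → y (toℕ j))) zero
          (λ h → 1≉0 (trans (sym y₀) h))
      θ = proj₁ value
      β : Carrier
      β = ∑ (λ (j : Fin (suc l)) → f (toℕ j))
      step : ∀ j → x * σ^ h (y j * σ^ (h *ℕ j) θ) ≈ f (suc j)
      step j = trans (*-congˡ (σ^-* h (y j) _)) (trans (sym (*-assoc x _ _))
        (*-cong (sym (y-suc j)) (trans (σ^-∘ h (h *ℕ j) θ) (reflexive (≡.cong (λ k → σ^ k θ) (≡.trans (ℕ.+-comm (h *ℕ j) h) (≡.sym (ℕ.*-suc h j))))))))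
      ends : f (suc l) ≈ f 0
      ends = *-cong (trans y-l (sym y₀)) (trans (reflexive (≡.cong (λ k → σ^ k θ) hl)) (trans (identity θ) (reflexive (≡.cong (λ k → σ^ k θ) (≡.sym (ℕ.*-zeroʳ h))))))

  Uˢ : Pred Carrier s
  Uˢ _ = Lift s ⊤

  degree-Uˢ : HasDegree K F Uˢ (p ^ℕ n)
  degree-Uˢ = record
    { basis = basis ; basis∈E = λ _ → lift tt ; independent = independent ; spanning = λ _ → spanning tt }
    where open HasDegree degree

  independent-∑ : ∀ {t} {E : Pred Carrier t} {d} (deg : HasDegree K F E d) → let open HasDegree deg in
                  (y : Fin d → Carrier) → (∀ j → y j ∈ Subfield.member F) → ∑ (λ j → y j * basis j) ≈ 0# → ∀ j → y j ≈ 0#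
  independent-∑ deg y y∈F eq = HasDegree.independent deg y y∈F (trans (reflexive (≡.sym (∑≡sum (λ j → y j * HasDegree.basis deg j)))) eq)

  -- Dedekind bounds the least period of σ by the degree. A smaller period would by `artin` make the
  -- basis of K dependent over F.
  order : IsOrder (p ^ℕ n)
  order = ≡.subst IsOrder P≡ P-order
    where
    fixes = Fixes? degree-Uˢ (lift tt) (λ _ _ → lift tt)
    found = period degree-Uˢ (lift tt) (λ _ _ → lift tt)
    smallest = least (λ k → Fixes degree-Uˢ (lift tt) (λ _ _ → lift tt) (suc k)) (λ k → fixes (suc k)) (proj₁ found) (proj₂ (proj₂ found))
    P : ℕ
    P = suc (proj₁ smallest)
    P-order : IsOrder P
    P-order = record
      { positive = z<s
      ; identity = λ x → proj₁ (proj₂ (proj₂ smallest)) x (lift tt)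
      ; distinct = λ { {suc j} _ (s≤s j<P) → let x , _ , h = moves degree-Uˢ (lift tt) (λ _ _ → lift tt) {suc j} (proj₂ (proj₂ (proj₂ smallest)) j j<P) in x , h }
      }
    P≤ : P ≤ p ^ℕ n
    P≤ = ℕ.≤-<-trans (proj₁ (proj₂ smallest)) (proj₁ (proj₂ found))
    P≡ : P ≡ p ^ℕ n
    P≡ with ℕ.m≤n⇒m<n∨m≡n P≤
    ... | inj₂ eq = eq
    ... | inj₁ P<  = let y , y∈F , (j , y≉0) , eq = artin P-order {P} z<s P< (HasDegree.basis degree) (λ j → IsOrder.identity P-order _) in
      contradiction (independent-∑ degree y y∈F eq j) y≉0

  module _ (i : Fin (suc n)) where
    private
      E = Kᵢ i
      open Subfield E using (member)

    -- Of `Kᵢ` only the degree is known. Some σ ^ k with k at most p ^ i fixes it, and k < p ^ i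
    -- would by `artin` contradict the independence of its basis.
    Kᵢ⊆fixed : ∀ {x} → x ∈ member → σ^ (p ^ℕ toℕ i) x ≈ x
    Kᵢ⊆fixed {x} x∈E = ≡.subst (λ k → σ^ k x ≈ x) k≡ (proj₂ (proj₂ found) x x∈E)
      where
      found = period (degreeKᵢ i) (Subfield.1∈ E) (Subfield.*-closed E)
      k≡ : suc (proj₁ found) ≡ p ^ℕ toℕ i
      k≡ with ℕ.m≤n⇒m<n∨m≡n (proj₁ (proj₂ found))
      ... | inj₂ eq = eq
      ... | inj₁ k< = let y , y∈F , (j , y≉0) , eq = artin order z<s k< (HasDegree.basis (degreeKᵢ i))
                            (λ j → proj₂ (proj₂ found) _ (HasDegree.basis∈E (degreeKᵢ i) j)) in
        contradiction (independent-∑ (degreeKᵢ i) y y∈F eq j) y≉0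

    -- Adjoining x to a basis of `Kᵢ` gives p ^ i + 1 elements fixed by σ ^ (p ^ i). They are
    -- dependent over F, and independence of the basis makes the coefficient of x non-zero.
    fixed⊆Kᵢ : ∀ {x} → 0 < p ^ℕ toℕ i → σ^ (p ^ℕ toℕ i) x ≈ x → x ∈ member
    fixed⊆Kᵢ {x} h>0 fixed = Subfield.resp E (sym x≈) combination∈E
      where
      open HasDegree (degreeKᵢ i)
      v : Fin (suc (p ^ℕ toℕ i)) → Carrier
      v zero    = x
      v (suc j) = basis j
      v-fixed : ∀ j → σ^ (p ^ℕ toℕ i) (v j) ≈ v j
      v-fixed zero    = fixed
      v-fixed (suc j) = Kᵢ⊆fixed (basis∈E j)
      dependence = artin order h>0 (ℕ.n<1+n _) v v-fixed
      y = proj₁ dependence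
      y∈F = proj₁ (proj₂ dependence)
      relation : y zero * x + ∑ (λ j → y (suc j) * basis j) ≈ 0#
      relation = trans (sym (∑-suc (λ j → y j * v j))) (proj₂ (proj₂ (proj₂ dependence)))
      y₀≉0 : ¬ y zero ≈ 0#
      y₀≉0 y₀≈0 = nontrivial (proj₁ (proj₂ (proj₂ dependence)))
        where
        rest : ∀ j → y (suc j) ≈ 0#
        rest = independent-∑ (degreeKᵢ i) (λ j → y (suc j)) (λ j → y∈F (suc j))
          (linear₂ 1# relation (- x) y₀≈0 (solve 3 (λ S y x → S :+ :1 :* con ℤ.0ℤ :+ (:- x) :* con ℤ.0ℤ := con ℤ.0ℤ :+ :1 :* (y :* x :+ S) :+ (:- x) :* y) refl _ (y zero) x))
        nontrivial : ¬ Nontrivial y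
        nontrivial (zero  , h) = h y₀≈0
        nontrivial (suc j , h) = h (rest j)
      y⁻¹ = recip y₀≉0
      y⁻¹∈F : proj₁ y⁻¹ ∈ Subfield.member F
      y⁻¹∈F = Subfield.inv-closed F (y∈F zero) (proj₂ y⁻¹)
      combination : Carrier
      combination = - proj₁ y⁻¹ * ∑ (λ j → y (suc j) * basis j)
      x≈ : x ≈ combination
      x≈ = linear₂ (- x) (proj₂ y⁻¹) (proj₁ y⁻¹) relation (solve 4 (λ x y z S → x :+ (:- x) :* :1 :+ z :* con ℤ.0ℤ
        := (:- z) :* S :+ (:- x) :* (y :* z) :+ z :* (y :* x :+ S)) refl x (y zero) (proj₁ y⁻¹) _)
      combination∈E : combination ∈ member
      combination∈E = Subfield.*-closed E (Subfield.neg-closed E (F⊆Kᵢ i y⁻¹∈F))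
        (∑-closed member (Subfield.0∈ E) (Subfield.+-closed E) (λ j → Subfield.*-closed E (F⊆Kᵢ i (y∈F (suc j))) (basis∈E j)))

-- An additive model of the unit group inside a commutative ring.

-- An additive copy of an abelian group with an endomorphism σ inside a commutative ring
-- in which σ acts by multiplication.
record Embedding {a ℓ} (G : AbelianGroup a ℓ) (σ : AbelianGroup.Carrier G → AbelianGroup.Carrier G) : Set (lsuc (a ⊔ ℓ)) where
  open AbelianGroup G using (_∙_; ε; _⁻¹) renaming (Carrier to M; _≈_ to _≋_; rawMonoid to M-rawMonoid)
  field
    R : CommutativeRing a (a ⊔ ℓ)

  open Geometric R

  field
    σᴬ          : Carrier
    IsElement   : Carrier → Set (a ⊔ ℓ)
    isIdeal     : IsIdeal R IsElement
    μ           : M → Carrier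
    element     : Carrier → M
    μ-element   : ∀ x → IsElement (μ x)
    element-μ   : ∀ {x} → IsElement x → x ≈ μ (element x)
    μ-cong      : ∀ {x y} → x ≋ y → μ x ≈ μ y
    μ-injective : ∀ {x y} → μ x ≈ μ y → x ≋ y
    μ-∙         : ∀ x y → μ (x ∙ y) ≈ μ x + μ y
    μ-⁻¹        : ∀ x → μ (x ⁻¹) ≈ - μ x
    μ-ε         : μ ε ≈ 0#
    σ-μ         : ∀ x → σᴬ * μ x ≈ μ (σ x)

  open Algebra.Definitions.RawMonoid M-rawMonoid using () renaming (_×_ to _×ᴹ_; sum to sumᴹ)

  σ^-μ : ∀ k x → σᴬ ^ k * μ x ≈ μ (iterate σ x k)
  σ^-μ zero    x = *-identityˡ (μ x)
  σ^-μ (suc k) x = trans (trans (*-congʳ (*-comm σᴬ (σᴬ ^ k))) (*-assoc (σᴬ ^ k) σᴬ (μ x)))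
    (trans (*-congˡ (σ-μ x)) (σ^-μ k (σ x)))

  ι-μ : ∀ k x → ι k * μ x ≈ μ (k ×ᴹ x)
  ι-μ zero    x = trans (*-congʳ ι-0) (trans (zeroˡ (μ x)) (sym μ-ε))
  ι-μ (suc k) x = trans (*-congʳ (ι-suc k)) (trans (distribʳ (μ x) 1# (ι k))
    (trans (+-cong (*-identityˡ (μ x)) (ι-μ k x)) (sym (μ-∙ x (k ×ᴹ x)))))

  ∑-μ : ∀ {k} (x : Fin k → M) → ∑ (λ i → μ (x i)) ≈ μ (sumᴹ x)
  ∑-μ {zero}  x = trans (∑-zero {x = λ i → μ (x i)} λ ()) (sym μ-ε)
  ∑-μ {suc k} x = trans (∑-suc (λ i → μ (x i))) (trans (+-congˡ (∑-μ (λ i → x (suc i)))) (sym (μ-∙ _ _)))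

  norm-μ : ∀ k x → geom 1# σᴬ k * μ x ≈ μ (sumᴹ {k} (λ j → iterate σ x (toℕ j)))
  norm-μ zero    x = trans (zeroˡ (μ x)) (sym μ-ε)
  norm-μ (suc k) x = trans (distribʳ (μ x) (σᴬ * geom 1# σᴬ k) (1# ^ k))
    (trans (+-cong (trans (trans (*-congʳ (*-comm σᴬ (geom 1# σᴬ k))) (*-assoc (geom 1# σᴬ k) σᴬ (μ x)))
        (trans (*-congˡ (σ-μ x)) (norm-μ k (σ x)))) (trans (*-congʳ (1^ k)) (*-identityˡ (μ x))))
      (trans (+-comm _ _) (sym (μ-∙ x _))))
    where
    1^ : ∀ k → 1# ^ k ≈ 1#
    1^ zero    = refl
    1^ (suc k) = trans (*-identityˡ (1# ^ k)) (1^ k)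

-- The idealization R ⋉ M of an abelian group M with an endomorphism σ, where R
-- is the commutative ring of polynomials in σ, up to equality of their actions.
module Idealization {a ℓ} (G : AbelianGroup a ℓ) (σ : AbelianGroup.Carrier G → AbelianGroup.Carrier G)
  (σ-cong : ∀ {x y} → AbelianGroup._≈_ G x y → AbelianGroup._≈_ G (σ x) (σ y))
  (σ-∙ : ∀ x y → AbelianGroup._≈_ G (σ (AbelianGroup._∙_ G x y)) (AbelianGroup._∙_ G (σ x) (σ y))) where

  private
    module G = AbelianGroup G
    open G using (_∙_; ε; _⁻¹) renaming (Carrier to M; _≈_ to _≋_)
    open Algebra.Properties.AbelianGroup G using (⁻¹-∙-comm; ε⁻¹≈ε; identityˡ-unique)
    open Algebra.Solver.CommutativeMonoid G.commutativeMonoid using (solve; _⊜_; _⊕_)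

    interchange : ∀ w x y z → (w ∙ x) ∙ (y ∙ z) ≋ (w ∙ y) ∙ (x ∙ z)
    interchange = solve 4 (λ w x y z → (w ⊕ x) ⊕ (y ⊕ z) ⊜ (w ⊕ y) ⊕ (x ⊕ z)) G.refl

  -- Formal integral polynomials in σ. Arbitrary additive endomorphisms would not commute, whereas
  -- expressions built from σ alone do, by induction on their form.
  data Operator : Set where
    zero′ one′ σ′ : Operator
    _+′_ _*′_     : Operator → Operator → Operator
    -′_           : Operator → Operator

  act : Operator → M → M
  act zero′    x = ε
  act one′     x = x
  act σ′       x = σ x
  act (f +′ g) x = act f x ∙ act g x
  act (f *′ g) x = act f (act g x)
  act (-′ f)   x = act f x ⁻¹

  private
    act-cong : ∀ f {x y} → x ≋ y → act f x ≋ act f y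
    act-cong zero′    h = G.refl
    act-cong one′     h = h
    act-cong σ′       h = σ-cong h
    act-cong (f +′ g) h = G.∙-cong (act-cong f h) (act-cong g h)
    act-cong (f *′ g) h = act-cong f (act-cong g h)
    act-cong (-′ f)   h = G.⁻¹-cong (act-cong f h)

    act-∙ : ∀ f x y → act f (x ∙ y) ≋ act f x ∙ act f y
    act-∙ zero′    x y = G.sym (G.identityˡ ε)
    act-∙ one′     x y = G.refl
    act-∙ σ′       x y = σ-∙ x y
    act-∙ (f +′ g) x y = G.trans (G.∙-cong (act-∙ f x y) (act-∙ g x y)) (interchange _ _ _ _)
    act-∙ (f *′ g) x y = G.trans (act-cong f (act-∙ g x y)) (act-∙ f _ _)
    act-∙ (-′ f)   x y = G.trans (G.⁻¹-cong (act-∙ f x y)) (G.sym (⁻¹-∙-comm _ _))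

    act-ε : ∀ f → act f ε ≋ ε
    act-ε f = identityˡ-unique (act f ε) (act f ε) (G.trans (G.sym (act-∙ f ε ε)) (act-cong f (G.identityˡ ε)))

    act-⁻¹ : ∀ f x → act f (x ⁻¹) ≋ act f x ⁻¹
    act-⁻¹ f x = G.uniqueˡ-⁻¹ _ _ (G.trans (G.sym (act-∙ f (x ⁻¹) x)) (G.trans (act-cong f (G.inverseˡ x)) (act-ε f)))

    act-σ : ∀ f x → act f (σ x) ≋ σ (act f x)
    act-σ zero′    x = G.sym (act-ε σ′)
    act-σ one′     x = G.refl
    act-σ σ′       x = G.refl
    act-σ (f +′ g) x = G.trans (G.∙-cong (act-σ f x) (act-σ g x)) (G.sym (σ-∙ _ _))
    act-σ (f *′ g) x = G.trans (act-cong f (act-σ g x)) (act-σ f _)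
    act-σ (-′ f)   x = G.trans (G.⁻¹-cong (act-σ f x)) (G.sym (act-⁻¹ σ′ (act f x)))

    act-comm : ∀ f g x → act f (act g x) ≋ act g (act f x)
    act-comm zero′    g x = G.sym (act-ε g)
    act-comm one′     g x = G.refl
    act-comm σ′       g x = G.sym (act-σ g x)
    act-comm (f +′ h) g x = G.trans (G.∙-cong (act-comm f g x) (act-comm h g x)) (G.sym (act-∙ g _ _))
    act-comm (f *′ h) g x = G.trans (act-cong f (act-comm h g x)) (act-comm f g _)
    act-comm (-′ f)   g x = G.trans (G.⁻¹-cong (act-comm f g x)) (G.sym (act-⁻¹ g _))

  infix 4 _≈′_
  _≈′_ : Operator × M → Operator × M → Set (a ⊔ ℓ)
  (f , x) ≈′ (g , y) = (∀ z → act f z ≋ act g z) × x ≋ y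

  idealization : CommutativeRing a (a ⊔ ℓ)
  idealization = record
    { Carrier = Operator × M
    ; _≈_ = _≈′_
    ; _+_ = λ { (f , x) (g , y) → f +′ g , x ∙ y }
    ; _*_ = λ { (f , x) (g , y) → f *′ g , act f y ∙ act g x }
    ; -_  = λ { (f , x) → -′ f , x ⁻¹ }
    ; 0#  = zero′ , ε
    ; 1#  = one′ , ε
    ; isCommutativeRing = record
      { isRing = record
        { +-isAbelianGroup = record
          { isGroup = record
            { isMonoid = record
              { isSemigroup = record
                { isMagma = record
                  { isEquivalence = record
                    { refl  = (λ _ → G.refl) , G.refl
                    ; sym   = λ { (h , k) → (λ z → G.sym (h z)) , G.sym k }
                    ; trans = λ { (h , k) (h′ , k′) → (λ z → G.trans (h z) (h′ z)) , G.trans k k′ }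
                    }
                  ; ∙-cong = λ { (h , k) (h′ , k′) → (λ z → G.∙-cong (h z) (h′ z)) , G.∙-cong k k′ }
                  }
                ; assoc = λ { (f , x) (g , y) (h , z) → (λ w → G.assoc (act f w) (act g w) (act h w)) , G.assoc x y z }
                }
              ; identity = (λ { (f , x) → (λ z → G.identityˡ (act f z)) , G.identityˡ x })
                         , (λ { (f , x) → (λ z → G.identityʳ (act f z)) , G.identityʳ x })
              }
            ; inverse = (λ { (f , x) → (λ z → G.inverseˡ (act f z)) , G.inverseˡ x })
                      , (λ { (f , x) → (λ z → G.inverseʳ (act f z)) , G.inverseʳ x })
            ; ⁻¹-cong = λ { (h , k) → (λ z → G.⁻¹-cong (h z)) , G.⁻¹-cong k }
            }
          ; comm = λ { (f , x) (g , y) → (λ z → G.comm (act f z) (act g z)) , G.comm x y }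
          }
        ; *-cong = λ { {f , x} {f′ , x′} {g , y} {g′ , y′} (h , k) (h′ , k′) →
            (λ z → G.trans (act-cong f (h′ z)) (h (act g′ z)))
            , G.∙-cong (G.trans (act-cong f k′) (h y′)) (G.trans (act-cong g k) (h′ x′)) }
        ; *-assoc = λ { (f , x) (g , y) (h , z) → (λ w → G.refl)
            , (G.trans (G.∙-congˡ (act-∙ h (act f y) (act g x)))
              (G.trans (G.∙-congˡ (G.∙-cong (act-comm h f y) (act-comm h g x)))
              (G.trans (G.sym (G.assoc _ _ _)) (G.∙-congʳ (G.sym (act-∙ f (act g z) (act h y))))))) }
        ; *-identity = (λ { (f , x) → (λ z → G.refl) , G.trans (G.∙-congˡ (act-ε f)) (G.identityʳ x) })
                     , (λ { (f , x) → (λ z → G.refl) , G.trans (G.∙-congʳ (act-ε f)) (G.identityˡ x) })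
        ; distrib = (λ { (f , x) (g , y) (h , z) → (λ w → act-∙ f (act g w) (act h w))
                        , G.trans (G.∙-congʳ (act-∙ f y z)) (interchange _ _ _ _) })
                  , (λ { (f , x) (g , y) (h , z) → (λ w → G.refl)
                        , G.trans (G.∙-congˡ (act-∙ f y z)) (interchange _ _ _ _) })
        }
      ; *-comm = λ { (f , x) (g , y) → (λ z → act-comm f g z) , G.comm (act f y) (act g x) }
      }
    }

  embedding : Embedding G σ
  embedding = record
    { R = idealization ; σᴬ = σ′ , ε
    -- An operator component that acts as zero need not be `zero′` syntactically, so the ideal is
    -- defined by the action, which makes it invariant under the equality of the ring.
    ; IsElement = λ { (f , _) → ∀ z → act f z ≋ ε }
    ; isIdeal = record
      { 0∈       = λ _ → G.refl
      ; +-closed = λ h k z → G.trans (G.∙-cong (h z) (k z)) (G.identityˡ ε)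
      ; *-closed = λ { (f , _) h z → G.trans (act-cong f (h z)) (act-ε f) }
      ; resp     = λ { (h , _) k z → G.trans (G.sym (h z)) (k z) }
      }
    ; μ = λ x → zero′ , x
    ; element = proj₂
    ; μ-element = λ _ _ → G.refl
    ; element-μ = λ h → h , G.refl
    ; μ-cong = λ h → (λ _ → G.refl) , h
    ; μ-injective = proj₂
    ; μ-∙ = λ _ _ → (λ _ → G.sym (G.identityˡ ε)) , G.refl
    ; μ-⁻¹ = λ _ → (λ _ → G.sym ε⁻¹≈ε) , G.refl
    ; μ-ε = (λ _ → G.refl) , G.refl
    ; σ-μ = λ x → (λ _ → act-ε σ′) , G.identityʳ (σ x)
    }

-- Norm pairs of K / F as pairs in the additive model.

record Setup c ℓ₁ ℓ₂ s : Set (lsuc (c ⊔ ℓ₁ ⊔ ℓ₂ ⊔ s)) where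
  field
    em        : ExcludedMiddle (c ⊔ ℓ₁ ⊔ ℓ₂ ⊔ s)
    K         : HeytingField c ℓ₁ ℓ₂
    {p n}     : ℕ
    p-prime   : Prime p
    1≤n       : 1 ≤ n
    K/F       : CyclicExtension K s p n
    ξ         : FieldOps.Carrier K
    ξ-root    : FieldOps.IsPrimitiveRoot K p ξ
    ξ∈F       : ξ ∈ Subfield.member (CyclicExtension.F K/F)
    embedding : Embedding (FieldOps.unitGroup K) (CyclicExtension.σˣ K/F)

module Translation {c ℓ₁ ℓ₂ s} (H : Setup c ℓ₁ ℓ₂ s) where

  open Setup H
  open CyclicExtension K/F
  open Embedding embedding
  private
    module K = FieldOps K
    module L = LinearAlgebra s em K
    module Gal = GaloisTheory em K K/F
    module G = AbelianGroup K.unitGroup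
    module σ = Automorphism σ
  open K using (Unit; _≈ˣ_; _∙ˣ_; 1ˣ; _⁻¹ˣ; _^ˣ_; _^ᶻ_; ∏ˣ)
  open Geometric R
  open AddInfimum (Fin._<_ {suc n}) using (⊥₋<[_]; [_])
  open import Relation.Binary.Reasoning.Setoid setoid

  instance
    p≢0 : NonZero p
    p≢0 = prime⇒nonZero p-prime

  iterate-unit : ∀ u k → proj₁ (iterate σˣ u k) ≡ iterate σ.⟦_⟧ (proj₁ u) k
  iterate-unit u zero    = ≡.refl
  iterate-unit u (suc k) = iterate-unit (σˣ u) k

  ^ˣ-unit : ∀ u k → proj₁ (u ^ˣ k) ≡ proj₁ u K.^ k
  ^ˣ-unit u zero    = ≡.refl
  ^ˣ-unit u (suc k) = ≡.cong (proj₁ u K.*_) (^ˣ-unit u k)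

  σ-order : ∀ {x} → IsElement x → σᴬ ^ (p ^ℕ n) * x ≈ x
  σ-order {x} x∈M = begin
    σᴬ ^ (p ^ℕ n) * x                          ≈⟨ *-congˡ (element-μ x∈M) ⟩
    σᴬ ^ (p ^ℕ n) * μ (element x)              ≈⟨ σ^-μ (p ^ℕ n) (element x) ⟩
    μ (iterate σˣ (element x) (p ^ℕ n))        ≈⟨ μ-cong (L.trans (L.reflexive (iterate-unit (element x) (p ^ℕ n))) (Gal.IsOrder.identity Gal.order (proj₁ (element x)))) ⟩
    μ (element x)                              ≈⟨ element-μ x∈M ⟨
    x                                          ∎

  unit : ∀ {x} → ¬ x K.≈ K.0# → Unit
  unit {x} x≉0 = x , proj₁ (L.recip x≉0) , L.trans (L.*-comm _ _) (proj₂ (L.recip x≉0)) , proj₂ (L.recip x≉0)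

  hilbert90 : ∀ c → c ≤ n → ∀ {x} → IsElement x → geom 1# (σᴬ ^ (p ^ℕ c)) (p ^ℕ (n ∸ c)) * x ≈ 0# →
              ∃[ γ ] IsElement γ × x ≈ (σᴬ ^ (p ^ℕ c) - 1#) * γ
  -- Multiplicatively x σ ^ h β = β, so x is β divided by its conjugate. Hence the sign: γ is - β in
  -- additive notation.
  hilbert90 c c≤n {x} x∈M Nx≈0 = - 1# * μ βˣ , IsIdeal.*-closed isIdeal (- 1#) (μ-element βˣ) ,
      linear₄ 1# (element-μ x∈M) (- 1#) (sym (σ^-μ h βˣ)) 1# relation 0# refl
        (solve 6 (λ x τ β u v o → x :+ :1 :* u :+ (:- :1) :* (τ :* β) :+ :1 :* β :+ con ℤ.0ℤ :* o
          := (τ :- :1) :* ((:- :1) :* β) :+ :1 :* x :+ (:- :1) :* v :+ :1 :* (u :+ v) :+ con ℤ.0ℤ :* o) refl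
          x (σᴬ ^ h) (μ βˣ) (μ u) (μ (iterate σˣ βˣ h)) 0#)
    where
    h l : ℕ
    h = p ^ℕ c
    l = ℕ.pred (p ^ℕ (n ∸ c))
    u : Unit
    u = element x
    y : ℕ → Unit
    y zero    = 1ˣ
    y (suc j) = u ∙ˣ iterate σˣ (y j) h
    μ-y : ∀ j → μ (y j) ≈ geom 1# (σᴬ ^ h) j * μ u
    μ-y zero    = trans μ-ε (sym (zeroˡ (μ u)))
    μ-y (suc j) = begin
      μ (u ∙ˣ iterate σˣ (y j) h)                        ≈⟨ trans (μ-∙ _ _) (+-congˡ (sym (σ^-μ h (y j)))) ⟩
      μ u + σᴬ ^ h * μ (y j)                             ≈⟨ +-congˡ (*-congˡ (μ-y j)) ⟩
      μ u + σᴬ ^ h * (geom 1# (σᴬ ^ h) j * μ u)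
        ≈⟨ linear₁ (- μ u) (1^ j) (solve 4 (λ u τ g o → u :+ τ :* (g :* u) :+ (:- u) :* :1 := (τ :* g :+ o) :* u :+ (:- u) :* o) refl (μ u) (σᴬ ^ h) (geom 1# (σᴬ ^ h) j) (1# ^ j)) ⟩
      geom 1# (σᴬ ^ h) (suc j) * μ u                     ∎
      where
      1^ : ∀ k → 1# ^ k ≈ 1#
      1^ zero    = refl
      1^ (suc k) = trans (*-identityˡ (1# ^ k)) (1^ k)
    l≡ : suc l ≡ p ^ℕ (n ∸ c)
    l≡ = ℕ.suc-pred (p ^ℕ (n ∸ c)) ⦃ ℕ.m^n≢0 p (n ∸ c) ⦄
    y-l : y (suc l) ≈ˣ 1ˣ
    y-l = μ-injective (trans (μ-y (suc l)) (trans (*-congˡ (sym (element-μ x∈M)))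
      (trans (*-congʳ (reflexive (≡.cong (geom 1# (σᴬ ^ h)) l≡))) (trans Nx≈0 (sym μ-ε)))))
    found = Gal.hilbert90 Gal.order {h} {l} {proj₁ u} (ℕ.m^n>0 p c) (≡.trans (≡.cong (h *ℕ_) l≡)
        (≡.trans (ℕ.*-comm h _) (≡.sym (p^-split p c≤n)))) (proj₁ ∘ y) L.refl
        (λ j → L.*-congˡ (L.reflexive (iterate-unit (y j) h))) y-l
    βˣ : Unit
    βˣ = unit (proj₁ (proj₂ found))
    relation : μ u + μ (iterate σˣ βˣ h) ≈ μ βˣ
    relation = trans (sym (μ-∙ u _)) (μ-cong (L.trans (L.*-congˡ (L.reflexive (iterate-unit βˣ h))) (proj₂ (proj₂ found))))

  ξˣ : Unit
  ξˣ = ξ , ξ K.^ ℕ.pred p , L.trans (L.*-comm _ _) power , power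
    where
    power : ξ K.* ξ K.^ ℕ.pred p K.≈ K.1#
    power = L.trans (L.reflexive (≡.cong (ξ K.^_) (ℕ.suc-pred p))) (proj₁ ξ-root)

  ξ≉0 : ¬ μ ξˣ ≈ 0#
  ξ≉0 h = contradiction (∣.∣1⇒≡1 (proj₂ ξ-root 1 (L.trans (L.*-identityʳ ξ) (μ-injective (trans h (sym μ-ε))))))
    (ℕ.nonTrivial⇒≢1 ⦃ prime⇒nonTrivial p-prime ⦄)

  σξ : σᴬ * μ ξˣ ≈ μ ξˣ
  σξ = trans (σ-μ ξˣ) (μ-cong (σ.fixesBase ξ∈F))

  pξ : ι p * μ ξˣ ≈ 0#
  pξ = trans (ι-μ p ξˣ) (trans (μ-cong (L.trans (L.reflexive (^ˣ-unit ξˣ p)) (proj₁ ξ-root))) μ-ε)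

  p-torsion : ∀ {x} → IsElement x → ι p * x ≈ 0# → ∃[ j ] x ≈ ι j * μ ξˣ
  p-torsion {x} x∈M px = proj₁ found , trans (element-μ x∈M) (trans (μ-cong (L.trans (proj₂ found) (L.reflexive (≡.sym (^ˣ-unit ξˣ (proj₁ found)))))) (sym (ι-μ (proj₁ found) ξˣ)))
    where
    found = L.roots-of-unity p ξ-root (L.trans (L.reflexive (≡.sym (^ˣ-unit (element x) p)))
      (μ-injective (trans (sym (ι-μ p (element x))) (trans (*-congˡ (sym (element-μ x∈M))) (trans px (sym μ-ε))))))

  cyclicModule : CyclicModule _ _ _
  cyclicModule = record
    { R = R ; σ = σᴬ ; ξ = μ ξˣ ; p-prime = p-prime ; n = n ; 1≤n = 1≤n ; M = IsElement ; M-ideal = isIdeal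
    ; σ-order = σ-order ; hilbert90 = hilbert90
    ; ξ∈M = μ-element ξˣ ; ξ≉0 = ξ≉0 ; σξ = σξ ; pξ = pξ ; p-torsion = p-torsion }

  module Min = Minimality cyclicModule
  open Min using (HasPair)
  open Levels n using (level; height)
  open Pairs cyclicModule using (At; Below; IsPair; S; L; P; N; S-+)

  ιᶻ-μ : ∀ z u → ιᶻ z * μ u ≈ μ (u ^ᶻ z)
  ιᶻ-μ (+ k)    u = trans (*-congʳ (reflexive (≡.sym (ι≡ι k)))) (ι-μ k u)
  ιᶻ-μ -[1+ k ] u = begin
    ιᶻ -[1+ k ] * μ u            ≈⟨ *-congʳ (-‿cong (reflexive (≡.sym (ι≡ι (suc k))))) ⟩
    - ι (suc k) * μ u            ≈⟨ solve 2 (λ i u → (:- i) :* u := :- (i :* u)) refl (ι (suc k)) (μ u) ⟩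
    - (ι (suc k) * μ u)          ≈⟨ -‿cong (ι-μ (suc k) u) ⟩
    - μ (u ^ˣ suc k)             ≈⟨ μ-⁻¹ _ ⟨
    μ ((u ^ˣ suc k) ⁻¹ˣ)         ∎

  ι-+≡ιᶻ : ∀ k → ι k ≈ ιᶻ (+ k)
  ι-+≡ιᶻ k = reflexive (ι≡ι k)

  At⇒InKᵢ : ∀ {u} l → At (μ u) l → InKᵢ u l
  At⇒InKᵢ ⊥₋    h = one (μ-injective (trans h (sym μ-ε)))
  At⇒InKᵢ {u} [ i ] h = mem (Gal.fixed⊆Kᵢ i (ℕ.m^n>0 p (toℕ i))
    (L.trans (L.reflexive (≡.sym (iterate-unit u (p ^ℕ toℕ i)))) (μ-injective (trans (sym (σ^-μ (p ^ℕ toℕ i) u)) h))))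

  InKᵢ⇒At : ∀ {u} l → InKᵢ u l → At (μ u) l
  InKᵢ⇒At ⊥₋    (one h) = trans (μ-cong h) μ-ε
  InKᵢ⇒At {u} [ i ] (mem h) = trans (σ^-μ (p ^ℕ toℕ i) u)
    (μ-cong (L.trans (L.reflexive (iterate-unit u (p ^ℕ toℕ i))) (Gal.Kᵢ⊆fixed i h)))

  S-μ : ∀ {m} (δ : Fin (suc m) → Unit) → S (λ i → μ (δ i)) ≈ μ (∏ˣ (λ i → δ i ^ˣ (p ^ℕ toℕ i)))
  S-μ δ = trans (∑-cong (λ i → ι-μ (p ^ℕ toℕ i) (δ i))) (∑-μ (λ i → δ i ^ˣ (p ^ℕ toℕ i)))

  L-μ : ∀ {m} (δ : Fin (suc m) → Unit) → L (λ i → μ (δ i)) ≈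
        μ (norm (n ∸ 1) (δ zero)) + μ (∏ˣ (λ (i : Fin m) → norm n (δ (suc i)) ^ˣ (p ^ℕ toℕ i)))
  L-μ δ = +-cong (norm-μ (p ^ℕ (n ∸ 1)) (δ zero))
    (trans (∑-cong (λ i → trans (*-congˡ (norm-μ P (δ (suc i)))) (ι-μ (p ^ℕ toℕ i) (norm n (δ (suc i))))))
      (∑-μ (λ i → norm n (δ (suc i)) ^ˣ (p ^ℕ toℕ i))))

  multiplier : ∀ d (d∈U₁ : + p ∣ᶻ (d -ᶻ 1ℤ)) → ιᶻ d ≈ 1# + ι p * ιᶻ (quotient d∈U₁)
  multiplier d d∈U₁ = begin
    ιᶻ d                                             ≡⟨ ≡.cong ιᶻ (≡.sym d≡) ⟩
    ιᶻ (1ℤ +ᶻ (d -ᶻ 1ℤ))                             ≡⟨ ≡.cong (λ z → ιᶻ (1ℤ +ᶻ z)) (_∣ᶻ_.equality d∈U₁) ⟩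
    ιᶻ (1ℤ +ᶻ quotient d∈U₁ *ᶻ + p)                  ≈⟨ trans (ιᶻ-+ 1ℤ (quotient d∈U₁ *ᶻ + p)) (+-congˡ (ιᶻ-* (quotient d∈U₁) (+ p))) ⟩
    1# + ιᶻ (quotient d∈U₁) * ιᶻ (+ p)               ≈⟨ +-congˡ (trans (*-comm _ _) (*-congʳ (sym (ι-+≡ιᶻ p)))) ⟩
    1# + ι p * ιᶻ (quotient d∈U₁)                    ∎
    where
    d≡ : 1ℤ +ᶻ (d -ᶻ 1ℤ) ≡ d
    d≡ = ≡.trans (ℤ.+-comm 1ℤ (d -ᶻ 1ℤ)) (≡.trans (ℤ.+-assoc d (ℤ.- 1ℤ) 1ℤ) (ℤ.+-identityʳ d))

  module _ {m} (a : Vec Index (suc m)) where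

    below-lookup : (∀ (i : Fin (suc m)) → toℕ i ≡ 0 → lookup a i <₋ [ fromℕ n ]) → Below (level a zero)
    below-lookup bound c eq = below (≡.trans (Min.lookup-level a zero) eq) (bound zero ≡.refl)
      where
      below : ∀ {l} → l ≡ [ c ] → l <₋ [ fromℕ n ] → toℕ c < n
      below ≡.refl [ h ] = ≡.subst (toℕ c <_) (Fin.toℕ-fromℕ n) h

    lookup-below : Below (level a zero) → ∀ (i : Fin (suc m)) → toℕ i ≡ 0 → lookup a i <₋ [ fromℕ n ]
    lookup-below below zero _ = bound (lookup a zero) (λ c eq → below c (≡.trans (≡.sym (Min.lookup-level a zero)) eq))
      where
      bound : ∀ l → Below l → l <₋ [ fromℕ n ]
      bound ⊥₋    _ = ⊥₋<[ _ ]
      bound [ c ] h = [ ≡.subst (toℕ c <_) (≡.sym (Fin.toℕ-fromℕ n)) (h c ≡.refl) ]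

    top-or-lower : ∀ {ℓ} {Q : Fin (suc (suc m)) → Set ℓ} → (∀ i → Q (inject₁ i)) → Q (fromℕ (suc m)) → ∀ i → Q i
    top-or-lower {Q = Q} lower top i with suc m ℕ.≟ toℕ i
    ... | yes eq = ≡.subst Q (Fin.toℕ-injective (≡.trans (Fin.toℕ-fromℕ (suc m)) eq)) top
    ... | no  ne = ≡.subst Q (Fin.inject₁-lower₁ i ne) (lower (Fin.lower₁ i ne))

    toPair : ∀ {d} (pair : IsNormPair ξ a d) → HasPair a (ιᶻ (quotient (IsNormPair.d∈U₁ pair)))
    toPair {d} pair = μ α , (λ i → μ (δ i)) , record
      { y∈M     = μ-element α
      ; x∈M     = λ i → μ-element (δ i)
      ; at      = top-or-lower (λ i → ≡.subst (At (μ (δ (inject₁ i)))) (Min.lookup-level a i) (InKᵢ⇒At (lookup a i) (δ∈Kᵢ i)))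
          (Shifting.At-top cyclicModule a (μ-element (δ (fromℕ (suc m)))))
      ; twisted = begin
          σᴬ * μ α                                      ≈⟨ trans (σ-μ α) (μ-cong σα) ⟩
          μ (α ^ᶻ d ∙ˣ ∏ˣ (λ i → δ i ^ˣ (p ^ℕ toℕ i)))  ≈⟨ μ-∙ _ _ ⟩
          μ (α ^ᶻ d) + μ (∏ˣ (λ i → δ i ^ˣ (p ^ℕ toℕ i))) ≈⟨ +-cong (trans (sym (ιᶻ-μ d α)) (*-congʳ (multiplier d d∈U₁))) (sym (S-μ δ)) ⟩
          (1# + ι p * ιᶻ (quotient d∈U₁)) * μ α + S (λ i → μ (δ i)) ∎
      ; normed  = begin
          μ ξˣ                                          ≈⟨ μ-cong {ξˣ} ξ≈norms ⟩
          μ ((norm n α ^ᶻ quotient d∈U₁ ∙ˣ norm (n ∸ 1) (δ zero)) ∙ˣ rest)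
            ≈⟨ trans (μ-∙ _ _) (+-congʳ (μ-∙ _ _)) ⟩
          μ (norm n α ^ᶻ quotient d∈U₁) + μ (norm (n ∸ 1) (δ zero)) + μ rest
            ≈⟨ trans (+-assoc _ _ _) (+-cong (trans (sym (ιᶻ-μ (quotient d∈U₁) (norm n α))) (*-congˡ (sym (norm-μ P α)))) (sym (L-μ δ))) ⟩
          ιᶻ (quotient d∈U₁) * (N P * μ α) + L (λ i → μ (δ i)) ∎
      }
      where
      open IsNormPair pair
      open Represents represents
      rest = ∏ˣ (λ (i : Fin (suc m)) → norm n (δ (suc i)) ^ˣ (p ^ℕ toℕ i))

    fromPair : ∀ {d} (d∈U₁ : + p ∣ᶻ (d -ᶻ 1ℤ)) → Below (level a zero) → HasPair a (ιᶻ (quotient d∈U₁)) → IsNormPair ξ a d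
    fromPair {d} d∈U₁ below (y , x , pair) = record
      { a₀<n = lookup-below below
      ; d∈U₁ = d∈U₁
      ; α    = α
      ; δ    = δ
      ; represents = record
        { δ∈Kᵢ    = λ i → At⇒InKᵢ (lookup a i) (≡.subst (At (μ (δ (inject₁ i)))) (≡.sym (Min.lookup-level a i))
            (Lowering.At-resp cyclicModule (level a (inject₁ i)) (element-μ (x∈M (inject₁ i))) (at (inject₁ i))))
        ; σα      = μ-injective (begin
            μ (σˣ α)                                      ≈⟨ σ-μ α ⟨
            σᴬ * μ α                                      ≈⟨ *-congˡ (element-μ y∈M) ⟨
            σᴬ * y                                        ≈⟨ twisted ⟩
            (1# + ι p * ιᶻ (quotient d∈U₁)) * y + S x     ≈⟨ +-cong (*-cong (sym (multiplier d d∈U₁)) (element-μ y∈M)) S-x ⟩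
            ιᶻ d * μ α + S (λ i → μ (δ i))                ≈⟨ +-cong (ιᶻ-μ d α) (S-μ δ) ⟩
            μ (α ^ᶻ d) + μ (∏ˣ (λ i → δ i ^ˣ (p ^ℕ toℕ i))) ≈⟨ μ-∙ _ _ ⟨
            μ (α ^ᶻ d ∙ˣ ∏ˣ (λ i → δ i ^ˣ (p ^ℕ toℕ i)))  ∎)
        ; ξ≈norms = μ-injective {ξˣ} (begin
            μ ξˣ                                          ≈⟨ normed ⟩
            ιᶻ (quotient d∈U₁) * (N P * y) + L x
              ≈⟨ +-cong (*-congˡ (trans (*-congˡ (element-μ y∈M)) (norm-μ P α))) (trans L-x (L-μ δ)) ⟩
            ιᶻ (quotient d∈U₁) * μ (norm n α) + (μ (norm (n ∸ 1) (δ zero)) + μ rest)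
              ≈⟨ trans (+-congʳ (ιᶻ-μ (quotient d∈U₁) (norm n α))) (sym (+-assoc _ _ _)) ⟩
            μ (norm n α ^ᶻ quotient d∈U₁) + μ (norm (n ∸ 1) (δ zero)) + μ rest
              ≈⟨ trans (μ-∙ _ _) (+-congʳ (μ-∙ _ _)) ⟨
            μ ((norm n α ^ᶻ quotient d∈U₁ ∙ˣ norm (n ∸ 1) (δ zero)) ∙ˣ rest) ∎)
        }
      }
      where
      open IsPair pair
      α : Unit
      α = element y
      δ : Fin (suc (suc m)) → Unit
      δ i = element (x i)
      rest = ∏ˣ (λ (i : Fin (suc m)) → norm n (δ (suc i)) ^ˣ (p ^ℕ toℕ i))
      S-x : S x ≈ S (λ i → μ (δ i))
      S-x = ∑-cong (λ i → *-congˡ (element-μ (x∈M i)))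
      L-x : L x ≈ L (λ i → μ (δ i))
      L-x = +-cong (*-congˡ (element-μ (x∈M zero))) (∑-cong (λ i → *-congˡ (*-congˡ (element-μ (x∈M (suc i))))))

-- Truncated valuations.

module Valuation {p : ℕ} (p-prime : Prime p) where

  private
    1<p : 1 < p
    1<p = ℕ.nonTrivial⇒n>1 p ⦃ prime⇒nonTrivial p-prime ⦄

    k<p^k : ∀ k → k < p ^ℕ k
    k<p^k zero    = z<s
    k<p^k (suc k) = ℕ.≤-<-trans (k<p^k k) (ℕ.^-monoʳ-< p 1<p (ℕ.n<1+n k))

  greatestExponent-∣ : ∀ x b → p ^ℕ greatestExponent p x b ∣ x
  greatestExponent-∣ x zero = ∣.1∣ x
  greatestExponent-∣ x (suc b) with p ^ℕ suc b ∣? x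
  ... | yes h = h
  ... | no  _ = greatestExponent-∣ x b

  ≤-greatestExponent : ∀ x b k → k ≤ b → p ^ℕ k ∣ x → k ≤ greatestExponent p x b
  ≤-greatestExponent x zero    k k≤b h = k≤b
  ≤-greatestExponent x (suc b) k k≤b h with p ^ℕ suc b ∣? x
  ... | yes _ = k≤b
  ... | no ¬h with ℕ.m≤n⇒m<n∨m≡n k≤b
  ...   | inj₁ (s≤s k≤b′) = ≤-greatestExponent x b k k≤b′ h
  ...   | inj₂ ≡.refl     = contradiction h ¬h

  private
    bounded : ∀ x k → p ^ℕ k ∣ suc x → k ≤ greatestExponent p (suc x) (suc x)
    bounded x k h = ≤-greatestExponent (suc x) (suc x) k (ℕ.≤-trans (ℕ.<⇒≤ (k<p^k k)) (∣.∣⇒≤ h)) h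

    ∣-of-≤ : ∀ x k → k ≤ greatestExponent p x x → p ^ℕ k ∣ x
    ∣-of-≤ x k h = ∣.∣-trans (∣.divides (p ^ℕ (greatestExponent p x x ∸ k)) (p^-split p h)) (greatestExponent-∣ x x)

  -- Together with `valuation-∣` this reduces comparisons of truncated valuations to divisibility by
  -- p ^ k for k ≤ m, which needs no exception for z = 0.
  ≤-valuation : ∀ {m} z k → k ≤ m → + (p ^ℕ k) ∣ᶻ z → k ≤ m ⊓⁺ valuation p z
  ≤-valuation (+ 0)     k k≤m h = k≤m
  ≤-valuation (+ suc x) k k≤m h = ℕ.⊓-glb k≤m (bounded x k (ℤ.∣⇒∣ᵤ h))
  ≤-valuation -[1+ x ]  k k≤m h = ℕ.⊓-glb k≤m (bounded x k (ℤ.∣⇒∣ᵤ h))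

  valuation-∣ : ∀ {m} z k → k ≤ m ⊓⁺ valuation p z → k ≤ m × + (p ^ℕ k) ∣ᶻ z
  valuation-∣ {m} (+ 0)     k h = h , ℤ.∣ᵤ⇒∣ (∣._∣0 (p ^ℕ k))
  valuation-∣ {m} (+ suc x) k h = ℕ.≤-trans h (ℕ.m⊓n≤m m _) , ℤ.∣ᵤ⇒∣ (∣-of-≤ (suc x) k (ℕ.≤-trans h (ℕ.m⊓n≤n m _)))
  valuation-∣ {m} -[1+ x ]  k h = ℕ.≤-trans h (ℕ.m⊓n≤m m _) , ℤ.∣ᵤ⇒∣ (∣-of-≤ (suc x) k (ℕ.≤-trans h (ℕ.m⊓n≤n m _)))

-- Roots of unity in the algebraic closure.

module ClosureRoots {c ℓ₁ ℓ₂} s (em : ExcludedMiddle (c ⊔ ℓ₁ ⊔ ℓ₂ ⊔ s)) (K : HeytingField c ℓ₁ ℓ₂) (K̄ : AlgebraicClosure K)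
  {p : ℕ} (p-prime : Prime p) (ξ : FieldOps.Carrier K) (ξ-root : FieldOps.IsPrimitiveRoot K p ξ) where

  open AlgebraicClosure K̄
  private
    instance
      p≢0 : NonZero p
      p≢0 = prime⇒nonZero p-prime
    module K = LinearAlgebra s em K
    module Ω = LinearAlgebra s em Ω
    module Embed = RingMorphisms.IsRingMonomorphism isRingMonomorphism

  embed-^ : ∀ x k → embed (x K.^ k) Ω.≈ embed x Ω.^ k
  embed-^ x zero    = Embed.1#-homo
  embed-^ x (suc k) = Ω.trans (Embed.*-homo x (x K.^ k)) (Ω.*-congˡ (embed-^ x k))

  embed-one : ∀ {x k} → x K.^ k K.≈ K.1# → embed x Ω.^ k Ω.≈ Ω.1#
  embed-one {x} {k} h = Ω.trans (Ω.sym (embed-^ x k)) (Ω.trans (Embed.⟦⟧-cong h) Embed.1#-homo)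

  μ-monotone : ∀ {t} {L : Pred K.Carrier t} {j k} → j ≤ k → μ (p ^ℕ k) ⊆ L → μ (p ^ℕ j) ⊆ L
  μ-monotone {j = j} {k} j≤k μ⊆L z z1 = μ⊆L z (Ω.trans (Ω.reflexive (≡.cong (z Ω.^_) (p^-split p j≤k)))
    (Ω.trans (Ω.sym (Ω.^-^ z (p ^ℕ j) (p ^ℕ (k ∸ j)))) (Ω.trans (Ω.^-congˡ (p ^ℕ (k ∸ j)) z1) (Ω.^-one (p ^ℕ (k ∸ j))))))

  embed-root : FieldOps.IsPrimitiveRoot Ω p (embed ξ)
  embed-root = embed-one {ξ} {p} (proj₁ ξ-root) ,
    λ k h → proj₂ ξ-root k (Embed.injective (Ω.trans (embed-^ ξ k) (Ω.trans h (Ω.sym Embed.1#-homo))))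

  -- Such a w has order p ^ (e + 1), and by `prime-power-roots` in the closure all roots of unity of
  -- this order are powers of its image.
  μ-generated : ∀ {t} {L : Pred K.Carrier t} → K.1# ∈ L → (∀ {x y} → x ∈ L → y ∈ L → x K.* y ∈ L) →
                ∀ e {w} → w ∈ L → w K.^ (p ^ℕ e) K.≈ ξ → μ (p ^ℕ suc e) ⊆ L
  μ-generated {L = L} 1∈L *∈L e {w} w∈L wξ z z1 = w K.^ proj₁ found , power (proj₁ found) ,
      Ω.trans (embed-^ w (proj₁ found)) (Ω.sym (proj₂ found))
    where
    found = Ω.prime-power-roots p embed-root e (Ω.trans (Ω.sym (embed-^ w (p ^ℕ e))) (Embed.⟦⟧-cong wξ)) z1
    power : ∀ k → w K.^ k ∈ L
    power zero    = 1∈L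
    power (suc k) = *∈L w∈L (power k)

  -- A zero of X ^ p - w in the closure is a root of unity of order dividing p ^ (k + 1), and the
  -- hypothesis brings it down to L.
  p-th-root : ∀ {t} {L : Pred K.Carrier t} k {w} → w K.^ (p ^ℕ k) K.≈ K.1# → μ (p ^ℕ suc k) ⊆ L → ∃[ x ] x ∈ L × x K.^ p K.≈ w
  p-th-root k {w} w1 μ⊆L = proj₁ inside , proj₁ (proj₂ inside) ,
      Embed.injective (Ω.trans (embed-^ (proj₁ inside) p) (Ω.trans (Ω.^-congˡ p (proj₂ (proj₂ inside))) z^p))
    where
    p₋ : ℕ
    p₋ = ℕ.pred p
    coefficient : Fin (suc p₋) → Ω.Carrier
    coefficient zero    = Ω.- embed w
    coefficient (suc i) = Ω.0#
    root = closed p₋ coefficient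
    z = proj₁ root
    z^p : z Ω.^ p Ω.≈ embed w
    z^p = Ω.linear₃ Ω.1# (Ω.trans (Ω.+-congˡ (Ω.reflexive (Ω.∑≡sum (λ i → coefficient i Ω.* z Ω.^ toℕ i)))) (proj₂ root))
        (Ω.- Ω.1#) (Ω.trans (Ω.∑-suc (λ i → coefficient i Ω.* z Ω.^ toℕ i)) (Ω.+-congˡ (Ω.∑-zero (λ i → Ω.zeroˡ (z Ω.^ suc (toℕ i))))))
        (Ω.1#) (Ω.reflexive (≡.cong (z Ω.^_) (≡.sym (ℕ.suc-pred p))))
      (Ω.solve 5 (λ u v w S o → u Ω.:+ Ω.:1 Ω.:* Ω.con 0ℤ Ω.:+ (Ω.:- Ω.:1) Ω.:* ((Ω.:- w) Ω.:* Ω.:1 Ω.:+ Ω.con 0ℤ) Ω.:+ Ω.:1 Ω.:* v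
        Ω.:= w Ω.:+ Ω.:1 Ω.:* (v Ω.:+ S) Ω.:+ (Ω.:- Ω.:1) Ω.:* S Ω.:+ Ω.:1 Ω.:* u) Ω.refl
        (z Ω.^ p) (z Ω.^ suc p₋) (embed w) (Ω.∑ (λ i → coefficient i Ω.* z Ω.^ toℕ i)) Ω.0#)
    inside = μ⊆L z (Ω.trans (Ω.reflexive (≡.cong (z Ω.^_) (ℕ.*-comm p (p ^ℕ k)))) (Ω.trans (Ω.sym (Ω.^-^ z p (p ^ℕ k)))
      (Ω.trans (Ω.^-congˡ (p ^ℕ k) z^p) (embed-one {w} {p ^ℕ k} w1))))

unit-embedding : ∀ {c ℓ₁ ℓ₂ s} (K : HeytingField c ℓ₁ ℓ₂) {p n : ℕ} (K/F : CyclicExtension K s p n) →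
                 Embedding (FieldOps.unitGroup K) (CyclicExtension.σˣ K/F)
unit-embedding K K/F = Idealization.embedding (FieldOps.unitGroup K) (CyclicExtension.σˣ K/F)
  (Automorphism.⟦⟧-cong σ) (λ u v → Automorphism.*-homo σ (proj₁ u) (proj₁ v))
  where open CyclicExtension K/F using (σ)

-- The three claims for a minimal norm pair.

module MinimalNormPair {c ℓ₁ ℓ₂ s₀} (H : Setup c ℓ₁ ℓ₂ s₀) (K̄ : AlgebraicClosure (Setup.K H))
  (-1-norm : Setup.p H ≡ 2 → Setup.n H ≡ 1 →
    ∃[ u ] FieldOps._≈_ (Setup.K H) (proj₁ (CyclicExtension.norm (Setup.K/F H) (Setup.n H) u)) (FieldOps.-_ (Setup.K H) (FieldOps.1# (Setup.K H))))
  {m : ℕ} (a : Vec (CyclicExtension.Index (Setup.K/F H)) (suc m)) {d : ℤ}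
  (minimal : CyclicExtension.IsMinimalNormPair (Setup.K/F H) (Setup.ξ H) a d) where

  open Setup H
  open CyclicExtension K/F
  open Embedding embedding
  open Translation H hiding (p≢0)
  open ClosureRoots s₀ em K K̄ p-prime ξ ξ-root
  open AlgebraicClosure K̄ using (embed; isRingMonomorphism; IsRootExponent) renaming (μ_⊆_ to Roots_⊆_)
  open Valuation p-prime
  private
    instance
      p≢0 : NonZero p
      p≢0 = prime⇒nonZero p-prime
      p^≢0 : NonZero (p ^ℕ m)
      p^≢0 = ℕ.m^n≢0 p m
    module K = FieldOps K
    module L = LinearAlgebra s₀ em K
    module Ω = LinearAlgebra s₀ em (AlgebraicClosure.Ω K̄)
    module Embed = RingMorphisms.IsRingMonomorphism isRingMonomorphism
    module σ = Automorphism σ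
    module Sh = Shifting cyclicModule
    module Lo = Lowering cyclicModule
  open K using (Unit; _≈ˣ_; _^ˣ_; _^ᶻ_)
  open Geometric R
  open Families R
  open Levels n using (level; height)
  open Pairs cyclicModule using (At; At-0; At-single; Below; IsPair; S; P; N; S-single; L-single-suc)
  open Min using (HasPair)
  open AddInfimum (Fin._<_ {suc n}) using (<₋-asym)
  open import Relation.Binary.Reasoning.Setoid setoid

  private
    pair : IsNormPair ξ a d
    pair = proj₁ minimal

    d∈U₁ : + p ∣ᶻ (d -ᶻ 1ℤ)
    d∈U₁ = IsNormPair.d∈U₁ pair

    below : Below (level a zero)
    below = below-lookup a (IsNormPair.a₀<n pair)

    -- Only d mod p ^ m matters, so d may be replaced by the natural number 1 + p s.
    s : ℕ
    s = quotient d∈U₁ ℤ.%ℕ (p ^ℕ m)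

    t : ℤ
    t = quotient d∈U₁ ℤ./ℕ (p ^ℕ m)

    ιq≈ : ιᶻ (quotient d∈U₁) ≈ ι s + ιᶻ t * ι (p ^ℕ m)
    ιq≈ = begin
      ιᶻ (quotient d∈U₁)                   ≡⟨ ≡.cong ιᶻ (ℤ.a≡a%ℕn+[a/ℕn]*n (quotient d∈U₁) (p ^ℕ m)) ⟩
      ιᶻ (+ s +ᶻ t *ᶻ + (p ^ℕ m))          ≈⟨ trans (ιᶻ-+ (+ s) (t *ᶻ + (p ^ℕ m))) (+-congˡ (ιᶻ-* t (+ (p ^ℕ m)))) ⟩
      ιᶻ (+ s) + ιᶻ t * ιᶻ (+ (p ^ℕ m))    ≈⟨ +-cong (sym (ι-+≡ιᶻ s)) (*-congˡ (sym (ι-+≡ιᶻ (p ^ℕ m)))) ⟩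
      ι s + ιᶻ t * ι (p ^ℕ m)              ∎

    pair-s : HasPair a (ι s)
    pair-s = let y , x , pr = toPair a pair in
      y , Sh.shift (- ιᶻ t) pr (Sh.absorbed-top a (IsPair.y∈M pr))
        (linear₁ (- 1#) ιq≈ (solve 4 (λ s t u q → s :+ (:- :1) :* (s :+ t :* u) := q :+ (:- t) :* u :+ (:- :1) :* q) refl (ι s) (ιᶻ t) (ι (p ^ℕ m)) (ιᶻ (quotient d∈U₁))))

    lex-asym : ∀ {a b : Vec Index (suc m)} → Lex-< _≡_ _<₋_ a b → ¬ Lex-< _≡_ _<₋_ b a
    lex-asym = <-asym ≡.sym (≡.resp₂ _<₋_) (<₋-asym Fin.<-asym)

    minimal-a : Min.Minimal a
    minimal-a a′ s′ has below′ a′<a = not-≼ (proj₂ minimal a′ d′ (fromPair a′ d′∈U₁ below′ (≡.subst (HasPair a′) (ι≡ι s′) has)))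
      where
      d′ : ℤ
      d′ = 1ℤ +ᶻ + s′ *ᶻ + p
      d′∈U₁ : + p ∣ᶻ (d′ -ᶻ 1ℤ)
      d′∈U₁ = divides (+ s′) (solveᶻ 1 (λ x → conᶻ 1ℤ ⊕ x ⊖ conᶻ 1ℤ ⊜ x) ≡.refl (+ s′ *ᶻ + p))
        where open Data.Integer.Solver.+-*-Solver renaming (solve to solveᶻ; _:+_ to _⊕_; _:-_ to _⊖_; _:=_ to _⊜_; con to conᶻ)
      not-≼ : ¬ _≼_ ξ (a , d) (a′ , d′)
      not-≼ (inj₁ a<a′)        = lex-asym a<a′ a′<a
      not-≼ (inj₂ (≡.refl , _)) = lex-asym a′<a a′<a

    -- If p = 2 and n = 1, then ξ = -1 is the norm of some u. So p u has trivial norm and equals (σ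
    -- - 1) y by Hilbert 90. Now y with u in slot one and nothing in slot zero is a pair for d = 1,
    -- so a minimal a has no level at all in slot zero.
    good : Min.Good a
    good c level≡ with (p ℕ.≟ 2) ×-dec (n ℕ.≟ 1)
    ... | no  ordinary    = p∣p^c*tri p-prime (below c level≡) ordinary
    ... | yes (p≡2 , n≡1) = contradiction (Min.lowered-< a zero level≡ Lo.absent)
            (minimal-a (Lo.lowered a zero ⊥₋) 0 (y , x , norm-pair) (Min.lowered-below a zero level≡ Lo.absent below))
      where
      u : Unit
      u = proj₁ (-1-norm p≡2 n≡1)
      ξ≈-1 : ξ K.≈ K.- K.1#
      ξ≈-1 = L.linear₁ L.1# (L.*-cancel-0 ξ-1≉0 product) (L.solve 2 (λ ξ o → ξ L.:+ L.:1 L.:* L.con 0ℤ L.:= (L.:- L.:1) L.:+ L.:1 L.:* (ξ L.:+ L.:1)) L.refl ξ L.0#)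
        where
        ξ-1≉0 : ¬ ξ L.- L.1# L.≈ L.0#
        ξ-1≉0 h = contradiction (∣.∣1⇒≡1 (proj₂ ξ-root 1 (L.linear₁ L.1# h
            (L.solve 1 (λ ξ → ξ L.:* L.:1 L.:+ L.:1 L.:* L.con 0ℤ L.:= L.:1 L.:+ L.:1 L.:* (ξ L.:- L.:1)) L.refl ξ))))
          (ℕ.nonTrivial⇒≢1 ⦃ prime⇒nonTrivial p-prime ⦄)
        product : (ξ L.- L.1#) L.* (ξ L.+ L.1#) L.≈ L.0#
        product = L.linear₁ L.1# (≡.subst (λ k → ξ L.^ k L.≈ L.1#) p≡2 (proj₁ ξ-root))
          (L.solve 1 (λ ξ → (ξ L.:- L.:1) L.:* (ξ L.:+ L.:1) L.:+ L.:1 L.:* L.:1 L.:= L.con 0ℤ L.:+ L.:1 L.:* (ξ L.:* (ξ L.:* L.:1))) L.refl ξ)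
      N-u : N P * μ u ≈ μ ξˣ
      N-u = trans (norm-μ P u) (μ-cong (L.trans (proj₂ (-1-norm p≡2 n≡1)) (L.sym ξ≈-1)))
      h90 = Lo.kernel-N (IsIdeal.*-closed isIdeal (ι p) (μ-element u))
        (trans (solve 3 (λ n p u → n :* (p :* u) := p :* (n :* u)) refl (N P) (ι p) (μ u)) (trans (*-congˡ N-u) pξ))
      y : Carrier
      y = proj₁ h90
      x : Fin (suc (suc m)) → Carrier
      x = single (suc zero) (μ u)
      x∈M : ∀ i → IsElement (x i)
      x∈M = single-closed IsElement (IsIdeal.0∈ isIdeal) (suc zero) (μ-element u)
      norm-pair : IsPair (Lo.lowered a zero ⊥₋) (ι 0) y x
      norm-pair = record
        { y∈M     = proj₁ (proj₂ h90)
        ; x∈M     = x∈M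
        ; at      = Lo.At-lowered a zero x x∈M (λ _ ()) refl
        ; twisted = linear₄ (- 1#) (proj₂ (proj₂ h90)) (- (ι p * y)) ι-0 (- 1#) (S-single (suc zero) (μ u)) (- μ u) (ι-cong (ℕ.*-identityʳ p))
            (solve 8 (λ σ y p u o S q z → σ :* y :+ (:- :1) :* ((σ :- :1) :* y) :+ (:- (p :* y)) :* con ℤ.0ℤ :+ (:- :1) :* (q :* u) :+ (:- u) :* p
              := (:1 :+ p :* o) :* y :+ S :+ (:- :1) :* (p :* u) :+ (:- (p :* y)) :* o :+ (:- :1) :* S :+ (:- u) :* q)
             refl σᴬ y (ι p) (μ u) (ι 0) (S x) (ι (p ^ℕ 1)) 0#)
        ; normed  = sym (trans (+-cong (trans (*-congʳ ι-0) (zeroˡ _)) (trans (L-single-suc zero (μ u)) (trans (*-congʳ ι-1) (*-identityˡ _))))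
            (trans (+-identityˡ _) N-u))
        }

    abstract
      conclusion : Min.Conclusion a s
      conclusion = Min.conclusion a s below good minimal-a pair-s

    open Min.Conclusion conclusion

    e : ℕ
    e = suc e′

    killed : ∀ {k} → e ≤ k → ι (p ^ℕ k) * root ≈ 0#
    killed {k} e≤k = linear₄ root (trans (ι-cong (p^-split p e≤k)) (ι-* (p ^ℕ (k ∸ e)) (p ^ℕ e))) (ι (p ^ℕ (k ∸ e)) * root) (ι-* p (p ^ℕ e′))
        (ι (p ^ℕ (k ∸ e)) * ι p) root-order (ι (p ^ℕ (k ∸ e))) pξ
      (solve 7 (λ k r l e p e′ ξ → k :* r :+ r :* (l :* e) :+ l :* r :* (p :* e′) :+ l :* p :* ξ :+ l :* con ℤ.0ℤ
        := con ℤ.0ℤ :+ r :* k :+ l :* r :* e :+ l :* p :* (e′ :* r) :+ l :* (p :* ξ)) refl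
        (ι (p ^ℕ k)) root (ι (p ^ℕ (k ∸ e))) (ι (p ^ℕ e)) (ι p) (ι (p ^ℕ e′)) (μ ξˣ))

    -- The root was built for 1 + p s, which differs from d by a multiple of p ^ (m + 1), and this
    -- power kills it because e ≤ m + 1.
    σ-root : σᴬ * root ≈ ιᶻ d * root
    σ-root = linear₄ 1# root-eigen root (trans (ι-suc (p *ℕ s)) (+-congˡ (ι-* p s))) (- root) (multiplier d d∈U₁) (- (ι p * root)) ιq≈
      (linear₂ (- ιᶻ t) (killed e≤m) (ιᶻ t * root) (ι-* p (p ^ℕ m))
      (solve 10 (λ σ r D s p z q t k k′ →
        σ :* r :+ :1 :* (s :* r) :+ r :* (:1 :+ p :* z) :+ (:- r) :* (:1 :+ p :* q) :+ (:- (p :* r)) :* (z :+ t :* k)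
          :+ (:- t) :* con ℤ.0ℤ :+ t :* r :* (p :* k)
        := D :* r :+ :1 :* (σ :* r) :+ r :* s :+ (:- r) :* D :+ (:- (p :* r)) :* q :+ (:- t) :* (k′ :* r) :+ t :* r :* k′)
       refl σᴬ root (ιᶻ d) (ι (suc (p *ℕ s))) (ι p) (ι s) (ιᶻ (quotient d∈U₁)) (ιᶻ t) (ι (p ^ℕ m)) (ι (p ^ℕ suc m))))

    order : ∀ z → ιᶻ z * root ≈ 0# → + (p ^ℕ e) ∣ᶻ z
    order (+ k)    h = ℤ.∣ᵤ⇒∣ (Min.order e′ root-order (trans (*-congʳ (ι-+≡ιᶻ k)) h))
    order -[1+ k ] h = ℤ.∣ᵤ⇒∣ (Min.order e′ root-order (begin
      ι (suc k) * root              ≈⟨ *-congʳ (ι-+≡ιᶻ (suc k)) ⟩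
      ιᶻ (+ suc k) * root           ≈⟨ solve 2 (λ i r → i :* r := :- ((:- i) :* r)) refl (ιᶻ (+ suc k)) root ⟩
      - (ιᶻ -[1+ k ] * root)        ≈⟨ -‿cong h ⟩
      - 0#                          ≈⟨ solve 0 (:- con ℤ.0ℤ := con ℤ.0ℤ) refl ⟩
      0#                            ∎))

    order-difference : ∀ z z′ → ιᶻ z * root ≈ ιᶻ z′ * root → + (p ^ℕ e) ∣ᶻ (z -ᶻ z′)
    order-difference z z′ h = order (z -ᶻ z′) (linear₂ 1# h root
      (trans (ιᶻ-+ z (ℤ.- z′)) (+-congˡ (negated z′)))
      (solve 4 (λ d r z w → d :* r :+ :1 :* (w :* r) :+ r :* (z :+ (:- w)) := con ℤ.0ℤ :+ :1 :* (z :* r) :+ r :* d) refl (ιᶻ (z -ᶻ z′)) root (ιᶻ z) (ιᶻ z′)))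
      where
      negated : ∀ z → ιᶻ (ℤ.- z) ≈ - ιᶻ z
      negated z = linear₁ 1# (trans (sym (ιᶻ-+ z (ℤ.- z))) (trans (reflexive (≡.cong ιᶻ (ℤ.+-inverseʳ z))) refl))
        (solve 2 (λ z w → w :+ :1 :* con ℤ.0ℤ := (:- z) :+ :1 :* (z :+ w)) refl (ιᶻ z) (ιᶻ (ℤ.- z)))

    w : Unit
    w = element root

    root≈w : root ≈ μ w
    root≈w = element-μ root∈M

    wξ : proj₁ w K.^ (p ^ℕ e′) K.≈ ξ
    wξ = L.trans (L.reflexive (≡.sym (^ˣ-unit w (p ^ℕ e′))))
      (μ-injective {w ^ˣ (p ^ℕ e′)} {ξˣ} (trans (sym (ι-μ (p ^ℕ e′) w)) (trans (*-congˡ (sym root≈w)) root-order)))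

    w-killed : ∀ {k} → e ≤ k → w ^ˣ (p ^ℕ k) ≈ˣ K.1ˣ
    w-killed {k} e≤k = μ-injective (trans (sym (ι-μ (p ^ℕ k) w)) (trans (*-congˡ (sym root≈w)) (trans (killed e≤k) (sym μ-ε))))

    w-one : ∀ {k} → e ≤ k → proj₁ w K.^ (p ^ℕ k) K.≈ K.1#
    w-one {k} e≤k = L.trans (L.reflexive (≡.sym (^ˣ-unit w (p ^ℕ k)))) (w-killed e≤k)

    -- For v < e the powers of w exhaust the roots of unity of order p ^ e in the closure, and those
    -- of order p ^ (v + 1) are among them.
    e-bounded : ∀ {v} → ¬ (Roots (p ^ℕ suc v) ⊆ U) → e ≤ v
    e-bounded {v} ¬roots with e ℕ.≤? v
    ... | yes e≤v = e≤v
    ... | no  e≰v = contradiction (μ-monotone {L = U} (ℕ.≰⇒> e≰v) (μ-generated {L = U} tt (λ _ _ → tt) e′ tt wξ)) ¬roots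

    -- If K contained these roots, it would contain a p-th root of w, against `indivisible`.
    e-full : e < suc m → ¬ (Roots (p ^ℕ suc e) ⊆ U)
    e-full e<m roots = indivisible e<m (μ-element xˣ) (trans (ι-μ p xˣ)
        (trans (μ-cong {xˣ ^ˣ p} {w} (L.trans (L.reflexive (^ˣ-unit xˣ p)) (proj₂ (proj₂ found)))) (sym root≈w)))
      where
      found = p-th-root {L = U} e (w-one ℕ.≤-refl) roots
      x≉0 : ¬ proj₁ found K.≈ K.0#
      x≉0 x≈0 = L.1≉0 (L.trans (L.sym (proj₂ (proj₂ (proj₂ w)))) (L.trans (L.*-congʳ w≈0) (L.zeroˡ _)))
        where
        w≈0 : proj₁ w K.≈ K.0#
        w≈0 = L.trans (L.sym (proj₂ (proj₂ found))) (L.trans (L.reflexive (≡.cong (proj₁ found K.^_) (≡.sym (ℕ.suc-pred p))))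
          (L.trans (L.*-congʳ x≈0) (L.zeroˡ _)))
      xˣ : Unit
      xˣ = unit x≉0

    e-min : ∀ ν → IsRootExponent p U ν → e ≡ suc m ⊓⁺ ν
    e-min [ v ] (roots , ¬roots) with ℕ.m≤n⇒m<n∨m≡n e≤m
    ... | inj₂ e≡m = ≡.trans e≡m (≡.sym (ℕ.m≤n⇒m⊓n≡m (≡.subst (_≤ v) e≡m (e-bounded ¬roots))))
    ... | inj₁ e<m = ≡.trans e≡v (≡.sym (ℕ.m≥n⇒m⊓n≡n (≡.subst (_≤ suc m) e≡v (ℕ.<⇒≤ e<m))))
      where
      e≡v : e ≡ v
      e≡v with ℕ.m≤n⇒m<n∨m≡n (e-bounded ¬roots)
      ... | inj₂ e≡v = e≡v
      ... | inj₁ e<v = contradiction (μ-monotone {L = U} e<v roots) (e-full e<m)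
    e-min ⊤⁺ roots with ℕ.m≤n⇒m<n∨m≡n e≤m
    ... | inj₂ e≡m = e≡m
    ... | inj₁ e<m = contradiction (roots (suc e)) (e-full e<m)

    roots-F⇒fixed : Roots (p ^ℕ e) ⊆ Subfield.member F → σᴬ * root ≈ root
    roots-F⇒fixed roots = trans (*-congˡ root≈w) (trans (σ-μ w) (trans (μ-cong {σˣ w} {w} (σ.fixesBase w∈F)) (sym root≈w)))
      where
      found = roots (embed (proj₁ w)) (embed-one {proj₁ w} {p ^ℕ e} (w-one ℕ.≤-refl))
      w∈F : proj₁ w ∈ Subfield.member F
      w∈F = Subfield.resp F (Embed.injective (proj₂ (proj₂ found))) (proj₁ (proj₂ found))

    fixed⇒roots-F : σᴬ * root ≈ root → Roots (p ^ℕ e) ⊆ Subfield.member F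
    fixed⇒roots-F fixed = μ-generated {L = Subfield.member F} (Subfield.1∈ F) (Subfield.*-closed F) e′ w∈F wξ
      where
      w∈F : proj₁ w ∈ Subfield.member F
      w∈F = GaloisTheory.fixed⇒F em K K/F (μ-injective {σˣ w} {w} (trans (sym (σ-μ w)) (trans (*-congˡ (sym root≈w)) (trans fixed root≈w))))

    shifted : ∀ {d̃} (d̃∈U₁ : + p ∣ᶻ (d̃ -ᶻ 1ℤ)) → + (p ^ℕ e) ∣ᶻ (d̃ -ᶻ d) → IsNormPair ξ a d̃
    -- The shift is measured from s and not from (d - 1) / p = s + t p ^ m. Therefore t p ^ (m - e′)
    -- is added to the k belonging to d̃ - d.
    shifted {d̃} d̃∈U₁ (divides k d̃-d≡) = fromPair a d̃∈U₁ below (shifts (ιᶻ t * ι (p ^ℕ (m ∸ e′)) + ιᶻ k) (begin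
        ιᶻ (quotient d̃∈U₁)                       ≡⟨ ≡.cong ιᶻ q̃≡ ⟩
        ιᶻ (q +ᶻ k *ᶻ + (p ^ℕ e′))                ≈⟨ trans (ιᶻ-+ q (k *ᶻ + (p ^ℕ e′))) (+-congˡ (trans (ιᶻ-* k (+ (p ^ℕ e′))) (*-congˡ (sym (ι-+≡ιᶻ (p ^ℕ e′)))))) ⟩
        ιᶻ q + ιᶻ k * ι (p ^ℕ e′)
          ≈⟨ linear₂ 1# ιq≈ (ιᶻ t) (trans (ι-cong (p^-split p (ℕ.s≤s⁻¹ e≤m))) (ι-* (p ^ℕ (m ∸ e′)) (p ^ℕ e′)))
             (solve 7 (λ q k e s t u v → q :+ k :* e :+ :1 :* (s :+ t :* u) :+ t :* (v :* e) := s :+ (t :* v :+ k) :* e :+ :1 :* q :+ t :* u) refl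
               (ιᶻ q) (ιᶻ k) (ι (p ^ℕ e′)) (ι s) (ιᶻ t) (ι (p ^ℕ m)) (ι (p ^ℕ (m ∸ e′)))) ⟩
        ι s + (ιᶻ t * ι (p ^ℕ (m ∸ e′)) + ιᶻ k) * ι (p ^ℕ e′) ∎))
      where
      q : ℤ
      q = quotient d∈U₁
      open Data.Integer.Solver.+-*-Solver using () renaming (solve to solveᶻ; _:+_ to _⊕_; _:-_ to _⊖_; _:*_ to _⊗_; _:=_ to _⊜_; con to conᶻ)
      q̃≡ : quotient d̃∈U₁ ≡ q +ᶻ k *ᶻ + (p ^ℕ e′)
      q̃≡ = ℤ.*-cancelʳ-≡ _ _ (+ p) (≡R.begin
        quotient d̃∈U₁ *ᶻ + p                     ≡R.≡⟨ _∣ᶻ_.equality d̃∈U₁ ⟨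
        d̃ -ᶻ 1ℤ                                  ≡R.≡⟨ solveᶻ 2 (λ d̃ d → d̃ ⊖ conᶻ 1ℤ ⊜ (d̃ ⊖ d) ⊕ (d ⊖ conᶻ 1ℤ)) ≡.refl d̃ d ⟩
        (d̃ -ᶻ d) +ᶻ (d -ᶻ 1ℤ)                    ≡R.≡⟨ ≡.cong₂ _+ᶻ_ d̃-d≡ (_∣ᶻ_.equality d∈U₁) ⟩
        k *ᶻ + (p ^ℕ e) +ᶻ q *ᶻ + p              ≡R.≡⟨ ≡.cong (λ z → k *ᶻ z +ᶻ q *ᶻ + p) (ℤ.pos-* p (p ^ℕ e′)) ⟩
        k *ᶻ (+ p *ᶻ + (p ^ℕ e′)) +ᶻ q *ᶻ + p    ≡R.≡⟨ solveᶻ 4 (λ k p e q → k ⊗ (p ⊗ e) ⊕ q ⊗ p ⊜ (q ⊕ k ⊗ e) ⊗ p) ≡.refl k (+ p) (+ (p ^ℕ e′)) q ⟩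
        (q +ᶻ k *ᶻ + (p ^ℕ e′)) *ᶻ + p           ≡R.∎)
        where module ≡R = ≡.≡-Reasoning

    ιᶻ-1-root : ιᶻ 1ℤ * root ≈ root
    ιᶻ-1-root = *-identityˡ root

    p^e∣p^v : ∀ {v z} → e ≤ v → + (p ^ℕ v) ∣ᶻ z → + (p ^ℕ e) ∣ᶻ z
    p^e∣p^v {v} e≤v h = ℤ.∣-trans (ℤ.∣ᵤ⇒∣ (∣.divides (p ^ℕ (v ∸ e)) (p^-split p e≤v))) h

  -- When F contains the roots of order p ^ e, σ fixes w. So d is 1 modulo p ^ e, and d may be
  -- replaced by 1, whose truncated valuation is the largest possible. Minimality forces the same
  -- value on d, which is stronger than the congruence modulo p ^ e.
  d≡1 : ∀ ν → IsRootExponent p U ν → IsRootExponent p (Subfield.member F) ν → + (p ^ℕ suc m) ∣ᶻ (d -ᶻ 1ℤ)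
  d≡1 ν K-roots F-roots = ordered (proj₂ minimal a 1ℤ (shifted (divides 0ℤ ≡.refl) 1-d))
    where
    roots-F : ∀ ν → IsRootExponent p U ν → IsRootExponent p (Subfield.member F) ν → Roots (p ^ℕ e) ⊆ Subfield.member F
    roots-F [ v ] (_ , ¬roots) (roots , _) = μ-monotone {L = Subfield.member F} {e} {v} (e-bounded ¬roots) roots
    roots-F ⊤⁺    _            roots       = roots e
    1-d : + (p ^ℕ e) ∣ᶻ (1ℤ -ᶻ d)
    1-d = order-difference 1ℤ d (trans ιᶻ-1-root (trans (sym (roots-F⇒fixed (roots-F ν K-roots F-roots))) σ-root))
    ordered : _≼_ ξ (a , d) (a , 1ℤ) → + (p ^ℕ suc m) ∣ᶻ (d -ᶻ 1ℤ)
    ordered (inj₁ a<a)     = contradiction a<a (lex-asym a<a)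
    ordered (inj₂ (_ , h)) = proj₂ (valuation-∣ (d -ᶻ 1ℤ) (suc m) h)

  d≡χ : ∀ ν → IsRootExponent p U ν → ∀ χ → IsCyclotomicCharacter ν χ →
        + (p ^ℕ (suc m ⊓⁺ ν)) ∣ᶻ (d -ᶻ residueMod p ν χ (suc m ⊓⁺ ν))
  d≡χ ν roots χ character = ≡.subst (λ k → + (p ^ℕ k) ∣ᶻ (d -ᶻ residueMod p ν χ (suc m ⊓⁺ ν))) (e-min ν roots)
    (order-difference d (residueMod p ν χ (suc m ⊓⁺ ν)) (trans (sym σ-root)
      (trans (*-congˡ root≈w) (trans (σ-μ w) (trans (μ-cong {σˣ w} {w ^ᶻ residueMod p ν χ (suc m ⊓⁺ ν)} (value ν roots χ character))
        (trans (sym (ιᶻ-μ (residueMod p ν χ (suc m ⊓⁺ ν)) w)) (*-congˡ (sym root≈w))))))))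
    where
    value : ∀ ν → IsRootExponent p U ν → ∀ χ → IsCyclotomicCharacter ν χ → σˣ w ≈ˣ w ^ᶻ residueMod p ν χ (suc m ⊓⁺ ν)
    value [ v ] (_ , ¬roots) χ (_ , value) = value w (w-killed {v} (e-bounded ¬roots))
    value ⊤⁺    _            χ (_ , value) = value (suc m) w (w-killed e≤m)

  periodic : ∀ ω ν → IsRootExponent p (Subfield.member F) ω → IsRootExponent p U ν → ω <⁺ ν →
             ∀ d̃ → CongruentMod p ν d̃ d → IsMinimalNormPair ξ a d̃
  periodic ω ⊤⁺ _ _ _ d̃ ≡.refl = minimal
  periodic [ o ] [ v ] (_ , ¬F-roots) K-roots@(_ , ¬roots) AddSupremum.[ o<v ] d̃ d̃-d =
      shifted d̃∈U₁ (p^e∣p^v {v} (e-bounded ¬roots) d̃-d) , λ a′ d′ pair′ → compare {a′} {d′} (proj₂ minimal a′ d′ pair′)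
    where
    d̃-1≡ : (d̃ -ᶻ d) +ᶻ (d -ᶻ 1ℤ) ≡ d̃ -ᶻ 1ℤ
    d̃-1≡ = solveᶻ 2 (λ d̃ d → (d̃ ⊖ d) ⊕ (d ⊖ conᶻ 1ℤ) ⊜ d̃ ⊖ conᶻ 1ℤ) ≡.refl d̃ d
      where open Data.Integer.Solver.+-*-Solver using () renaming (solve to solveᶻ; _:+_ to _⊕_; _:-_ to _⊖_; _:=_ to _⊜_; con to conᶻ)

    divides-d̃-1 : ∀ {k} → k ≤ v → + (p ^ℕ k) ∣ᶻ (d -ᶻ 1ℤ) → + (p ^ℕ k) ∣ᶻ (d̃ -ᶻ 1ℤ)
    divides-d̃-1 {k} k≤v h = ≡.subst (+ (p ^ℕ k) ∣ᶻ_) d̃-1≡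
      (ℤ.∣m∣n⇒∣m+n (ℤ.∣-trans (ℤ.∣ᵤ⇒∣ (∣.divides (p ^ℕ (v ∸ k)) (p^-split p k≤v))) d̃-d) h)

    d̃∈U₁ : + p ∣ᶻ (d̃ -ᶻ 1ℤ)
    d̃∈U₁ = ≡.subst (λ k → + k ∣ᶻ (d̃ -ᶻ 1ℤ)) (ℕ.*-identityʳ p)
      (divides-d̃-1 {1} (ℕ.≤-<-trans z≤n o<v) (≡.subst (λ k → + k ∣ᶻ (d -ᶻ 1ℤ)) (≡.sym (ℕ.*-identityʳ p)) d∈U₁))

    -- Otherwise v < m, so e = v, and σ would fix w, putting μ_{p ^ v} into F although ω < v.
    small : ∀ {k} → k ≤ suc m → + (p ^ℕ k) ∣ᶻ (d -ᶻ 1ℤ) → k ≤ v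
    small {k} k≤m h with k ℕ.≤? v
    ... | yes k≤v = k≤v
    ... | no  k≰v = contradiction (μ-monotone {L = Subfield.member F} o<e (fixed⇒roots-F fixed)) ¬F-roots
      where
      v<m : v < suc m
      v<m = ℕ.<-≤-trans (ℕ.≰⇒> k≰v) k≤m
      e≡v : e ≡ v
      e≡v = ≡.trans (e-min [ v ] K-roots) (ℕ.m≥n⇒m⊓n≡n (ℕ.<⇒≤ v<m))
      o<e : suc o ≤ e
      o<e = ≡.subst (suc o ≤_) (≡.sym e≡v) o<v
      fixed : σᴬ * root ≈ root
      fixed = fixed-by (p^e∣p^v (≡.subst (_≤ k) (≡.sym e≡v) (ℕ.<⇒≤ (ℕ.≰⇒> k≰v))) h)
        where
        fixed-by : + (p ^ℕ e) ∣ᶻ (d -ᶻ 1ℤ) → σᴬ * root ≈ root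
        fixed-by (divides k d-1≡) = linear₄ 1# σ-root root ιd (ιᶻ k * root) (sym (ι-+≡ιᶻ (p ^ℕ e))) (ιᶻ k) (killed ℕ.≤-refl)
          (solve 6 (λ σ r D k e e′ → σ :* r :+ :1 :* (D :* r) :+ r :* (:1 :+ k :* e) :+ k :* r :* e′ :+ k :* con ℤ.0ℤ
            := r :+ :1 :* (σ :* r) :+ r :* D :+ k :* r :* e :+ k :* (e′ :* r)) refl σᴬ root (ιᶻ d) (ιᶻ k) (ιᶻ (+ (p ^ℕ e))) (ι (p ^ℕ e)))
          where
          ιd : ιᶻ d ≈ 1# + ιᶻ k * ιᶻ (+ (p ^ℕ e))
          ιd = trans (reflexive (≡.cong ιᶻ (≡.trans d≡ (≡.cong (1ℤ +ᶻ_) d-1≡)))) (trans (ιᶻ-+ 1ℤ (k *ᶻ + (p ^ℕ e))) (+-congˡ (ιᶻ-* k (+ (p ^ℕ e)))))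
            where
            d≡ : d ≡ 1ℤ +ᶻ (d -ᶻ 1ℤ)
            d≡ = solveᶻ 1 (λ d → d ⊜ conᶻ 1ℤ ⊕ (d ⊖ conᶻ 1ℤ)) ≡.refl d
              where open Data.Integer.Solver.+-*-Solver using () renaming (solve to solveᶻ; _:+_ to _⊕_; _:-_ to _⊖_; _:=_ to _⊜_; con to conᶻ)

    compare : ∀ {a′ d′} → _≼_ ξ (a , d) (a′ , d′) → _≼_ ξ (a , d̃) (a′ , d′)
    compare (inj₁ a<a′)         = inj₁ a<a′
    compare (inj₂ (a≡a′ , h)) = inj₂ (a≡a′ , ℕ.≤-trans h raised)
      where
      -- By `small` the truncated valuation of d - 1 is at most v, so the congruence modulo p ^ v
      -- carries it over to d̃.
      raised : suc m ⊓⁺ valuation p (d -ᶻ 1ℤ) ≤ suc m ⊓⁺ valuation p (d̃ -ᶻ 1ℤ)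
      raised = let k≤m , p^k∣ = valuation-∣ {suc m} (d -ᶻ 1ℤ) (suc m ⊓⁺ valuation p (d -ᶻ 1ℤ)) ℕ.≤-refl in
        ≤-valuation (d̃ -ᶻ 1ℤ) (suc m ⊓⁺ valuation p (d -ᶻ 1ℤ)) k≤m (divides-d̃-1 (small k≤m p^k∣) p^k∣)

open import Data.Nat.Base using (_^_)

theorem1 : ∀ {c ℓ₁ ℓ₂ s} → ExcludedMiddle (c ⊔ ℓ₁ ⊔ ℓ₂ ⊔ s) →
    (K : HeytingField c ℓ₁ ℓ₂) (K̄ : AlgebraicClosure K) →
    let module K = FieldOps K in
    (p n : ℕ) → Prime p → 1 ≤ n → ¬ K.HasCharacteristic p →
    (K/F : CyclicExtension K s p n) →
    let open CyclicExtension K/F in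
    (ω ν : ℕ ⁺) → AlgebraicClosure.IsRootExponent K̄ p (Subfield.member F) ω →
    AlgebraicClosure.IsRootExponent K̄ p U ν →
    (ξ : K.Carrier) → K.IsPrimitiveRoot p ξ → ξ ∈ Subfield.member F →
    (p ≡ 2 → n ≡ 1 → ∃[ u ] (proj₁ (norm n u) K.≈ K.- K.1#)) →
    ¬ (p ≡ 2 × ω ≡ [ 1 ] × ω <⁺ ν) →
    (m : ℕ) → 1 ≤ m →
    (a : Vec Index m) (d : ℤ) → IsMinimalNormPair ξ a d →
    (ω <⁺ ν → ∀ d̃ → CongruentMod p ν d̃ d → IsMinimalNormPair ξ a d̃)
    × (ω ≡ ν → + (p ^ m) ∣ᶻ (d -ᶻ 1ℤ))
    × (∀ (χ : ℤ/ p ^ ν) → IsCyclotomicCharacter ν χ →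
    + (p ^ (m ⊓⁺ ν)) ∣ᶻ (d -ᶻ residueMod p ν χ (m ⊓⁺ ν)))
theorem1 em K K̄ p n p-prime 1≤n _ K/F ω ν F-roots K-roots ξ ξ-root ξ∈F -1-norm _ (suc m) _ a d minimal =
    T.periodic ω ν F-roots K-roots
  , (λ ω≡ν → T.d≡1 ν K-roots (≡.subst (AlgebraicClosure.IsRootExponent K̄ p (Subfield.member (CyclicExtension.F K/F))) ω≡ν F-roots))
  , T.d≡χ ν K-roots
  where
  H : Setup _ _ _ _
  H = record
    { em = em ; K = K ; p-prime = p-prime ; 1≤n = 1≤n ; K/F = K/F ; ξ = ξ ; ξ-root = ξ-root ; ξ∈F = ξ∈F
    ; embedding = unit-embedding K K/F }
  module T = MinimalNormPair H K̄ -1-norm a minimal
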